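{- Let $d\ge 8$ be even. Let $\mathbb F_q$ range over finite fields with $q$ elements whose characteristic is not $2$, and for $E\subset\mathbb F_q^d$ let $\Delta_3(E)=\{\|\mathbf x_1+\mathbf x_2+\mathbf x_3\|: \mathbf x_1,\mathbf x_2,\mathbf x_3\in E\}\subset\mathbb F_q$. Then there is a constant $0<c\le 1$ independent of $q$ such that for every $\varepsilon>0$ there exists $C_\varepsilon>0$ (independent of $q$) with the property: for every such $q$ and every $E\subset\mathbb F_q^d$ with $|E|\ge C_\varepsilon q^{\frac{d+1}{2}-\frac{1}{9d-18}+\varepsilon}$, we have $|\Delta_3(E)|\ge c q$.
   Context: For $\mathbf v=(v_1,\dots,v_d)\in\mathbb F_q^d$, $\|\mathbf v\|=v_1^2+\cdots+v_d^2\in\mathbb F_q$. -}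

module Defs where

open import Level using (0ℓ)
open import Data.Nat as ℕ using (ℕ; zero; suc)
open import Data.Integer as ℤ using (ℤ; +_; -[1+_])
open import Data.Rational as ℚ using (ℚ; 0ℚ; 1ℚ; _/_)
open import Data.Fin using (Fin)
open import Data.Vec using (Vec; zipWith; foldr)
open import Data.List using (List; length)
open import Data.List.Membership.Propositional using (_∈_)
open import Data.List.Relation.Unary.Unique.Propositional using (Unique)
open import Data.Product using (Σ; ∃; ∃-syntax; _×_)
open import Relation.Binary.PropositionalEquality using (_≡_)
open import Relation.Nullary using (¬_)
open import Relation.Binary.Definitions using (DecidableEquality)
open import Algebra.Structures using (IsCommutativeRing)

record FiniteField : Set₁ where
  infixl 7 _*_
  infixl 6 _+_
  field
    F      : Set
    _+_    : F → F → F
    _*_    : F → F → F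
    -_     : F → F
    0#     : F
    1#     : F
    isCommutativeRing : IsCommutativeRing _≡_ _+_ _*_ -_ 0# 1#
    0≢1    : ¬ (0# ≡ 1#)
    inverse : ∀ x → ¬ (x ≡ 0#) → ∃[ y ] (x * y ≡ 1#)
    _≟_    : DecidableEquality F
    elements : List F
    complete : ∀ x → x ∈ elements
    distinct : Unique elements

  size : ℕ
  size = length elements

  CharNot2 : Set
  CharNot2 = ¬ (1# + 1# ≡ 0#)

  _⊕_ : ∀ {d} → Vec F d → Vec F d → Vec F d
  _⊕_ = zipWith _+_

  ‖_‖ : ∀ {d} → Vec F d → F
  ‖ v ‖ = foldr _ (λ a s → a * a + s) 0# v

  InΔ₃ : ∀ {d} → List (Vec F d) → F → Set
  InΔ₃ E t = ∃[ x₁ ] ∃[ x₂ ] ∃[ x₃ ]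
    (x₁ ∈ E × x₂ ∈ E × x₃ ∈ E × ‖ (x₁ ⊕ x₂) ⊕ x₃ ‖ ≡ t)

ℕ→ℚ : ℕ → ℚ
ℕ→ℚ n = + n / 1

_^ℚ_ : ℚ → ℕ → ℚ
x ^ℚ zero  = 1ℚ
x ^ℚ suc n = x ℚ.* (x ^ℚ n)

-- The exponent (d+1)/2 - 1/(9d-18)  (only used for d ≥ 8; value for d < 3 is a dummy)
expo : ℕ → ℚ
expo (suc (suc (suc k))) = (+ (4 ℕ.+ k)) / 2 ℚ.- (+ 1) / (9 ℕ.* suc k)
expo _ = 0ℚ

-- AtLeastCPow x C q e  means  x ≥ C · q^e  (for x ≥ 0, C > 0, q > 0 real),
-- written exactly via e = p/n:  x^n ≥ C^n · q^p.
AtLeastCPow : ℚ → ℚ → ℕ → ℚ → Set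
AtLeastCPow x C q e with ℚ.↥ e
... | + k      = (C ^ℚ n) ℚ.* (ℕ→ℚ q ^ℚ k) ℚ.≤ (x ^ℚ n)
  where n = ℚ.denominatorℕ e
... | -[1+ k ] = (C ^ℚ n) ℚ.≤ (x ^ℚ n) ℚ.* (ℕ→ℚ q ^ℚ suc k)
  where n = ℚ.denominatorℕ e

{-# OPTIONS --safe #-}
-- Write d = 2k, N = |E| and w(m) = |Ê(m)|², and let ν(t) count the triples of E with ‖x₁ + x₂ + x₃‖ = t.
-- By Cauchy–Schwarz it suffices that ∑_{t≠0} ν(t)² ≲ N⁶/q and ν(0) ≤ ¾N³. Completing squares turns this into a
-- bound for ∑_{r≠0} |∑_{‖m‖=r} Ê(m)³|²; the spheres t = 0 and r = 0 are harmless because d is even, so that the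
-- Gauss sum of s‖·‖ does not depend on s ≠ 0. For r ≠ 0 one bounds U = ∑_{‖m‖=r} w(m)². Positivity gives
-- U² ≤ N² ∑_{‖a‖=‖b‖=r} w(a) w(b) w(a - b), and ‖a‖ = ‖a + z‖ = r puts a on the hyperplane ‖z‖ + 2a·z = 0, so a large
-- U makes many pairs (a, z) incident. Taking k-th moments over z produces k hyperplanes; unless one z is dependent on
-- the others (few choices), they meet in an affine k-space, and this cannot lie in the sphere, since a totally
-- isotropic k-space is its own orthogonal complement. Hence the section has at most 2qᵏ⁻¹ points, which is enough.
-- Complex numbers are replaced by the group ring of the additive group of the field, where every inequality
-- used has a sum-of-norms certificate.
module Submission where

open import Level using (0ℓ)
open import Data.Nat as ℕ using (ℕ; zero; suc; _≤_)
import Data.Nat.Properties as ℕP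
open import Data.Integer as ℤ using (ℤ; +_; -[1+_])
import Data.Integer.Properties as ℤP
open import Data.Maybe using (Maybe; just; nothing)
open import Data.List using (List; []; _∷_; _++_; length; map; filter; cartesianProductWith)
open import Data.List.Membership.Propositional using (_∈_; find)
open import Data.List.Relation.Unary.Any using (here; there; any?)
open import Data.List.Relation.Unary.All as All using (All; []; _∷_)
open import Data.List.Relation.Unary.AllPairs using ([]; _∷_)
open import Data.List.Relation.Unary.Unique.Propositional using (Unique)
open import Data.Product using (∃-syntax; _×_; _,_; proj₁; proj₂)
open import Data.Sum using (_⊎_; inj₁; inj₂)
open import Data.Empty using (⊥; ⊥-elim)
open import Relation.Nullary using (¬_; Dec; yes; no)
open import Relation.Nullary.Decidable using (_×-dec_; ¬?; toWitness)
open import Relation.Binary.Definitions using (DecidableEquality)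
open import Relation.Binary.PropositionalEquality as ≡ using (_≡_; _≢_; refl)
open import Algebra.Bundles using (CommutativeRing; CommutativeSemiring; RawRing)
import Algebra.Solver.Ring as Solver
import Algebra.Solver.Ring.AlmostCommutativeRing as ACR
import Algebra.Properties.Ring as RingProperties
import Algebra.Properties.AbelianGroup as AbelianGroupProperties
import Algebra.Properties.CommutativeSemigroup as CommutativeSemigroupProperties
import Algebra.Properties.Semiring.Mult.TCOptimised as Mult
import Relation.Binary.Reasoning.Setoid as SetoidReasoning
open import Defs
open import Relation.Binary.Bundles using (Preorder)
import Algebra.Properties.Semiring.Exp as Exp
import Relation.Binary.Reasoning.Preorder as PreorderReasoning
open import Data.List.Properties using (length-++; length-map)
open import Data.List.Membership.Propositional.Properties using (∈-cartesianProductWith⁺; ∈-filter⁺; ∈-filter⁻; ∈-cartesianProductWith⁻)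
open import Data.List.Relation.Unary.Unique.Propositional.Properties using (cartesianProductWith⁺; filter⁺)
open import Data.Vec using (Vec; []; _∷_; replicate) renaming (map to mapᵛ)
open import Data.Vec.Properties using (≡-dec; ∷-injective)
open import Data.Nat.Solver using (module +-*-Solver)
open import Data.List.Relation.Unary.All.Properties using (¬All⇒Any¬; all-filter)
import Algebra.Properties.CommutativeSemiring.Exp as CommutativeExp
open import Data.Nat.Divisibility using (_∣_; divides)
open import Data.Rational as ℚ using (ℚ; 0ℚ; 1ℚ; mkℚ; toℚᵘ)
import Data.Rational.Properties as ℚP
open import Data.Rational.Unnormalised as ℚᵘ using (ℚᵘ; mkℚᵘ)
import Data.Rational.Unnormalised.Properties as ℚᵘP
import Data.Nat.Coprimality as Coprimality

-- The sizes are dictated by the end. Let W(r) be the sum of w over the sphere of radius r.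
-- Cauchy-Schwarz gives |∑ Ê³|² ≤ W(r) U(r), and ∑ W(r) = q^d N by Parseval, so qU ≤ 2N⁵ for each r
-- ≠ 0 is enough. As U² ≤ N⁴ I with I a weighted count of incidences (a, z), the aim is I ≲ N⁶/q².
-- Points a whose z have total weight at most N⁵/q^(d+2) contribute no more than this; the others
-- are controlled by the k-th moment, of order N² q^(k-1) (q^d N)^k, and the two parts match when
-- N^(4k-1) ≥ q^(4k²+k-1). The value t = 0 stands apart because the sphere r = 0 enters the formula
-- for ν(t) with weight -1 if t ≠ 0, but with weight q - 1 if t = 0; hence only the size of ν(0) is
-- bounded. Division is not at hand in the ring. Estimates are therefore multiplied by positive
-- natural numbers, which are cancelled after a return to ℕ through `NonNeg-reflect`. Likewise
-- subspaces are measured by cardinality instead of dimension, so that no basis has to be chosen.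

module IntegerSolver (R : CommutativeRing 0ℓ 0ℓ) where
  open CommutativeRing R renaming (refl to ≈-refl)
  open RingProperties ring using (-‿distribˡ-*; -‿distribʳ-*; -‿involutive; -0#≈0#)
  open AbelianGroupProperties +-abelianGroup using (⁻¹-∙-comm)
  open CommutativeSemigroupProperties +-commutativeSemigroup using (interchange)
  open Mult semiring using (×-homo-+; ×1-homo-*) renaming (_×_ to _·_)
  open SetoidReasoning setoid

  ⟦_⟧ : ℤ → Carrier
  ⟦ + n ⟧ = n · 1#
  ⟦ -[1+ n ] ⟧ = - (suc n · 1#)

  ⟦⟧-neg : ∀ i → ⟦ ℤ.- i ⟧ ≈ - ⟦ i ⟧
  ⟦⟧-neg (+ zero) = sym -0#≈0#
  ⟦⟧-neg (+ suc n) = ≈-refl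
  ⟦⟧-neg -[1+ n ] = sym (-‿involutive _)

  ⟦⟧-⊖ : ∀ m n → ⟦ m ℤ.⊖ n ⟧ ≈ m · 1# - n · 1#
  ⟦⟧-⊖ m zero = begin
    m · 1#           ≈⟨ +-identityʳ _ ⟨
    m · 1# + 0#      ≈⟨ +-congˡ -0#≈0# ⟨
    m · 1# + - 0#    ∎
  ⟦⟧-⊖ zero (suc n) = sym (+-identityˡ _)
  ⟦⟧-⊖ (suc m) (suc n) = begin
    ⟦ suc m ℤ.⊖ suc n ⟧                ≡⟨ ≡.cong ⟦_⟧ (ℤP.[1+m]⊖[1+n]≡m⊖n m n) ⟩
    ⟦ m ℤ.⊖ n ⟧                        ≈⟨ ⟦⟧-⊖ m n ⟩
    m · 1# - n · 1#                    ≈⟨ +-identityˡ _ ⟨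
    0# + (m · 1# - n · 1#)             ≈⟨ +-congʳ (-‿inverseʳ 1#) ⟨
    1# - 1# + (m · 1# - n · 1#)        ≈⟨ interchange _ _ _ _ ⟩
    1# + m · 1# + (- 1# - n · 1#)      ≈⟨ +-cong (×-homo-+ 1# 1 m) (trans (-‿cong (×-homo-+ 1# 1 n)) (sym (⁻¹-∙-comm _ _))) ⟨
    suc m · 1# - suc n · 1#            ∎

  ⟦⟧-+ : ∀ i j → ⟦ i ℤ.+ j ⟧ ≈ ⟦ i ⟧ + ⟦ j ⟧
  ⟦⟧-+ (+ m) (+ n) = ×-homo-+ 1# m n
  ⟦⟧-+ (+ m) -[1+ n ] = ⟦⟧-⊖ m (suc n)
  ⟦⟧-+ -[1+ m ] (+ n) = trans (⟦⟧-⊖ n (suc m)) (+-comm _ _)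
  ⟦⟧-+ -[1+ m ] -[1+ n ] = begin
    - (suc (suc (m ℕ.+ n)) · 1#)          ≡⟨ ≡.cong (λ l → - (suc l · 1#)) (ℕP.+-suc m n) ⟨
    - ((suc m ℕ.+ suc n) · 1#)            ≈⟨ -‿cong (×-homo-+ 1# (suc m) (suc n)) ⟩
    - (suc m · 1# + suc n · 1#)           ≈⟨ ⁻¹-∙-comm _ _ ⟨
    - (suc m · 1#) + - (suc n · 1#)       ∎

  ⟦⟧-pos* : ∀ m j → ⟦ + m ℤ.* j ⟧ ≈ m · 1# * ⟦ j ⟧
  ⟦⟧-pos* m (+ n) = trans (reflexive (≡.cong ⟦_⟧ (≡.sym (ℤP.pos-* m n)))) (×1-homo-* m n)
  ⟦⟧-pos* m -[1+ n ] = begin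
    ⟦ + m ℤ.* -[1+ n ] ⟧          ≡⟨ ≡.cong ⟦_⟧ (ℤP.neg-distribʳ-* (+ m) (+ suc n)) ⟨
    ⟦ ℤ.- (+ m ℤ.* + suc n) ⟧     ≈⟨ ⟦⟧-neg (+ m ℤ.* + suc n) ⟩
    - ⟦ + m ℤ.* + suc n ⟧         ≈⟨ -‿cong (⟦⟧-pos* m (+ suc n)) ⟩
    - (m · 1# * (suc n · 1#))     ≈⟨ -‿distribʳ-* _ _ ⟩
    m · 1# * - (suc n · 1#)       ∎

  ⟦⟧-* : ∀ i j → ⟦ i ℤ.* j ⟧ ≈ ⟦ i ⟧ * ⟦ j ⟧
  ⟦⟧-* (+ m) j = ⟦⟧-pos* m j
  ⟦⟧-* -[1+ m ] j = begin
    ⟦ -[1+ m ] ℤ.* j ⟧         ≡⟨ ≡.cong ⟦_⟧ (ℤP.neg-distribˡ-* (+ suc m) j) ⟨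
    ⟦ ℤ.- (+ suc m ℤ.* j) ⟧    ≈⟨ ⟦⟧-neg (+ suc m ℤ.* j) ⟩
    - ⟦ + suc m ℤ.* j ⟧        ≈⟨ -‿cong (⟦⟧-pos* (suc m) j) ⟩
    - (suc m · 1# * ⟦ j ⟧)     ≈⟨ -‿distribˡ-* _ _ ⟩
    - (suc m · 1#) * ⟦ j ⟧     ∎

  ℤ-rawRing : RawRing 0ℓ 0ℓ
  ℤ-rawRing = record
    { Carrier = ℤ ; _≈_ = _≡_ ; _+_ = ℤ._+_ ; _*_ = ℤ._*_ ; -_ = ℤ.-_ ; 0# = + 0 ; 1# = + 1 }

  homomorphism : ℤ-rawRing ACR.-Raw-AlmostCommutative⟶ ACR.fromCommutativeRing R
  homomorphism = record
    { ⟦_⟧ = ⟦_⟧ ; +-homo = ⟦⟧-+ ; *-homo = ⟦⟧-* ; -‿homo = ⟦⟧-neg ; 0-homo = ≈-refl ; 1-homo = ≈-refl }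

  -- An arbitrary ring comes without a decision procedure for its equality, so coefficients are
  -- compared as integers; `nothing` only means that the normaliser gets no help.
  coefficient≟ : ∀ i j → Maybe (⟦ i ⟧ ≈ ⟦ j ⟧)
  coefficient≟ i j with i ℤ.≟ j
  ... | yes i≡j = just (reflexive (≡.cong ⟦_⟧ i≡j))
  ... | no _ = nothing

  open Solver ℤ-rawRing (ACR.fromCommutativeRing R) homomorphism coefficient≟ public
    using (solve; _:=_; _:+_; _:*_; _:-_; :-_; con; _:^_)

-- Finite sums and indicators in a commutative semiring

module Summation (S : CommutativeSemiring 0ℓ 0ℓ) where
  open CommutativeSemiring S renaming (refl to ≈-refl)
  open CommutativeSemigroupProperties +-commutativeSemigroup using (interchange)
  open SetoidReasoning setoid

  private
    variable
      A B : Set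

  ∑ : List A → (A → Carrier) → Carrier
  ∑ [] f = 0#
  ∑ (x ∷ xs) f = f x + ∑ xs f

  infix 5 ∑
  syntax ∑ xs (λ x → e) = ∑[ x ← xs ] e

  ∑-cong : ∀ (xs : List A) {f g : A → Carrier} → (∀ x → f x ≈ g x) → ∑ xs f ≈ ∑ xs g
  ∑-cong [] p = ≈-refl
  ∑-cong (x ∷ xs) p = +-cong (p x) (∑-cong xs p)

  ∑-cong-∈ : ∀ (xs : List A) {f g : A → Carrier} → (∀ {x} → x ∈ xs → f x ≈ g x) → ∑ xs f ≈ ∑ xs g
  ∑-cong-∈ [] p = ≈-refl
  ∑-cong-∈ (x ∷ xs) p = +-cong (p (here refl)) (∑-cong-∈ xs (λ x∈ → p (there x∈)))

  ∑-0 : ∀ (xs : List A) → ∑[ x ← xs ] 0# ≈ 0#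
  ∑-0 [] = ≈-refl
  ∑-0 (x ∷ xs) = trans (+-identityˡ _) (∑-0 xs)

  ∑-+ : ∀ (xs : List A) (f g : A → Carrier) → ∑[ x ← xs ] (f x + g x) ≈ ∑ xs f + ∑ xs g
  ∑-+ [] f g = sym (+-identityˡ _)
  ∑-+ (x ∷ xs) f g = trans (+-congˡ (∑-+ xs f g)) (interchange _ _ _ _)

  ∑-*ˡ : ∀ (xs : List A) c (f : A → Carrier) → ∑[ x ← xs ] (c * f x) ≈ c * ∑ xs f
  ∑-*ˡ [] c f = sym (zeroʳ c)
  ∑-*ˡ (x ∷ xs) c f = trans (+-congˡ (∑-*ˡ xs c f)) (sym (distribˡ _ _ _))

  ∑-*ʳ : ∀ (xs : List A) c (f : A → Carrier) → ∑[ x ← xs ] (f x * c) ≈ ∑ xs f * c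
  ∑-*ʳ xs c f = begin
    ∑[ x ← xs ] (f x * c)    ≈⟨ ∑-cong xs (λ x → *-comm _ _) ⟩
    ∑[ x ← xs ] (c * f x)    ≈⟨ ∑-*ˡ xs c f ⟩
    c * ∑ xs f               ≈⟨ *-comm _ _ ⟩
    ∑ xs f * c               ∎

  ∑-*-∑ : ∀ (xs : List A) (ys : List B) (f : A → Carrier) (g : B → Carrier) →
          ∑ xs f * ∑ ys g ≈ ∑[ x ← xs ] (∑[ y ← ys ] (f x * g y))
  ∑-*-∑ xs ys f g = begin
    ∑ xs f * ∑ ys g                           ≈⟨ ∑-*ʳ xs _ f ⟨
    ∑[ x ← xs ] (f x * ∑ ys g)                ≈⟨ ∑-cong xs (λ x → ∑-*ˡ ys _ g) ⟨
    ∑[ x ← xs ] (∑[ y ← ys ] (f x * g y))     ∎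

  ∑-swap : ∀ (xs : List A) (ys : List B) (f : A → B → Carrier) →
           ∑[ x ← xs ] (∑[ y ← ys ] f x y) ≈ ∑[ y ← ys ] (∑[ x ← xs ] f x y)
  ∑-swap [] ys f = sym (∑-0 ys)
  ∑-swap (x ∷ xs) ys f = trans (+-congˡ (∑-swap xs ys f)) (sym (∑-+ ys _ _))

  [_] : ∀ {P : Set} → Dec P → Carrier
  [ yes _ ] = 1#
  [ no _ ] = 0#

  []-yes : ∀ {P : Set} (P? : Dec P) → P → [ P? ] ≈ 1#
  []-yes (yes _) p = ≈-refl
  []-yes (no ¬p) p = ⊥-elim (¬p p)

  []-no : ∀ {P : Set} (P? : Dec P) → ¬ P → [ P? ] ≈ 0#
  []-no (yes p) ¬p = ⊥-elim (¬p p)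
  []-no (no _) _ = ≈-refl

  []-cong : ∀ {P Q : Set} (P? : Dec P) (Q? : Dec Q) → (P → Q) → (Q → P) → [ P? ] ≈ [ Q? ]
  []-cong (yes p) Q? f g = sym ([]-yes Q? (f p))
  []-cong (no ¬p) Q? f g = sym ([]-no Q? (λ q → ¬p (g q)))

  []-× : ∀ {P Q : Set} (P? : Dec P) (Q? : Dec Q) → [ P? ×-dec Q? ] ≈ [ P? ] * [ Q? ]
  []-× (yes _) (yes _) = sym (*-identityˡ _)
  []-× (yes _) (no _) = sym (*-identityˡ _)
  []-× (no _) Q? = sym (zeroˡ _)

  []-¬ : ∀ {P : Set} (P? : Dec P) → [ P? ] + [ ¬? P? ] ≈ 1#
  []-¬ (yes _) = +-identityʳ _
  []-¬ (no _) = +-identityˡ _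

  []-idem : ∀ {P : Set} (P? : Dec P) → [ P? ] * [ P? ] ≈ [ P? ]
  []-idem (yes _) = *-identityˡ _
  []-idem (no _) = zeroˡ _

  []-*-cong : ∀ {P : Set} (P? : Dec P) {x y} → (P → x ≈ y) → [ P? ] * x ≈ [ P? ] * y
  []-*-cong (yes p) h = *-congˡ (h p)
  []-*-cong (no _) h = trans (zeroˡ _) (sym (zeroˡ _))

  ∑-++ : ∀ (xs ys : List A) (f : A → Carrier) → ∑ (xs ++ ys) f ≈ ∑ xs f + ∑ ys f
  ∑-++ [] ys f = sym (+-identityˡ _)
  ∑-++ (x ∷ xs) ys f = trans (+-congˡ (∑-++ xs ys f)) (sym (+-assoc _ _ _))

  ∑-map : ∀ (xs : List A) (g : A → B) (f : B → Carrier) → ∑ (map g xs) f ≈ ∑[ x ← xs ] f (g x)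
  ∑-map [] g f = ≈-refl
  ∑-map (x ∷ xs) g f = +-congˡ (∑-map xs g f)

  ∑-cartesianProductWith : ∀ {D : Set} (g : A → B → D) (xs : List A) (ys : List B) (f : D → Carrier) →
    ∑ (cartesianProductWith g xs ys) f ≈ ∑[ x ← xs ] (∑[ y ← ys ] f (g x y))
  ∑-cartesianProductWith g [] ys f = ≈-refl
  ∑-cartesianProductWith g (x ∷ xs) ys f =
    trans (∑-++ (map (g x) ys) _ f) (+-cong (∑-map ys (g x) f) (∑-cartesianProductWith g xs ys f))

  ∑-filter : ∀ {P : A → Set} (P? : ∀ x → Dec (P x)) (xs : List A) (f : A → Carrier) →
             ∑ (filter P? xs) f ≈ ∑[ x ← xs ] ([ P? x ] * f x)
  ∑-filter P? [] f = ≈-refl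
  ∑-filter P? (x ∷ xs) f with P? x
  ... | yes _ = +-cong (sym (*-identityˡ _)) (∑-filter P? xs f)
  ... | no _ = trans (∑-filter P? xs f) (trans (sym (+-identityˡ _)) (+-congʳ (sym (zeroˡ _))))

  module _ {A : Set} (_≟_ : DecidableEquality A) where

    ∑-pick-∉ : ∀ (f : A → Carrier) {xs} y → All (y ≢_) xs → ∑[ x ← xs ] ([ x ≟ y ] * f x) ≈ 0#
    ∑-pick-∉ f y [] = ≈-refl
    ∑-pick-∉ f {x ∷ xs} y (y≢x ∷ ps) = begin
      [ x ≟ y ] * f x + (∑[ x ← xs ] ([ x ≟ y ] * f x))
        ≈⟨ +-cong (*-congʳ ([]-no (x ≟ y) (λ e → y≢x (≡.sym e)))) (∑-pick-∉ f y ps) ⟩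
      0# * f x + 0#
        ≈⟨ trans (+-identityʳ _) (zeroˡ _) ⟩
      0# ∎

    ∑-pick : ∀ (f : A → Carrier) {xs y} → Unique xs → y ∈ xs → ∑[ x ← xs ] ([ x ≟ y ] * f x) ≈ f y
    ∑-pick f {y ∷ xs} (u ∷ us) (here refl) = begin
      [ y ≟ y ] * f y + (∑[ x ← xs ] ([ x ≟ y ] * f x))
        ≈⟨ +-cong (*-congʳ ([]-yes (y ≟ y) refl)) (∑-pick-∉ f y u) ⟩
      1# * f y + 0#
        ≈⟨ trans (+-identityʳ _) (*-identityˡ _) ⟩
      f y ∎
    ∑-pick f {z ∷ xs} {y} (u ∷ us) (there y∈xs) = begin
      [ z ≟ y ] * f z + (∑[ x ← xs ] ([ x ≟ y ] * f x))
        ≈⟨ +-cong (*-congʳ ([]-no (z ≟ y) (All.lookup u y∈xs))) (∑-pick f us y∈xs) ⟩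
      0# * f z + f y
        ≈⟨ trans (+-congʳ (zeroˡ _)) (+-identityˡ _) ⟩
      f y ∎

record Enumeration (A : Set) : Set where
  field
    _≟_      : DecidableEquality A
    list     : List A
    complete : ∀ x → x ∈ list
    unique   : Unique list

module EnumSummation (S : CommutativeSemiring 0ℓ 0ℓ) {A : Set} (enum : Enumeration A) where
  open CommutativeSemiring S hiding (refl)
  open Summation S
  open Enumeration enum
  open SetoidReasoning setoid

  pick : ∀ (f : A → Carrier) y → ∑[ x ← list ] ([ x ≟ y ] * f x) ≈ f y
  pick f y = ∑-pick _≟_ f unique (complete y)

  count-≡ : ∀ y → ∑[ x ← list ] [ x ≟ y ] ≈ 1#
  count-≡ y = trans (∑-cong list (λ x → sym (*-identityʳ _))) (pick (λ _ → 1#) y)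

  -- No permutation of the list is constructed: the sum is spread over all pairs (x, y) with y = φ
  -- x, the order of summation is exchanged, and each y has the single preimage ψ y.
  ∑-reindex : ∀ (φ ψ : A → A) → (∀ x → φ (ψ x) ≡ x) → (∀ x → ψ (φ x) ≡ x) →
              ∀ (f : A → Carrier) → ∑[ x ← list ] f (φ x) ≈ ∑ list f
  ∑-reindex φ ψ φψ ψφ f = begin
    ∑[ x ← list ] f (φ x)
      ≈⟨ ∑-cong list (λ x → pick f (φ x)) ⟨
    ∑[ x ← list ] (∑[ y ← list ] ([ y ≟ φ x ] * f y))
      ≈⟨ ∑-swap list list _ ⟩
    ∑[ y ← list ] (∑[ x ← list ] ([ y ≟ φ x ] * f y))
      ≈⟨ ∑-cong list (λ y → ∑-*ʳ list (f y) _) ⟩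
    ∑[ y ← list ] ((∑[ x ← list ] [ y ≟ φ x ]) * f y)
      ≈⟨ ∑-cong list (λ y → *-congʳ (trans (∑-cong list (λ x → flip x y)) (count-≡ (ψ y)))) ⟩
    ∑[ y ← list ] (1# * f y)
      ≈⟨ ∑-cong list (λ y → *-identityˡ _) ⟩
    ∑ list f ∎
    where
    flip : ∀ x y → [ y ≟ φ x ] ≈ [ x ≟ ψ y ]
    flip x y = []-cong (y ≟ φ x) (x ≟ ψ y)
      (λ e → ≡.trans (≡.sym (ψφ x)) (≡.cong ψ (≡.sym e)))
      (λ e → ≡.trans (≡.sym (φψ y)) (≡.cong φ (≡.sym e)))

-- Finite fields and the axioms for a ring of character values

fieldRing : FiniteField → CommutativeRing 0ℓ 0ℓ
fieldRing K = record { isCommutativeRing = FiniteField.isCommutativeRing K }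

fieldEnumeration : (K : FiniteField) → Enumeration (FiniteField.F K)
fieldEnumeration K = record
  { _≟_ = FiniteField._≟_ K
  ; list = FiniteField.elements K
  ; complete = FiniteField.complete K
  ; unique = FiniteField.distinct K
  }

-- Stands in for the complex numbers: χ is a nontrivial additive character of K,
-- and NonNeg x means that x is a nonnegative real number.
record CharacterRing (K : FiniteField) : Set₁ where
  open FiniteField K using (F; elements) renaming (_+_ to _+ᶠ_; -_ to -ᶠ_; 0# to 0ᶠ)
  field
    ring : CommutativeRing 0ℓ 0ℓ
  open CommutativeRing ring
  open Summation commutativeSemiring using (∑)
  open Mult semiring using () renaming (_×_ to _·_)
  field
    conj           : Carrier → Carrier
    conj-cong      : ∀ {x y} → x ≈ y → conj x ≈ conj y
    conj-+         : ∀ x y → conj (x + y) ≈ conj x + conj y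
    conj-*         : ∀ x y → conj (x * y) ≈ conj x * conj y
    conj-neg       : ∀ x → conj (- x) ≈ - conj x
    conj-0         : conj 0# ≈ 0#
    conj-1         : conj 1# ≈ 1#
    conj-conj      : ∀ x → conj (conj x) ≈ x
    NonNeg         : Carrier → Set
    NonNeg-resp    : ∀ {x y} → x ≈ y → NonNeg x → NonNeg y
    NonNeg-+       : ∀ {x y} → NonNeg x → NonNeg y → NonNeg (x + y)
    NonNeg-*       : ∀ {x y} → NonNeg x → NonNeg y → NonNeg (x * y)
    NonNeg-norm    : ∀ x → NonNeg (x * conj x)
    NonNeg-real    : ∀ {x} → NonNeg x → conj x ≈ x
    NonNeg-reflect : ∀ {m n} → NonNeg (n · 1# - m · 1#) → m ℕ.≤ n
    χ              : F → Carrier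
    χ-+            : ∀ a b → χ (a +ᶠ b) ≈ χ a * χ b
    χ-0            : χ 0ᶠ ≈ 1#
    conj-χ         : ∀ a → conj (χ a) ≈ χ (-ᶠ a)
    ∑-χ            : ∑ elements χ ≈ 0#

-- A model of the axioms: the group ring modulo constants

length≥2 : ∀ {A : Set} {x y : A} {xs : List A} → x ≢ y → x ∈ xs → y ∈ xs → 2 ℕ.≤ length xs
length≥2 x≢y (here refl) (here refl) = ⊥-elim (x≢y refl)
length≥2 x≢y (here refl) (there {xs = _ ∷ _} _) = ℕ.s≤s (ℕ.s≤s ℕ.z≤n)
length≥2 x≢y (there {xs = _ ∷ _} _) _ = ℕ.s≤s (ℕ.s≤s ℕ.z≤n)

size≥2 : (K : FiniteField) → 2 ℕ.≤ FiniteField.size K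
size≥2 K = length≥2 (FiniteField.0≢1 K) (FiniteField.complete K (FiniteField.0# K)) (FiniteField.complete K (FiniteField.1# K))

i*i≥0 : ∀ i → + 0 ℤ.≤ i ℤ.* i
i*i≥0 (+ n) = ≡.subst (+ 0 ℤ.≤_) (ℤP.pos-* n n) (ℤ.+≤+ ℕ.z≤n)
i*i≥0 -[1+ n ] = ℤ.+≤+ ℕ.z≤n

-- The group ring ℤ[F] modulo the constant functions; on the quotient, the trace q f(0) - ∑ f
-- is the sum over the nontrivial characters.
module GroupRing (K : FiniteField) where
  open FiniteField K using (F; elements; size; _≟_) renaming (0# to 0ᶠ)
  module 𝔽 = CommutativeRing (fieldRing K)
  open 𝔽 using () renaming (_+_ to _+ᶠ_; -_ to -ᶠ_; _-_ to _-ᶠ_)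
  module FS = IntegerSolver (fieldRing K)
  module ℤR = CommutativeRing ℤP.+-*-commutativeRing
  open Summation ℤR.commutativeSemiring
  open EnumSummation ℤR.commutativeSemiring (fieldEnumeration K)
  module ℤS = IntegerSolver ℤP.+-*-commutativeRing
  open import Data.Integer using (_+_; _*_; -_; _-_)
  open ≡.≡-Reasoning

  infixl 7 _⊛_
  infixl 6 _⊞_
  _⊛_ : (F → ℤ) → (F → ℤ) → F → ℤ
  (f ⊛ g) x = ∑[ y ← elements ] (f y * g (x -ᶠ y))

  _⊞_ : (F → ℤ) → (F → ℤ) → F → ℤ
  (f ⊞ g) x = f x + g x

  ⊟_ : (F → ℤ) → F → ℤ
  (⊟ f) x = - f x

  δ : F → F → ℤ
  δ a x = [ x ≟ a ]

  infix 4 _≈_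
  -- The constant function 1 is the sum of all `δ a`, so identifying functions that differ by a
  -- constant is exactly what makes the sum of the character vanish.
  record _≈_ (f g : F → ℤ) : Set where
    constructor offset
    field
      c     : ℤ
      f≡g+c : ∀ x → f x ≡ g x + c

  pointwise : ∀ {f g : F → ℤ} → (∀ x → f x ≡ g x) → f ≈ g
  pointwise p = offset (+ 0) λ x → ≡.trans (p x) (≡.sym (ℤP.+-identityʳ _))

  ≈-sym : ∀ {f g} → f ≈ g → g ≈ f
  ≈-sym {f} {g} (offset c p) = offset (- c) λ x → begin
    g x               ≡⟨ ℤS.solve 2 (λ a b → a ℤS.:= a ℤS.:+ b ℤS.:- b) refl (g x) c ⟩
    g x + c - c       ≡⟨ ≡.cong (_- c) (p x) ⟨
    f x - c           ∎

  ≈-trans : ∀ {f g h} → f ≈ g → g ≈ h → f ≈ h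
  ≈-trans {f} {g} {h} (offset c p) (offset d r) = offset (d + c) λ x → begin
    f x            ≡⟨ p x ⟩
    g x + c        ≡⟨ ≡.cong (_+ c) (r x) ⟩
    h x + d + c    ≡⟨ ℤP.+-assoc (h x) d c ⟩
    h x + (d + c)  ∎

  ⊞-cong : ∀ {f g f′ g′} → f ≈ f′ → g ≈ g′ → f ⊞ g ≈ f′ ⊞ g′
  ⊞-cong {f′ = f′} {g′} (offset c p) (offset d r) = offset (c + d) λ x →
    ≡.trans (≡.cong₂ _+_ (p x) (r x))
      (ℤS.solve 4 (λ a b c d → (a ℤS.:+ c) ℤS.:+ (b ℤS.:+ d) ℤS.:= (a ℤS.:+ b) ℤS.:+ (c ℤS.:+ d)) refl (f′ x) (g′ x) c d)

  ⊟-cong : ∀ {f g} → f ≈ g → ⊟ f ≈ ⊟ g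
  ⊟-cong {f} {g} (offset c p) = offset (- c) λ x → ≡.trans (≡.cong -_ (p x)) (ℤP.neg-distrib-+ (g x) c)

  -‿-‿cancel : ∀ x y → x -ᶠ (x -ᶠ y) ≡ y
  -‿-‿cancel = FS.solve 2 (λ x y → x FS.:- (x FS.:- y) FS.:= y) refl

  ∑-reflect : ∀ x (f : F → ℤ) → ∑[ y ← elements ] f (x -ᶠ y) ≡ ∑ elements f
  ∑-reflect x = ∑-reindex (λ y → x -ᶠ y) (λ y → x -ᶠ y) (-‿-‿cancel x) (-‿-‿cancel x)

  ⊛-comm : ∀ f g x → (f ⊛ g) x ≡ (g ⊛ f) x
  ⊛-comm f g x = begin
    ∑[ y ← elements ] (f y * g (x -ᶠ y))
      ≡⟨ ∑-reflect x (λ y → f y * g (x -ᶠ y)) ⟨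
    ∑[ y ← elements ] (f (x -ᶠ y) * g (x -ᶠ (x -ᶠ y)))
      ≡⟨ ∑-cong elements (λ y → ≡.trans (≡.cong (λ z → f (x -ᶠ y) * g z) (-‿-‿cancel x y)) (ℤP.*-comm _ (g y))) ⟩
    ∑[ y ← elements ] (g y * f (x -ᶠ y)) ∎

  -- Constants form an ideal: the convolution of f with the constant c is the constant (∑ f) c.
  ⊛-congˡ : ∀ f {g g′} → g ≈ g′ → f ⊛ g ≈ f ⊛ g′
  ⊛-congˡ f {g} {g′} (offset c p) = offset (∑ elements f * c) λ x → begin
    ∑[ y ← elements ] (f y * g (x -ᶠ y))
      ≡⟨ ∑-cong elements (λ y → ≡.trans (≡.cong (f y *_) (p _)) (ℤP.*-distribˡ-+ (f y) (g′ (x -ᶠ y)) c)) ⟩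
    ∑[ y ← elements ] (f y * g′ (x -ᶠ y) + f y * c)
      ≡⟨ ∑-+ elements _ _ ⟩
    (f ⊛ g′) x + (∑[ y ← elements ] (f y * c))
      ≡⟨ ≡.cong (λ z → (f ⊛ g′) x + z) (∑-*ʳ elements c f) ⟩
    (f ⊛ g′) x + ∑ elements f * c ∎

  ⊛-cong : ∀ {f g f′ g′} → f ≈ f′ → g ≈ g′ → f ⊛ g ≈ f′ ⊛ g′
  ⊛-cong {f} {g} {f′} {g′} p r =
    ≈-trans (⊛-congˡ f r) (≈-trans (pointwise (⊛-comm f g′)) (≈-trans (⊛-congˡ g′ p) (pointwise (⊛-comm g′ f′))))

  ⊛-assoc : ∀ f g h x → ((f ⊛ g) ⊛ h) x ≡ (f ⊛ (g ⊛ h)) x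
  ⊛-assoc f g h x = begin
    ∑[ z ← elements ] ((f ⊛ g) z * h (x -ᶠ z))
      ≡⟨ ∑-cong elements (λ z → ∑-*ʳ elements (h (x -ᶠ z)) _) ⟨
    ∑[ z ← elements ] (∑[ y ← elements ] (f y * g (z -ᶠ y) * h (x -ᶠ z)))
      ≡⟨ ∑-swap elements elements _ ⟩
    ∑[ y ← elements ] (∑[ z ← elements ] (f y * g (z -ᶠ y) * h (x -ᶠ z)))
      ≡⟨ ∑-cong elements (λ y → ∑-reindex (_+ᶠ y) (_-ᶠ y) (λ z → cancel₁ z y) (λ z → cancel₂ z y)
           (λ z → f y * g (z -ᶠ y) * h (x -ᶠ z))) ⟨
    ∑[ y ← elements ] (∑[ z ← elements ] (f y * g (z +ᶠ y -ᶠ y) * h (x -ᶠ (z +ᶠ y))))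
      ≡⟨ ∑-cong elements (λ y → ∑-cong elements (λ z → ≡.trans
           (≡.cong₂ (λ u v → f y * g u * h v) (cancel₂ z y) (cancel₃ x z y)) (ℤP.*-assoc (f y) _ _))) ⟩
    ∑[ y ← elements ] (∑[ z ← elements ] (f y * (g z * h (x -ᶠ y -ᶠ z))))
      ≡⟨ ∑-cong elements (λ y → ∑-*ˡ elements (f y) _) ⟩
    ∑[ y ← elements ] (f y * (g ⊛ h) (x -ᶠ y)) ∎
    where
    cancel₁ : ∀ z y → (z -ᶠ y) +ᶠ y ≡ z
    cancel₁ = FS.solve 2 (λ z y → z FS.:- y FS.:+ y FS.:= z) refl
    cancel₂ : ∀ z y → (z +ᶠ y) -ᶠ y ≡ z
    cancel₂ = FS.solve 2 (λ z y → z FS.:+ y FS.:- y FS.:= z) refl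
    cancel₃ : ∀ x z y → x -ᶠ (z +ᶠ y) ≡ x -ᶠ y -ᶠ z
    cancel₃ = FS.solve 3 (λ x z y → x FS.:- (z FS.:+ y) FS.:= x FS.:- y FS.:- z) refl

  δ-⊛ : ∀ a g x → (δ a ⊛ g) x ≡ g (x -ᶠ a)
  δ-⊛ a g x = pick (λ y → g (x -ᶠ y)) a

  x-0 : ∀ x → x -ᶠ 0ᶠ ≡ x
  x-0 = FS.solve 1 (λ x → x FS.:- FS.con (+ 0) FS.:= x) refl

  ⊛-identityˡ : ∀ g x → (δ 0ᶠ ⊛ g) x ≡ g x
  ⊛-identityˡ g x = ≡.trans (δ-⊛ 0ᶠ g x) (≡.cong g (x-0 x))

  ⊛-distribˡ : ∀ f g h x → (f ⊛ (g ⊞ h)) x ≡ (f ⊛ g) x + (f ⊛ h) x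
  ⊛-distribˡ f g h x = ≡.trans (∑-cong elements (λ y → ℤP.*-distribˡ-+ (f y) _ _)) (∑-+ elements _ _)

  groupRing : CommutativeRing 0ℓ 0ℓ
  groupRing = record
    { Carrier = F → ℤ ; _≈_ = _≈_ ; _+_ = _⊞_ ; _*_ = _⊛_ ; -_ = ⊟_ ; 0# = λ _ → + 0 ; 1# = δ 0ᶠ
    ; isCommutativeRing = record
      { isRing = record
        { +-isAbelianGroup = record
          { isGroup = record
            { isMonoid = record
              { isSemigroup = record
                { isMagma = record
                  { isEquivalence = record { refl = pointwise (λ _ → refl) ; sym = ≈-sym ; trans = ≈-trans }
                  ; ∙-cong = ⊞-cong }
                ; assoc = λ f g h → pointwise (λ x → ℤP.+-assoc (f x) (g x) (h x)) }
              ; identity = (λ f → pointwise (λ x → ℤP.+-identityˡ (f x))) , (λ f → pointwise (λ x → ℤP.+-identityʳ (f x))) }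
            ; inverse = (λ f → pointwise (λ x → ℤP.+-inverseˡ (f x))) , (λ f → pointwise (λ x → ℤP.+-inverseʳ (f x)))
            ; ⁻¹-cong = ⊟-cong }
          ; comm = λ f g → pointwise (λ x → ℤP.+-comm (f x) (g x)) }
        ; *-cong = ⊛-cong
        ; *-assoc = λ f g h → pointwise (⊛-assoc f g h)
        ; *-identity = (λ f → pointwise (⊛-identityˡ f)) ,
                       (λ f → pointwise (λ x → ≡.trans (⊛-comm f (δ 0ᶠ) x) (⊛-identityˡ f x)))
        ; distrib = (λ f g h → pointwise (⊛-distribˡ f g h)) ,
                    (λ f g h → pointwise (λ x → ≡.trans (⊛-comm (g ⊞ h) f x)
                       (≡.trans (⊛-distribˡ f g h x) (≡.cong₂ _+_ (⊛-comm f g x) (⊛-comm f h x)))))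
        }
      ; *-comm = λ f g → pointwise (⊛-comm f g)
      }
    }

  module R = CommutativeRing groupRing
  module RS = IntegerSolver groupRing
  open Mult R.semiring using (×-homo-+) renaming (_×_ to _·_)

  conj : (F → ℤ) → F → ℤ
  conj f x = f (-ᶠ x)

  conj-⊛ : ∀ f g x → conj (f ⊛ g) x ≡ (conj f ⊛ conj g) x
  conj-⊛ f g x = begin
    ∑[ y ← elements ] (f y * g (-ᶠ x -ᶠ y))
      ≡⟨ ∑-reindex -ᶠ_ -ᶠ_ neg-neg neg-neg (λ y → f y * g (-ᶠ x -ᶠ y)) ⟨
    ∑[ y ← elements ] (f (-ᶠ y) * g (-ᶠ x -ᶠ -ᶠ y))
      ≡⟨ ∑-cong elements (λ y → ≡.cong (λ z → f (-ᶠ y) * g z) (neg-sub x y)) ⟩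
    ∑[ y ← elements ] (f (-ᶠ y) * g (-ᶠ (x -ᶠ y))) ∎
    where
    neg-neg : ∀ y → -ᶠ -ᶠ y ≡ y
    neg-neg = FS.solve 1 (λ y → FS.:- FS.:- y FS.:= y) refl
    neg-sub : ∀ x y → -ᶠ x -ᶠ -ᶠ y ≡ -ᶠ (x -ᶠ y)
    neg-sub = FS.solve 2 (λ x y → FS.:- x FS.:- FS.:- y FS.:= FS.:- (x FS.:- y)) refl

  conj-conj : ∀ f x → conj (conj f) x ≡ f x
  conj-conj f x = ≡.cong f (FS.solve 1 (λ y → FS.:- FS.:- y FS.:= y) refl x)

  conj-δ : ∀ a x → conj (δ a) x ≡ δ (-ᶠ a) x
  conj-δ a x = []-cong ((-ᶠ x) ≟ a) (x ≟ (-ᶠ a))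
    (λ e → ≡.trans (neg-neg x) (≡.cong -ᶠ_ e))
    (λ e → ≡.trans (≡.cong -ᶠ_ e) (≡.sym (neg-neg a)))
    where
    neg-neg : ∀ y → y ≡ -ᶠ -ᶠ y
    neg-neg = FS.solve 1 (λ y → y FS.:= FS.:- FS.:- y) refl

  δ-+ : ∀ a b x → δ (a +ᶠ b) x ≡ (δ a ⊛ δ b) x
  δ-+ a b x = ≡.trans
    ([]-cong (x ≟ (a +ᶠ b)) ((x -ᶠ a) ≟ b)
      (λ e → ≡.trans (≡.cong (_-ᶠ a) e) (FS.solve 2 (λ a b → a FS.:+ b FS.:- a FS.:= b) refl a b))
      (λ e → ≡.trans (FS.solve 2 (λ x a → x FS.:= a FS.:+ (x FS.:- a)) refl x a) (≡.cong (a +ᶠ_) e)))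
    (≡.sym (δ-⊛ a (δ b) x))

  -- The cone generated by norms. There is no constructor for products: `trace` is additive but not
  -- multiplicative, so `trace≥0` could not treat one by induction. Closure under products follows
  -- instead from the norm of a product being the product of the norms.
  data NonNeg : (F → ℤ) → Set where
    norm : ∀ h → NonNeg (h ⊛ conj h)
    plus : ∀ {f g} → NonNeg f → NonNeg g → NonNeg (f ⊞ g)
    resp : ∀ {f g} → f ≈ g → NonNeg f → NonNeg g

  NonNeg-⊛ : ∀ {f g} → NonNeg f → NonNeg g → NonNeg (f ⊛ g)
  NonNeg-⊛ (norm h) (norm k) = resp
    (R.trans (R.*-congˡ {h ⊛ k} (pointwise (conj-⊛ h k)))
      (RS.solve 4 (λ a b c d → (a RS.:* b) RS.:* (c RS.:* d) RS.:= (a RS.:* c) RS.:* (b RS.:* d)) R.refl h k (conj h) (conj k)))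
    (norm (h ⊛ k))
  NonNeg-⊛ {f} p@(norm _) (plus {g} {h} q r) = resp (R.sym (R.distribˡ f g h)) (plus (NonNeg-⊛ p q) (NonNeg-⊛ p r))
  NonNeg-⊛ {f} p@(norm _) (resp e q) = resp (R.*-congˡ {f} e) (NonNeg-⊛ p q)
  NonNeg-⊛ {g = h} (plus {f} {g} p q) r = resp (R.sym (R.distribʳ h f g)) (plus (NonNeg-⊛ p r) (NonNeg-⊛ q r))
  NonNeg-⊛ {g = g} (resp e p) q = resp (R.*-congʳ {g} e) (NonNeg-⊛ p q)

  conj-cong : ∀ {f g} → f ≈ g → conj f ≈ conj g
  conj-cong (offset c p) = offset c λ x → p (-ᶠ x)

  NonNeg-real : ∀ {f} → NonNeg f → conj f ≈ f
  NonNeg-real (norm h) = R.trans (pointwise (conj-⊛ h (conj h)))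
    (R.trans (R.*-congˡ {conj h} (pointwise (conj-conj h))) (R.*-comm (conj h) h))
  NonNeg-real (plus p q) = R.+-cong (NonNeg-real p) (NonNeg-real q)
  NonNeg-real (resp e p) = R.trans (conj-cong (R.sym e)) (R.trans (NonNeg-real p) e)

  q : ℤ
  q = + size

  ∑-const : ∀ (xs : List F) c → ∑[ x ← xs ] c ≡ + length xs * c
  ∑-const [] c = refl
  ∑-const (x ∷ xs) c = begin
    c + (∑[ x ← xs ] c)            ≡⟨ ≡.cong (λ z → c + z) (∑-const xs c) ⟩
    c + + length xs * c            ≡⟨ ℤP.suc-* (+ length xs) c ⟨
    + length (x ∷ xs) * c          ∎

  trace : (F → ℤ) → ℤ
  trace f = q * f 0ᶠ - ∑ elements f

  trace-cong : ∀ {f g} → f ≈ g → trace f ≡ trace g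
  trace-cong {f} {g} (offset c p) = begin
    q * f 0ᶠ - ∑ elements f
      ≡⟨ ≡.cong₂ (λ u v → q * u - v) (p 0ᶠ) (≡.trans (∑-cong elements p)
           (≡.trans (∑-+ elements g _) (≡.cong (λ z → ∑ elements g + z) (∑-const elements c)))) ⟩
    q * (g 0ᶠ + c) - (∑ elements g + q * c)
      ≡⟨ ℤS.solve 4 (λ q g c s → q ℤS.:* (g ℤS.:+ c) ℤS.:- (s ℤS.:+ q ℤS.:* c) ℤS.:= q ℤS.:* g ℤS.:- s)
           refl q (g 0ᶠ) c (∑ elements g) ⟩
    trace g ∎

  trace-⊞ : ∀ f g → trace (f ⊞ g) ≡ trace f + trace g
  trace-⊞ f g = begin
    q * (f 0ᶠ + g 0ᶠ) - ∑ elements (f ⊞ g)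
      ≡⟨ ≡.cong (λ u → q * (f 0ᶠ + g 0ᶠ) - u) (∑-+ elements f g) ⟩
    q * (f 0ᶠ + g 0ᶠ) - (∑ elements f + ∑ elements g)
      ≡⟨ ℤS.solve 5 (λ q f g s t → q ℤS.:* (f ℤS.:+ g) ℤS.:- (s ℤS.:+ t) ℤS.:= (q ℤS.:* f ℤS.:- s) ℤS.:+ (q ℤS.:* g ℤS.:- t))
           refl q (f 0ᶠ) (g 0ᶠ) (∑ elements f) (∑ elements g) ⟩
    trace f + trace g ∎

  ∑-square≥0 : ∀ (xs : List F) (f : F → ℤ) → + 0 ℤ.≤ ∑[ x ← xs ] (f x * f x)
  ∑-square≥0 [] f = ℤP.≤-refl
  ∑-square≥0 (x ∷ xs) f = ℤP.+-mono-≤ (i*i≥0 (f x)) (∑-square≥0 xs f)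

  ∑-square-sub : ∀ (xs : List F) a (h : F → ℤ) →
    ∑[ x ← xs ] ((a - h x) * (a - h x)) ≡ + length xs * (a * a) + ((∑[ x ← xs ] (h x * h x)) - (a * ∑ xs h + a * ∑ xs h))
  ∑-square-sub [] a h = ℤS.solve 1 (λ a → ℤS.con (+ 0) ℤS.:= ℤS.con (+ 0) ℤS.:* (a ℤS.:* a)
    ℤS.:+ (ℤS.con (+ 0) ℤS.:- (a ℤS.:* ℤS.con (+ 0) ℤS.:+ a ℤS.:* ℤS.con (+ 0)))) refl a
  ∑-square-sub (x ∷ xs) a h = begin
    (a - h x) * (a - h x) + (∑[ x ← xs ] ((a - h x) * (a - h x)))
      ≡⟨ ≡.cong (λ z → (a - h x) * (a - h x) + z) (∑-square-sub xs a h) ⟩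
    (a - h x) * (a - h x) + (n * (a * a) + (B - (a * S + a * S)))
      ≡⟨ ℤS.solve 5 (λ a h n B S → (a ℤS.:- h) ℤS.:* (a ℤS.:- h) ℤS.:+ (n ℤS.:* (a ℤS.:* a) ℤS.:+ (B ℤS.:- (a ℤS.:* S ℤS.:+ a ℤS.:* S)))
             ℤS.:= (a ℤS.:* a ℤS.:+ n ℤS.:* (a ℤS.:* a)) ℤS.:+ ((h ℤS.:* h ℤS.:+ B) ℤS.:- (a ℤS.:* (h ℤS.:+ S) ℤS.:+ a ℤS.:* (h ℤS.:+ S))))
             refl a (h x) n B S ⟩
    (a * a + n * (a * a)) + ((h x * h x + B) - (a * (h x + S) + a * (h x + S)))
      ≡⟨ ≡.cong (_+ ((h x * h x + B) - (a * (h x + S) + a * (h x + S)))) (ℤP.suc-* n (a * a)) ⟨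
    + length (x ∷ xs) * (a * a) + ((h x * h x + B) - (a * (h x + S) + a * (h x + S))) ∎
    where
    n B S : ℤ
    n = + length xs
    B = ∑[ x ← xs ] (h x * h x)
    S = ∑ xs h

  -- When x is put in front of xs, the difference of the two sides grows by the sum of (h x - h y)²
  -- over y in xs; in the end it is a sum of squares over pairs.
  cauchy-schwarz : ∀ (xs : List F) (h : F → ℤ) → + 0 ℤ.≤ + length xs * (∑[ x ← xs ] (h x * h x)) - ∑ xs h * ∑ xs h
  cauchy-schwarz [] h = ℤP.≤-refl
  cauchy-schwarz (x ∷ xs) h = ≡.subst (+ 0 ℤ.≤_) identity
    (ℤP.+-mono-≤ (cauchy-schwarz xs h) (∑-square≥0 xs (λ y → h x - h y)))
    where
    n B S : ℤ
    n = + length xs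
    B = ∑[ x ← xs ] (h x * h x)
    S = ∑ xs h
    identity : n * B - S * S + (∑[ y ← xs ] ((h x - h y) * (h x - h y)))
             ≡ + length (x ∷ xs) * (h x * h x + B) - (h x + S) * (h x + S)
    identity = begin
      n * B - S * S + (∑[ y ← xs ] ((h x - h y) * (h x - h y)))
        ≡⟨ ≡.cong (λ z → n * B - S * S + z) (∑-square-sub xs (h x) h) ⟩
      n * B - S * S + (n * (h x * h x) + (B - (h x * S + h x * S)))
        ≡⟨ ℤS.solve 4 (λ a n B S → n ℤS.:* B ℤS.:- S ℤS.:* S ℤS.:+ (n ℤS.:* (a ℤS.:* a) ℤS.:+ (B ℤS.:- (a ℤS.:* S ℤS.:+ a ℤS.:* S)))
             ℤS.:= ((a ℤS.:* a ℤS.:+ B) ℤS.:+ n ℤS.:* (a ℤS.:* a ℤS.:+ B)) ℤS.:- (a ℤS.:+ S) ℤS.:* (a ℤS.:+ S)) refl (h x) n B S ⟩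
      ((h x * h x + B) + n * (h x * h x + B)) - (h x + S) * (h x + S)
        ≡⟨ ≡.cong (_- (h x + S) * (h x + S)) (ℤP.suc-* n (h x * h x + B)) ⟨
      + length (x ∷ xs) * (h x * h x + B) - (h x + S) * (h x + S) ∎

  trace-norm : ∀ h → trace (h ⊛ conj h) ≡ q * (∑[ x ← elements ] (h x * h x)) - ∑ elements h * ∑ elements h
  trace-norm h = ≡.cong₂ (λ u v → q * u - v) at-0 total
    where
    at-0 : (h ⊛ conj h) 0ᶠ ≡ ∑[ x ← elements ] (h x * h x)
    at-0 = ∑-cong elements (λ y → ≡.cong (λ z → h y * h z)
      (FS.solve 1 (λ y → FS.:- (FS.con (+ 0) FS.:- y) FS.:= y) refl y))
    total : ∑ elements (h ⊛ conj h) ≡ ∑ elements h * ∑ elements h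
    total = begin
      ∑[ x ← elements ] (∑[ y ← elements ] (h y * h (-ᶠ (x -ᶠ y))))
        ≡⟨ ∑-swap elements elements _ ⟩
      ∑[ y ← elements ] (∑[ x ← elements ] (h y * h (-ᶠ (x -ᶠ y))))
        ≡⟨ ∑-cong elements (λ y → ∑-cong elements (λ x → ≡.cong (λ z → h y * h z)
             (FS.solve 2 (λ x y → FS.:- (x FS.:- y) FS.:= y FS.:- x) refl x y))) ⟩
      ∑[ y ← elements ] (∑[ x ← elements ] (h y * h (y -ᶠ x)))
        ≡⟨ ∑-cong elements (λ y → ≡.trans (∑-*ˡ elements (h y) _) (≡.cong (h y *_) (∑-reflect y h))) ⟩
      ∑[ y ← elements ] (h y * ∑ elements h)
        ≡⟨ ∑-*ʳ elements _ h ⟩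
      ∑ elements h * ∑ elements h ∎

  trace≥0 : ∀ {f} → NonNeg f → + 0 ℤ.≤ trace f
  trace≥0 (norm h) = ≡.subst (+ 0 ℤ.≤_) (≡.sym (trace-norm h)) (cauchy-schwarz elements h)
  trace≥0 (plus {f} {g} p q) = ≡.subst (+ 0 ℤ.≤_) (≡.sym (trace-⊞ f g)) (ℤP.+-mono-≤ (trace≥0 p) (trace≥0 q))
  trace≥0 (resp e p) = ≡.subst (+ 0 ℤ.≤_) (trace-cong e) (trace≥0 p)

  trace-1 : trace (δ 0ᶠ) ≡ q - + 1
  trace-1 = ≡.cong₂ (λ u v → u - v) (≡.trans (≡.cong (q *_) ([]-yes (0ᶠ ≟ 0ᶠ) refl)) (ℤP.*-identityʳ q)) (count-≡ 0ᶠ)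

  trace-· : ∀ n → trace (n · δ 0ᶠ) ≡ + n * (q - + 1)
  trace-· zero = ≡.cong₂ _-_ (ℤP.*-zeroʳ q) (∑-0 elements)
  trace-· (suc n) = begin
    trace (suc n · δ 0ᶠ)                   ≡⟨ trace-cong (×-homo-+ (δ 0ᶠ) 1 n) ⟩
    trace (δ 0ᶠ ⊞ (n · δ 0ᶠ))              ≡⟨ trace-⊞ (δ 0ᶠ) (n · δ 0ᶠ) ⟩
    trace (δ 0ᶠ) + trace (n · δ 0ᶠ)        ≡⟨ ≡.cong₂ _+_ trace-1 (trace-· n) ⟩
    (q - + 1) + + n * (q - + 1)            ≡⟨ ℤP.suc-* (+ n) (q - + 1) ⟨
    + suc n * (q - + 1)                    ∎

  -- The trace of n · 1 is n (q - 1), and q ≥ 2 allows the factor to be cancelled. This is what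
  -- keeps the formal order from being trivial: an inequality between numerals certified by norms is
  -- a true one.
  NonNeg-reflect : ∀ {m n} → NonNeg ((n · δ 0ᶠ) ⊞ (⊟ (m · δ 0ᶠ))) → m ℕ.≤ n
  NonNeg-reflect {m} {n} p = ℤP.drop‿+≤+ (ℤP.*-cancelʳ-≤-pos (+ m) (+ n) (+ suc (proj₁ q-1)) bound)
    where
    predecessor : ∀ s → 2 ℕ.≤ s → ∃[ l ] (+ s - + 1 ≡ + suc l)
    predecessor (suc zero) (ℕ.s≤s ())
    predecessor (suc (suc l)) _ = l , refl
    q-1 : ∃[ l ] (q - + 1 ≡ + suc l)
    q-1 = predecessor size (size≥2 K)
    difference : F → ℤ
    difference = (n · δ 0ᶠ) ⊞ (⊟ (m · δ 0ᶠ))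
    total : trace (n · δ 0ᶠ) ≡ trace difference + trace (m · δ 0ᶠ)
    total = ≡.trans (trace-cong (RS.solve 2 (λ a b → a RS.:= (a RS.:- b) RS.:+ b) R.refl (n · δ 0ᶠ) (m · δ 0ᶠ)))
      (trace-⊞ difference (m · δ 0ᶠ))
    bound : + m * + suc (proj₁ q-1) ℤ.≤ + n * + suc (proj₁ q-1)
    bound = ≡.subst₂ ℤ._≤_
      (≡.trans (ℤP.+-identityˡ _) (≡.trans (trace-· m) (≡.cong (+ m *_) (proj₂ q-1))))
      (≡.trans (≡.sym total) (≡.trans (trace-· n) (≡.cong (+ n *_) (proj₂ q-1))))
      (ℤP.+-mono-≤ (trace≥0 p) (ℤP.≤-refl {trace (m · δ 0ᶠ)}))

  ∑-δ : Summation.∑ R.commutativeSemiring elements δ ≈ (λ _ → + 0)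
  ∑-δ = offset (+ 1) λ x → ≡.trans (evaluate elements x)
    (≡.trans (∑-cong elements (λ a → []-cong (x ≟ a) (a ≟ x) ≡.sym ≡.sym)) (count-≡ x))
    where
    evaluate : ∀ xs x → Summation.∑ R.commutativeSemiring xs δ x ≡ ∑[ a ← xs ] δ a x
    evaluate [] x = refl
    evaluate (a ∷ xs) x = ≡.cong (λ z → δ a x + z) (evaluate xs x)

characterRing : (K : FiniteField) → CharacterRing K
characterRing K = record
  { ring = groupRing
  ; conj = conj
  ; conj-cong = conj-cong
  ; conj-+ = λ _ _ → pointwise (λ _ → refl)
  ; conj-* = λ f g → pointwise (conj-⊛ f g)
  ; conj-neg = λ _ → pointwise (λ _ → refl)
  ; conj-0 = pointwise (λ _ → refl)
  ; conj-1 = pointwise (λ x → ≡.trans (conj-δ _ x) (≡.cong (λ a → δ a x) (FS.solve 0 (FS.:- FS.con (+ 0) FS.:= FS.con (+ 0)) refl)))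
  ; conj-conj = λ f → pointwise (conj-conj f)
  ; NonNeg = NonNeg
  ; NonNeg-resp = resp
  ; NonNeg-+ = plus
  ; NonNeg-* = NonNeg-⊛
  ; NonNeg-norm = norm
  ; NonNeg-real = NonNeg-real
  ; NonNeg-reflect = NonNeg-reflect
  ; χ = δ
  ; χ-+ = λ a b → pointwise (δ-+ a b)
  ; χ-0 = R.refl
  ; conj-χ = λ a → pointwise (conj-δ a)
  ; ∑-χ = ∑-δ
  }
  where open GroupRing K

-- Inequalities in the ring: Cauchy-Schwarz and the power mean

module Order (K : FiniteField) (M : CharacterRing K) where
  open CharacterRing M public
  open CommutativeRing ring public renaming (refl to ≈-refl; sym to ≈-sym; trans to ≈-trans) hiding (zero; ring)
  open Summation commutativeSemiring public
  open IntegerSolver ring public using (solve; _:=_; _:+_; _:*_; _:-_; :-_; con)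
  open Mult semiring public using (×-homo-+; ×1-homo-*) renaming (_×_ to _·_)
  open Exp semiring public using (_^_; ^-homo-*; ^-congˡ)

  private
    variable
      A : Set

  infix 4 _≼_
  -- Totality is not among the axioms, so every comparison that needs a case split is made between
  -- natural numbers.
  _≼_ : Carrier → Carrier → Set
  x ≼ y = NonNeg (y - x)

  NonNeg-1 : NonNeg 1#
  NonNeg-1 = NonNeg-resp (≈-trans (*-identityˡ _) conj-1) (NonNeg-norm 1#)

  NonNeg-0 : NonNeg 0#
  NonNeg-0 = NonNeg-resp (zeroˡ _) (NonNeg-norm 0#)

  ≼-reflexive : ∀ {x y} → x ≈ y → x ≼ y
  ≼-reflexive {x} {y} x≈y = NonNeg-resp (≈-trans (≈-sym (-‿inverseʳ x)) (+-congʳ x≈y)) NonNeg-0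

  ≼-trans : ∀ {x y z} → x ≼ y → y ≼ z → x ≼ z
  ≼-trans {x} {y} {z} p q = NonNeg-resp
    (solve 3 (λ x y z → (y :- x) :+ (z :- y) := z :- x) ≈-refl x y z) (NonNeg-+ p q)

  preorder : Preorder 0ℓ 0ℓ 0ℓ
  preorder = record
    { Carrier = Carrier ; _≈_ = _≈_ ; _≲_ = _≼_
    ; isPreorder = record { isEquivalence = isEquivalence ; reflexive = ≼-reflexive ; trans = ≼-trans } }

  open PreorderReasoning preorder public

  ≼-refl : ∀ {x} → x ≼ x
  ≼-refl = ≼-reflexive ≈-refl

  0≼ : ∀ {x} → NonNeg x → 0# ≼ x
  0≼ {x} p = NonNeg-resp (solve 1 (λ x → x := x :- con (+ 0)) ≈-refl x) p

  NonNeg-≼ : ∀ {x y} → NonNeg x → x ≼ y → NonNeg y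
  NonNeg-≼ {x} {y} p q = NonNeg-resp (solve 2 (λ x y → x :+ (y :- x) := y) ≈-refl x y) (NonNeg-+ p q)

  +-mono : ∀ {x y u v} → x ≼ y → u ≼ v → x + u ≼ y + v
  +-mono {x} {y} {u} {v} p q = NonNeg-resp
    (solve 4 (λ x y u v → (y :- x) :+ (v :- u) := (y :+ v) :- (x :+ u)) ≈-refl x y u v) (NonNeg-+ p q)

  *-monoˡ : ∀ {x y z} → NonNeg z → x ≼ y → z * x ≼ z * y
  *-monoˡ {x} {y} {z} p q = NonNeg-resp
    (solve 3 (λ x y z → z :* (y :- x) := z :* y :- z :* x) ≈-refl x y z) (NonNeg-* p q)

  *-monoʳ : ∀ {x y z} → NonNeg z → x ≼ y → x * z ≼ y * z
  *-monoʳ {x} {y} {z} p q = NonNeg-resp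
    (solve 3 (λ x y z → z :* (y :- x) := y :* z :- x :* z) ≈-refl x y z) (NonNeg-* p q)

  *-mono : ∀ {x y u v} → NonNeg y → NonNeg u → x ≼ y → u ≼ v → x * u ≼ y * v
  *-mono py pu p q = ≼-trans (*-monoʳ pu p) (*-monoˡ py q)

  ∑-mono : ∀ (xs : List A) {f g : A → Carrier} → (∀ x → f x ≼ g x) → ∑ xs f ≼ ∑ xs g
  ∑-mono [] p = ≼-refl
  ∑-mono (x ∷ xs) p = +-mono (p x) (∑-mono xs p)

  ∑-NonNeg : ∀ (xs : List A) {f : A → Carrier} → (∀ x → NonNeg (f x)) → NonNeg (∑ xs f)
  ∑-NonNeg [] p = NonNeg-0
  ∑-NonNeg (x ∷ xs) p = NonNeg-+ (p x) (∑-NonNeg xs p)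

  []-NonNeg : ∀ {P : Set} (P? : Dec P) → NonNeg [ P? ]
  []-NonNeg (yes _) = NonNeg-1
  []-NonNeg (no _) = NonNeg-0

  []≼1 : ∀ {P : Set} (P? : Dec P) → [ P? ] ≼ 1#
  []≼1 (yes _) = ≼-refl
  []≼1 (no _) = 0≼ NonNeg-1

  []-mono : ∀ {P Q : Set} (P? : Dec P) (Q? : Dec Q) → (P → Q) → [ P? ] ≼ [ Q? ]
  []-mono (yes p) Q? f = ≼-reflexive (≈-sym ([]-yes Q? (f p)))
  []-mono (no _) Q? f = 0≼ ([]-NonNeg Q?)

  []*≼ : ∀ {P : Set} (P? : Dec P) {x} → NonNeg x → [ P? ] * x ≼ x
  []*≼ P? {x} p = ≼-trans (*-monoʳ p ([]≼1 P?)) (≼-reflexive (*-identityˡ x))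

  []-*-mono : ∀ {P : Set} (P? : Dec P) {x y} → (P → x ≼ y) → [ P? ] * x ≼ [ P? ] * y
  []-*-mono (yes p) h = *-monoˡ NonNeg-1 (h p)
  []-*-mono (no _) {x} {y} h = ≼-reflexive (≈-trans (zeroˡ x) (≈-sym (zeroˡ y)))

  ∈⇒≼∑ : ∀ {xs : List A} {f : A → Carrier} → (∀ x → NonNeg (f x)) → ∀ {y} → y ∈ xs → f y ≼ ∑ xs f
  ∈⇒≼∑ {xs = x ∷ xs} p (here refl) = ≼-trans (≼-reflexive (≈-sym (+-identityʳ _))) (+-mono ≼-refl (0≼ (∑-NonNeg xs p)))
  ∈⇒≼∑ {xs = x ∷ xs} p (there y∈) = ≼-trans (≼-reflexive (≈-sym (+-identityˡ _))) (+-mono (0≼ (p x)) (∈⇒≼∑ p y∈))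

  nat : ℕ → Carrier
  nat n = n · 1#

  nat-+ : ∀ m n → nat (m ℕ.+ n) ≈ nat m + nat n
  nat-+ = ×-homo-+ 1#

  nat-* : ∀ m n → nat (m ℕ.* n) ≈ nat m * nat n
  nat-* = ×1-homo-*

  nat-suc : ∀ n → nat (suc n) ≈ 1# + nat n
  nat-suc = nat-+ 1

  nat-^ : ∀ m n → nat (m ℕ.^ n) ≈ nat m ^ n
  nat-^ m zero = ≈-refl
  nat-^ m (suc n) = ≈-trans (nat-* m (m ℕ.^ n)) (*-congˡ (nat-^ m n))

  nat-NonNeg : ∀ n → NonNeg (nat n)
  nat-NonNeg zero = NonNeg-0
  nat-NonNeg (suc n) = NonNeg-resp (≈-sym (nat-suc n)) (NonNeg-+ NonNeg-1 (nat-NonNeg n))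

  nat-mono : ∀ {m n} → m ℕ.≤ n → nat m ≼ nat n
  nat-mono {m} m≤n with o , refl ← ℕP.m≤n⇒∃[o]m+o≡n m≤n = begin
    nat m               ≈⟨ +-identityʳ _ ⟨
    nat m + 0#          ≲⟨ +-mono ≼-refl (0≼ (nat-NonNeg o)) ⟩
    nat m + nat o       ≈⟨ nat-+ m o ⟨
    nat (m ℕ.+ o)       ∎

  ∑-const : ∀ (xs : List A) c → ∑[ x ← xs ] c ≈ nat (length xs) * c
  ∑-const [] c = ≈-sym (zeroˡ c)
  ∑-const (x ∷ xs) c = begin-equality
    c + (∑[ x ← xs ] c)                 ≈⟨ +-cong (≈-sym (*-identityˡ c)) (∑-const xs c) ⟩
    1# * c + nat (length xs) * c        ≈⟨ distribʳ c 1# _ ⟨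
    (1# + nat (length xs)) * c          ≈⟨ *-congʳ (nat-suc (length xs)) ⟨
    nat (length (x ∷ xs)) * c           ∎

  ^-NonNeg : ∀ {x} n → NonNeg x → NonNeg (x ^ n)
  ^-NonNeg zero p = NonNeg-1
  ^-NonNeg (suc n) p = NonNeg-* p (^-NonNeg n p)

  ^-mono : ∀ {x y} n → NonNeg x → x ≼ y → x ^ n ≼ y ^ n
  ^-mono zero p q = ≼-refl
  ^-mono (suc n) p q = *-mono (NonNeg-≼ p q) (^-NonNeg n p) q (^-mono n p q)

  conj-[] : ∀ {P : Set} (P? : Dec P) → conj [ P? ] ≈ [ P? ]
  conj-[] (yes _) = conj-1
  conj-[] (no _) = conj-0

  conj-∑ : ∀ (xs : List A) f → conj (∑ xs f) ≈ ∑[ x ← xs ] conj (f x)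
  conj-∑ [] f = conj-0
  conj-∑ (x ∷ xs) f = ≈-trans (conj-+ _ _) (+-congˡ (conj-∑ xs f))

  conj-nat : ∀ n → conj (nat n) ≈ nat n
  conj-nat n = NonNeg-real (nat-NonNeg n)

  norm : Carrier → Carrier
  norm x = x * conj x

  norm-cong : ∀ {x y} → x ≈ y → norm x ≈ norm y
  norm-cong p = *-cong p (conj-cong p)

  norm-* : ∀ x y → norm (x * y) ≈ norm x * norm y
  norm-* x y = ≈-trans (*-congˡ (conj-* x y))
    (solve 4 (λ a b c d → (a :* b) :* (c :* d) := (a :* c) :* (b :* d)) ≈-refl x y (conj x) (conj y))

  norm-real : ∀ {x} → conj x ≈ x → norm x ≈ x * x
  norm-real p = *-congˡ p

  norm-[] : ∀ {P : Set} (P? : Dec P) → norm [ P? ] ≈ [ P? ]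
  norm-[] P? = ≈-trans (norm-real (conj-[] P?)) ([]-idem P?)

  norm-[]* : ∀ {P : Set} (P? : Dec P) y → norm ([ P? ] * y) ≈ [ P? ] * norm y
  norm-[]* P? y = ≈-trans (norm-* [ P? ] y) (*-congʳ (norm-[] P?))

  norm-conj : ∀ x → norm (conj x) ≈ norm x
  norm-conj x = ≈-trans (*-congˡ (conj-conj x)) (*-comm _ _)

  square-NonNeg : ∀ {x} → conj x ≈ x → NonNeg (x * x)
  square-NonNeg p = NonNeg-resp (norm-real p) (NonNeg-norm _)

  conj-- : ∀ {x y x′ y′} → conj x ≈ x′ → conj y ≈ y′ → conj (x - y) ≈ x′ - y′
  conj-- p q = ≈-trans (conj-+ _ _) (+-cong p (≈-trans (conj-neg _) (-‿cong q)))

  conj-*′ : ∀ {x y x′ y′} → conj x ≈ x′ → conj y ≈ y′ → conj (x * y) ≈ x′ * y′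
  conj-*′ p q = ≈-trans (conj-* _ _) (*-cong p q)

  2xy≼x²+y² : ∀ {x y} → conj x ≈ x → conj y ≈ y → x * y + x * y ≼ x * x + y * y
  2xy≼x²+y² {x} {y} p q = NonNeg-resp
    (solve 2 (λ x y → (x :- y) :* (x :- y) := (x :* x :+ y :* y) :- (x :* y :+ x :* y)) ≈-refl x y)
    (square-NonNeg (conj-- p q))

  module _ {A : Set} (u v : A → Carrier) where
    private
      UU VV UV : List A → Carrier
      UU xs = ∑[ x ← xs ] norm (u x)
      VV xs = ∑[ x ← xs ] norm (v x)
      UV xs = ∑[ x ← xs ] (u x * v x)

    -- Termwise this is |a conj(v) - conj(b) u|² ≥ 0. Taken at a = u x and b = v x it bounds the
    -- mixed terms that appear when x is added to the list in `cauchy-schwarz`, as in the Lagrange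
    -- identity; neither a discriminant nor a quotient is formed.
    cross : ∀ a b (xs : List A) → a * b * conj (UV xs) + conj a * conj b * UV xs ≼ norm a * VV xs + norm b * UU xs
    cross a b [] = ≼-reflexive (≈-trans (+-congʳ (*-congˡ conj-0))
      (solve 6 (λ a b c d e f → a :* b :* con (+ 0) :+ c :* d :* con (+ 0) := e :* con (+ 0) :+ f :* con (+ 0)) ≈-refl a b (conj a) (conj b) (norm a) (norm b)))
    cross a b (x ∷ xs) = begin
      a * b * conj (u x * v x + UV xs) + conj a * conj b * (u x * v x + UV xs)
        ≈⟨ +-congʳ (*-congˡ (≈-trans (conj-+ _ _) (+-congʳ (conj-* _ _)))) ⟩
      a * b * (conj (u x) * conj (v x) + conj (UV xs)) + conj a * conj b * (u x * v x + UV xs)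
        ≈⟨ split a b (conj a) (conj b) (u x * v x) (conj (u x) * conj (v x)) (UV xs) (conj (UV xs)) ⟩
      (a * b * (conj (u x) * conj (v x)) + conj a * conj b * (u x * v x)) + (a * b * conj (UV xs) + conj a * conj b * UV xs)
        ≲⟨ +-mono single (cross a b xs) ⟩
      (norm a * norm (v x) + norm b * norm (u x)) + (norm a * VV xs + norm b * UU xs)
        ≈⟨ merge (norm a) (norm b) (norm (u x)) (norm (v x)) (UU xs) (VV xs) ⟩
      norm a * VV (x ∷ xs) + norm b * UU (x ∷ xs) ∎
      where
      split = solve 8 (λ a b a′ b′ p p′ s s′ → a :* b :* (p′ :+ s′) :+ a′ :* b′ :* (p :+ s)
        := (a :* b :* p′ :+ a′ :* b′ :* p) :+ (a :* b :* s′ :+ a′ :* b′ :* s)) ≈-refl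
      merge = solve 6 (λ a b u v s t → (a :* v :+ b :* u) :+ (a :* t :+ b :* s) := a :* (v :+ t) :+ b :* (u :+ s)) ≈-refl
      single : a * b * (conj (u x) * conj (v x)) + conj a * conj b * (u x * v x) ≼ norm a * norm (v x) + norm b * norm (u x)
      single = NonNeg-resp (≈-trans
        (*-congˡ (conj-- (conj-*′ ≈-refl (conj-conj (v x))) (conj-*′ (conj-conj b) ≈-refl)))
        (solve 8 (λ a a′ b b′ u u′ v v′ → (a :* v′ :- b′ :* u) :* (a′ :* v :- b :* u′)
           := (a :* a′ :* (v :* v′) :+ b :* b′ :* (u :* u′)) :- (a :* b :* (u′ :* v′) :+ a′ :* b′ :* (u :* v))) ≈-refl
           a (conj a) b (conj b) (u x) (conj (u x)) (v x) (conj (v x))))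
        (NonNeg-norm (a * conj (v x) - conj b * u x))

    cauchy-schwarz : ∀ (xs : List A) → norm (UV xs) ≼ UU xs * VV xs
    cauchy-schwarz [] = ≼-reflexive (≈-trans (zeroˡ _) (≈-sym (zeroˡ _)))
    cauchy-schwarz (x ∷ xs) = begin
      (u x * v x + UV xs) * conj (u x * v x + UV xs)
        ≈⟨ *-congˡ (≈-trans (conj-+ _ _) (+-congʳ (conj-* _ _))) ⟩
      (u x * v x + UV xs) * (conj (u x) * conj (v x) + conj (UV xs))
        ≈⟨ solve 6 (λ u u′ v v′ s s′ → (u :* v :+ s) :* (u′ :* v′ :+ s′)
             := (u :* u′) :* (v :* v′) :+ ((u :* v :* s′ :+ u′ :* v′ :* s) :+ s :* s′)) ≈-refl
             (u x) (conj (u x)) (v x) (conj (v x)) (UV xs) (conj (UV xs)) ⟩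
      norm (u x) * norm (v x) + ((u x * v x * conj (UV xs) + conj (u x) * conj (v x) * UV xs) + norm (UV xs))
        ≲⟨ +-mono ≼-refl (+-mono (cross (u x) (v x) xs) (cauchy-schwarz xs)) ⟩
      norm (u x) * norm (v x) + ((norm (u x) * VV xs + norm (v x) * UU xs) + UU xs * VV xs)
        ≈⟨ solve 4 (λ u v s t → u :* v :+ ((u :* t :+ v :* s) :+ s :* t) := (u :+ s) :* (v :+ t)) ≈-refl
             (norm (u x)) (norm (v x)) (UU xs) (VV xs) ⟩
      (norm (u x) + UU xs) * (norm (v x) + VV xs) ∎

  norm-1 : norm 1# ≈ 1#
  norm-1 = ≈-trans (*-identityˡ _) conj-1

  cauchy-schwarz-1 : ∀ (xs : List A) (f : A → Carrier) → norm (∑ xs f) ≼ nat (length xs) * (∑[ x ← xs ] norm (f x))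
  cauchy-schwarz-1 xs f = begin
    norm (∑ xs f)
      ≈⟨ norm-cong (∑-cong xs (λ x → *-identityˡ (f x))) ⟨
    norm (∑[ x ← xs ] (1# * f x))
      ≲⟨ cauchy-schwarz (λ _ → 1#) f xs ⟩
    (∑[ x ← xs ] norm 1#) * (∑[ x ← xs ] norm (f x))
      ≈⟨ *-congʳ (≈-trans (∑-cong xs (λ _ → norm-1)) (≈-trans (∑-const xs 1#) (*-identityʳ _))) ⟩
    nat (length xs) * (∑[ x ← xs ] norm (f x)) ∎

  norm-+-+ : ∀ x y z → norm (x + y + z) ≼ nat 3 * (norm x + norm y + norm z)
  norm-+-+ x y z = begin
    norm (x + y + z)
      ≈⟨ norm-cong (solve 3 (λ x y z → x :+ y :+ z := x :+ (y :+ (z :+ con (+ 0)))) ≈-refl x y z) ⟩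
    norm (∑ (x ∷ y ∷ z ∷ []) (λ t → t))
      ≲⟨ cauchy-schwarz-1 (x ∷ y ∷ z ∷ []) (λ t → t) ⟩
    nat 3 * (norm x + (norm y + (norm z + 0#)))
      ≈⟨ *-congˡ (solve 3 (λ x y z → x :+ (y :+ (z :+ con (+ 0))) := x :+ y :+ z) ≈-refl (norm x) (norm y) (norm z)) ⟩
    nat 3 * (norm x + norm y + norm z) ∎

  -- b k = yᵏ - k y Aᵏ⁻¹ + (k-1) Aᵏ satisfies b (k+1) = y b k + k Aᵏ⁻¹ (y - A)².
  power-mean : ∀ {y A} k → NonNeg y → NonNeg A →
               nat (suc k) * A ^ k * y ≼ y ^ suc k + nat k * A ^ suc k
  power-mean {y} {A} zero p q = ≼-reflexive
    (solve 2 (λ y a → con (+ 1) :* con (+ 1) :* y := y :* con (+ 1) :+ con (+ 0) :* (a :* con (+ 1))) ≈-refl y A)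
  power-mean {y} {A} (suc k) p q = NonNeg-resp identity
    (NonNeg-+ (NonNeg-* p (power-mean k p q))
              (NonNeg-* (NonNeg-* (nat-NonNeg (suc k)) (^-NonNeg k q)) (square-NonNeg (conj-- (NonNeg-real p) (NonNeg-real q)))))
    where
    identity : y * (y ^ suc k + nat k * A ^ suc k - nat (suc k) * A ^ k * y) + nat (suc k) * A ^ k * ((y - A) * (y - A))
             ≈ y ^ suc (suc k) + nat (suc k) * A ^ suc (suc k) - nat (suc (suc k)) * A ^ suc k * y
    identity = begin-equality
      y * (y ^ suc k + nat k * A ^ suc k - nat (suc k) * A ^ k * y) + nat (suc k) * A ^ k * ((y - A) * (y - A))
        ≈⟨ +-cong (*-congˡ (+-congˡ (-‿cong (*-congʳ (*-congʳ (nat-suc k)))))) (*-congʳ (*-congʳ (nat-suc k))) ⟩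
      y * (y ^ suc k + nat k * A ^ suc k - (1# + nat k) * A ^ k * y) + (1# + nat k) * A ^ k * ((y - A) * (y - A))
        ≈⟨ solve 5 (λ y a n Y P → y :* ((y :* Y) :+ n :* (a :* P) :- (con (+ 1) :+ n) :* P :* y) :+ (con (+ 1) :+ n) :* P :* ((y :- a) :* (y :- a))
             := y :* (y :* Y) :+ (con (+ 1) :+ n) :* (a :* (a :* P)) :- (con (+ 1) :+ (con (+ 1) :+ n)) :* (a :* P) :* y) ≈-refl
             y A (nat k) (y ^ k) (A ^ k) ⟩
      y ^ suc (suc k) + (1# + nat k) * A ^ suc (suc k) - (1# + (1# + nat k)) * A ^ suc k * y
        ≈⟨ +-cong (+-congˡ (*-congʳ (nat-suc k)))
             (-‿cong (*-congʳ (*-congʳ (≈-trans (nat-suc (suc k)) (+-congˡ (nat-suc k)))))) ⟨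
      y ^ suc (suc k) + nat (suc k) * A ^ suc (suc k) - nat (suc (suc k)) * A ^ suc k * y ∎

-- Vectors over a finite field and the dot product

module VectorSpace (K : FiniteField) where
  open FiniteField K using (F; elements; inverse; _≟_; _⊕_; ‖_‖) renaming (0# to 0ᶠ; 1# to 1ᶠ)
  module 𝔽 = CommutativeRing (fieldRing K)
  open 𝔽
    using (*-identityˡ; *-comm; *-assoc; zeroˡ; zeroʳ; +-identityʳ; +-identityˡ; +-comm; -‿inverseʳ)
    renaming (_+_ to _+ᶠ_; -_ to -ᶠ_; _-_ to _-ᶠ_; _*_ to _*ᶠ_)
  module FS = IntegerSolver (fieldRing K)
  open FS using (solve; _:=_; _:+_; _:*_; _:-_; :-_; con)

  private
    variable
      d : ℕ

  -- inv 0 = 0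
  inv : F → F
  inv x with x ≟ 0ᶠ
  ... | yes _ = 0ᶠ
  ... | no x≢0 = proj₁ (inverse x x≢0)

  inv-0 : inv 0ᶠ ≡ 0ᶠ
  inv-0 with 0ᶠ ≟ 0ᶠ
  ... | yes _ = refl
  ... | no 0≢0 = ⊥-elim (0≢0 refl)

  *-inv : ∀ {x} → x ≢ 0ᶠ → x *ᶠ inv x ≡ 1ᶠ
  *-inv {x} x≢0 with x ≟ 0ᶠ
  ... | yes x≡0 = ⊥-elim (x≢0 x≡0)
  ... | no x≢0′ = proj₂ (inverse x x≢0′)

  *-cancelˡ : ∀ {x y z} → x ≢ 0ᶠ → x *ᶠ y ≡ x *ᶠ z → y ≡ z
  *-cancelˡ {x} {y} {z} x≢0 p = begin
    y                       ≡⟨ *-identityˡ y ⟨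
    1ᶠ *ᶠ y                 ≡⟨ ≡.cong (_*ᶠ y) (≡.trans (*-comm (inv x) x) (*-inv x≢0)) ⟨
    inv x *ᶠ x *ᶠ y         ≡⟨ *-assoc _ _ _ ⟩
    inv x *ᶠ (x *ᶠ y)       ≡⟨ ≡.cong (inv x *ᶠ_) p ⟩
    inv x *ᶠ (x *ᶠ z)       ≡⟨ *-assoc _ _ _ ⟨
    inv x *ᶠ x *ᶠ z         ≡⟨ ≡.cong (_*ᶠ z) (≡.trans (*-comm (inv x) x) (*-inv x≢0)) ⟩
    1ᶠ *ᶠ z                 ≡⟨ *-identityˡ z ⟩
    z                       ∎
    where open ≡.≡-Reasoning

  *-≢0 : ∀ {x y} → x ≢ 0ᶠ → y ≢ 0ᶠ → x *ᶠ y ≢ 0ᶠ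
  *-≢0 x≢0 y≢0 xy≡0 = y≢0 (*-cancelˡ x≢0 (≡.trans xy≡0 (≡.sym (zeroʳ _))))

  *≡0⇒≡0 : ∀ {x y} → x ≢ 0ᶠ → x *ᶠ y ≡ 0ᶠ → y ≡ 0ᶠ
  *≡0⇒≡0 x≢0 xy≡0 = *-cancelˡ x≢0 (≡.trans xy≡0 (≡.sym (zeroʳ _)))

  square-quotient : ∀ {s t u v} → u ≢ 0ᶠ → s *ᶠ (u *ᶠ u) ≡ t → v *ᶠ v ≡ t → (v *ᶠ inv u) *ᶠ (v *ᶠ inv u) ≡ s
  square-quotient {s} {t} {u} {v} u≢0 suu≡t vv≡t = begin
    (v *ᶠ inv u) *ᶠ (v *ᶠ inv u)
      ≡⟨ solve 2 (λ v i → (v :* i) :* (v :* i) := (v :* v) :* (i :* i)) refl v (inv u) ⟩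
    (v *ᶠ v) *ᶠ (inv u *ᶠ inv u)
      ≡⟨ ≡.cong (_*ᶠ (inv u *ᶠ inv u)) (≡.trans vv≡t (≡.sym suu≡t)) ⟩
    s *ᶠ (u *ᶠ u) *ᶠ (inv u *ᶠ inv u)
      ≡⟨ solve 3 (λ s u i → s :* (u :* u) :* (i :* i) := s :* ((u :* i) :* (u :* i))) refl s u (inv u) ⟩
    s *ᶠ ((u *ᶠ inv u) *ᶠ (u *ᶠ inv u))
      ≡⟨ ≡.cong (λ z → s *ᶠ (z *ᶠ z)) (*-inv u≢0) ⟩
    s *ᶠ (1ᶠ *ᶠ 1ᶠ)
      ≡⟨ solve 1 (λ s → s :* (con (+ 1) :* con (+ 1)) := s) refl s ⟩
    s ∎
    where open ≡.≡-Reasoning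

  -≡0 : ∀ {x y} → x -ᶠ y ≡ 0ᶠ → x ≡ y
  -≡0 {x} {y} p = ≡.trans (solve 2 (λ x y → x := (x :- y) :+ y) refl x y) (≡.trans (≡.cong (_+ᶠ y) p) (+-identityˡ y))

  dot : Vec F d → Vec F d → F
  dot [] [] = 0ᶠ
  dot (x ∷ xs) (y ∷ ys) = x *ᶠ y +ᶠ dot xs ys

  infixr 7 _∙_
  _∙_ : F → Vec F d → Vec F d
  c ∙ x = mapᵛ (c *ᶠ_) x

  ⊖_ : Vec F d → Vec F d
  ⊖ x = mapᵛ -ᶠ_ x

  𝟎 : Vec F d
  𝟎 = replicate _ 0ᶠ

  dot-comm : ∀ (x y : Vec F d) → dot x y ≡ dot y x
  dot-comm [] [] = refl
  dot-comm (x ∷ xs) (y ∷ ys) = ≡.cong₂ _+ᶠ_ (*-comm x y) (dot-comm xs ys)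

  dot-⊕ˡ : ∀ (x y z : Vec F d) → dot (x ⊕ y) z ≡ dot x z +ᶠ dot y z
  dot-⊕ˡ [] [] [] = ≡.sym (+-identityˡ 0ᶠ)
  dot-⊕ˡ (x ∷ xs) (y ∷ ys) (z ∷ zs) = ≡.trans (≡.cong ((x +ᶠ y) *ᶠ z +ᶠ_) (dot-⊕ˡ xs ys zs))
    (solve 5 (λ x y z s t → (x :+ y) :* z :+ (s :+ t) := (x :* z :+ s) :+ (y :* z :+ t)) refl x y z _ _)

  dot-⊕ʳ : ∀ (x y z : Vec F d) → dot z (x ⊕ y) ≡ dot z x +ᶠ dot z y
  dot-⊕ʳ x y z = ≡.trans (dot-comm z (x ⊕ y)) (≡.trans (dot-⊕ˡ x y z) (≡.cong₂ _+ᶠ_ (dot-comm x z) (dot-comm y z)))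

  dot-∙ˡ : ∀ c (x y : Vec F d) → dot (c ∙ x) y ≡ c *ᶠ dot x y
  dot-∙ˡ c [] [] = ≡.sym (zeroʳ c)
  dot-∙ˡ c (x ∷ xs) (y ∷ ys) = ≡.trans (≡.cong (c *ᶠ x *ᶠ y +ᶠ_) (dot-∙ˡ c xs ys))
    (solve 4 (λ c x y s → c :* x :* y :+ c :* s := c :* (x :* y :+ s)) refl c x y _)

  dot-∙ʳ : ∀ c (x y : Vec F d) → dot y (c ∙ x) ≡ c *ᶠ dot y x
  dot-∙ʳ c x y = ≡.trans (dot-comm y (c ∙ x)) (≡.trans (dot-∙ˡ c x y) (≡.cong (c *ᶠ_) (dot-comm x y)))

  dot-𝟎 : ∀ (x : Vec F d) → dot x 𝟎 ≡ 0ᶠ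
  dot-𝟎 [] = refl
  dot-𝟎 (x ∷ xs) = ≡.trans (≡.cong₂ _+ᶠ_ (zeroʳ x) (dot-𝟎 xs)) (+-identityˡ 0ᶠ)

  dot-self : ∀ (x : Vec F d) → dot x x ≡ ‖ x ‖
  dot-self [] = refl
  dot-self (x ∷ xs) = ≡.cong (x *ᶠ x +ᶠ_) (dot-self xs)

  ‖⊕‖ : ∀ (x y : Vec F d) → ‖ x ⊕ y ‖ ≡ ‖ x ‖ +ᶠ ‖ y ‖ +ᶠ (dot x y +ᶠ dot x y)
  ‖⊕‖ [] [] = solve 0 (con (+ 0) := con (+ 0) :+ con (+ 0) :+ (con (+ 0) :+ con (+ 0))) refl
  ‖⊕‖ (x ∷ xs) (y ∷ ys) = ≡.trans (≡.cong ((x +ᶠ y) *ᶠ (x +ᶠ y) +ᶠ_) (‖⊕‖ xs ys))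
    (solve 5 (λ x y s t u → (x :+ y) :* (x :+ y) :+ (s :+ t :+ (u :+ u))
      := (x :* x :+ s) :+ (y :* y :+ t) :+ ((x :* y :+ u) :+ (x :* y :+ u))) refl x y _ _ _)

  ‖∙‖ : ∀ c (x : Vec F d) → ‖ c ∙ x ‖ ≡ c *ᶠ c *ᶠ ‖ x ‖
  ‖∙‖ c [] = ≡.sym (zeroʳ _)
  ‖∙‖ c (x ∷ xs) = ≡.trans (≡.cong (c *ᶠ x *ᶠ (c *ᶠ x) +ᶠ_) (‖∙‖ c xs))
    (solve 3 (λ c x s → c :* x :* (c :* x) :+ c :* c :* s := c :* c :* (x :* x :+ s)) refl c x _)

  ⊕-⊖ : ∀ (x y : Vec F d) → (x ⊕ y) ⊕ (⊖ y) ≡ x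
  ⊕-⊖ [] [] = refl
  ⊕-⊖ (x ∷ xs) (y ∷ ys) = ≡.cong₂ _∷_ (solve 2 (λ x y → (x :+ y) :- y := x) refl x y) (⊕-⊖ xs ys)

  ⊖-⊕ : ∀ (x y : Vec F d) → (x ⊕ (⊖ y)) ⊕ y ≡ x
  ⊖-⊕ [] [] = refl
  ⊖-⊕ (x ∷ xs) (y ∷ ys) = ≡.cong₂ _∷_ (solve 2 (λ x y → (x :- y) :+ y := x) refl x y) (⊖-⊕ xs ys)

  ∙-≡𝟎 : ∀ {c} → c ≢ 0ᶠ → (x : Vec F d) → c ∙ x ≡ 𝟎 → x ≡ 𝟎
  ∙-≡𝟎 c≢0 [] p = refl
  ∙-≡𝟎 c≢0 (x ∷ xs) p with ∷-injective p
  ... | q , r = ≡.cong₂ _∷_ (*≡0⇒≡0 c≢0 q) (∙-≡𝟎 c≢0 xs r)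

  ∙-𝟎 : ∀ c → c ∙ 𝟎 {d} ≡ 𝟎
  ∙-𝟎 {zero} c = refl
  ∙-𝟎 {suc d} c = ≡.cong₂ _∷_ (zeroʳ c) (∙-𝟎 c)

  ‖𝟎‖ : ‖ 𝟎 {d} ‖ ≡ 0ᶠ
  ‖𝟎‖ {d} = ≡.trans (≡.sym (dot-self (𝟎 {d}))) (dot-𝟎 (𝟎 {d}))

  vectors : ∀ d → List (Vec F d)
  vectors zero = [] ∷ []
  vectors (suc d) = cartesianProductWith _∷_ elements (vectors d)

  vectors-complete : ∀ (x : Vec F d) → x ∈ vectors d
  vectors-complete [] = here refl
  vectors-complete (x ∷ xs) = ∈-cartesianProductWith⁺ _∷_ (FiniteField.complete K x) (vectors-complete xs)

  vectors-unique : ∀ d → Unique (vectors d)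
  vectors-unique zero = [] ∷ []
  vectors-unique (suc d) = cartesianProductWith⁺ _∷_ ∷-injective (FiniteField.distinct K) (vectors-unique d)

  _≟ᵛ_ : DecidableEquality (Vec F d)
  _≟ᵛ_ = ≡-dec _≟_

  vectorEnumeration : ∀ d → Enumeration (Vec F d)
  vectorEnumeration d = record
    { _≟_ = _≟ᵛ_ ; list = vectors d ; complete = vectors-complete ; unique = vectors-unique d }

-- Orthogonality of characters, Plancherel and Parseval

module Plancherel (K : FiniteField) (M : CharacterRing K) where
  open Order K M

  module Kernel {A X : Set} (_≟_ : DecidableEquality X) (as : List A) (e : A → X → Carrier) (Q : Carrier)
    (orthogonal : ∀ x y → ∑[ a ← as ] (e a x * conj (e a y)) ≈ [ y ≟ x ] * Q) where

    -- Only orthogonality of the kernel is assumed, because three kernels occur: the characters of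
    -- the vector space, those of the field, and the latter with frequencies twisted by s ↦ -1/(4s).
    plancherel : ∀ (c : X → Carrier) {xs} → Unique xs →
      ∑[ a ← as ] norm (∑[ x ← xs ] (c x * e a x)) ≈ Q * (∑[ x ← xs ] norm (c x))
    plancherel c {xs} unique = begin-equality
      ∑[ a ← as ] norm (∑[ x ← xs ] (c x * e a x))
        ≈⟨ ∑-cong as (λ a → ≈-trans (*-congˡ (conj-∑ xs _)) (∑-*-∑ xs xs _ _)) ⟩
      ∑[ a ← as ] (∑[ x ← xs ] (∑[ y ← xs ] (c x * e a x * conj (c y * e a y))))
        ≈⟨ ∑-swap as xs _ ⟩
      ∑[ x ← xs ] (∑[ a ← as ] (∑[ y ← xs ] (c x * e a x * conj (c y * e a y))))
        ≈⟨ ∑-cong xs (λ x → ∑-swap as xs _) ⟩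
      ∑[ x ← xs ] (∑[ y ← xs ] (∑[ a ← as ] (c x * e a x * conj (c y * e a y))))
        ≈⟨ ∑-cong xs (λ x → ∑-cong xs (λ y → inner x y)) ⟩
      ∑[ x ← xs ] (∑[ y ← xs ] ([ y ≟ x ] * (c x * conj (c y) * Q)))
        ≈⟨ ∑-cong-∈ xs (λ {x} x∈ → ∑-pick _≟_ (λ y → c x * conj (c y) * Q) unique x∈) ⟩
      ∑[ x ← xs ] (norm (c x) * Q)
        ≈⟨ ≈-trans (∑-*ʳ xs Q _) (*-comm _ _) ⟩
      Q * (∑[ x ← xs ] norm (c x)) ∎
      where
      inner : ∀ x y → ∑[ a ← as ] (c x * e a x * conj (c y * e a y)) ≈ [ y ≟ x ] * (c x * conj (c y) * Q)
      inner x y = begin-equality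
        ∑[ a ← as ] (c x * e a x * conj (c y * e a y))
          ≈⟨ ∑-cong as (λ a → ≈-trans (*-congˡ (conj-* _ _))
               (solve 4 (λ a b c d → (a :* b) :* (c :* d) := (a :* c) :* (b :* d)) ≈-refl (c x) (e a x) (conj (c y)) (conj (e a y)))) ⟩
        ∑[ a ← as ] (c x * conj (c y) * (e a x * conj (e a y)))
          ≈⟨ ∑-*ˡ as _ _ ⟩
        c x * conj (c y) * (∑[ a ← as ] (e a x * conj (e a y)))
          ≈⟨ *-congˡ (orthogonal x y) ⟩
        c x * conj (c y) * ([ y ≟ x ] * Q)
          ≈⟨ solve 3 (λ a b c → a :* (b :* c) := b :* (a :* c)) ≈-refl (c x * conj (c y)) [ y ≟ x ] Q ⟩
        [ y ≟ x ] * (c x * conj (c y) * Q) ∎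

module Characters (K : FiniteField) (M : CharacterRing K) where
  open FiniteField K using (F; elements; size; _≟_; _⊕_) renaming (0# to 0ᶠ; 1# to 1ᶠ)
  open VectorSpace K
  open 𝔽 using () renaming (_+_ to _+ᶠ_; -_ to -ᶠ_; _-_ to _-ᶠ_; _*_ to _*ᶠ_)
  open Order K M

  private
    variable
      d : ℕ

  χ-cong : ∀ {a b} → a ≡ b → χ a ≈ χ b
  χ-cong refl = ≈-refl

  χ-conj : ∀ a b → χ a * conj (χ b) ≈ χ (a -ᶠ b)
  χ-conj a b = ≈-trans (*-congˡ (conj-χ b)) (≈-sym (χ-+ a (-ᶠ b)))

  norm-χ : ∀ a → norm (χ a) ≈ 1#
  norm-χ a = ≈-trans (χ-conj a a) (≈-trans (χ-cong (𝔽.-‿inverseʳ a)) χ-0)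

  ∑F-reindex = EnumSummation.∑-reindex commutativeSemiring (fieldEnumeration K)
  ∑F-pick = EnumSummation.pick commutativeSemiring (fieldEnumeration K)

  ∑V-reindex : ∀ (φ ψ : Vec F d → Vec F d) → (∀ x → φ (ψ x) ≡ x) → (∀ x → ψ (φ x) ≡ x) →
               ∀ f → ∑[ x ← vectors d ] f (φ x) ≈ ∑ (vectors d) f
  ∑V-reindex {d} = EnumSummation.∑-reindex commutativeSemiring (vectorEnumeration d)

  ∑V-translate : ∀ (c : Vec F d) f → ∑[ x ← vectors d ] f (x ⊕ c) ≈ ∑ (vectors d) f
  ∑V-translate c = ∑V-reindex (_⊕ c) (λ x → x ⊕ (⊖ c)) (λ x → ⊖-⊕ x c) (λ x → ⊕-⊖ x c)

  ∑-χ-scale : ∀ {c} → c ≢ 0ᶠ → ∑[ t ← elements ] χ (t *ᶠ c) ≈ 0#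
  ∑-χ-scale {c} c≢0 = ≈-trans (∑F-reindex (_*ᶠ c) (_*ᶠ inv c) (λ t → undo t (inv c) c (≡.trans (𝔽.*-comm _ _) (*-inv c≢0)))
      (λ t → undo t c (inv c) (*-inv c≢0)) χ) ∑-χ
    where
    undo : ∀ t a b → a *ᶠ b ≡ 1ᶠ → t *ᶠ a *ᶠ b ≡ t
    undo t a b ab≡1 = ≡.trans (𝔽.*-assoc t a b) (≡.trans (≡.cong (t *ᶠ_) ab≡1) (𝔽.*-identityʳ t))

  orthogonalᶠ : ∀ x y → ∑[ t ← elements ] (χ (t *ᶠ x) * conj (χ (t *ᶠ y))) ≈ [ y ≟ x ] * nat size
  orthogonalᶠ x y with y ≟ x
  ... | yes refl = begin-equality
    ∑[ t ← elements ] norm (χ (t *ᶠ x))    ≈⟨ ∑-cong elements (λ t → norm-χ _) ⟩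
    ∑[ t ← elements ] 1#                   ≈⟨ ∑-const elements 1# ⟩
    nat size * 1#                          ≈⟨ *-comm _ _ ⟩
    1# * nat size                          ∎
  ... | no y≢x = begin-equality
    ∑[ t ← elements ] (χ (t *ᶠ x) * conj (χ (t *ᶠ y)))
      ≈⟨ ∑-cong elements (λ t → ≈-trans (χ-conj _ _)
           (χ-cong (FS.solve 3 (λ t x y → t FS.:* x FS.:- t FS.:* y FS.:= t FS.:* (x FS.:- y)) refl t x y))) ⟩
    ∑[ t ← elements ] χ (t *ᶠ (x -ᶠ y))
      ≈⟨ ∑-χ-scale (λ x-y≡0 → y≢x (≡.sym (-≡0 x-y≡0))) ⟩
    0#
      ≈⟨ zeroˡ _ ⟨
    0# * nat size ∎

  orthogonalᵛ : ∀ (x y : Vec F d) →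
    ∑[ m ← vectors d ] (χ (dot m x) * conj (χ (dot m y))) ≈ [ y ≟ᵛ x ] * nat (size ℕ.^ d)
  orthogonalᵛ [] [] = ≈-trans (+-identityʳ _) (≈-trans (norm-χ 0ᶠ) (≈-sym (*-identityˡ _)))
  orthogonalᵛ {suc d} (x ∷ xs) (y ∷ ys) = begin-equality
    ∑ (vectors (suc d)) _
      ≈⟨ ∑-cartesianProductWith _∷_ elements (vectors d) _ ⟩
    ∑[ a ← elements ] (∑[ m ← vectors d ] (χ (a *ᶠ x +ᶠ dot m xs) * conj (χ (a *ᶠ y +ᶠ dot m ys))))
      ≈⟨ ∑-cong elements (λ a → ∑-cong (vectors d) (λ m → ≈-trans
           (*-cong (χ-+ _ _) (≈-trans (conj-cong (χ-+ _ _)) (conj-* _ _)))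
           (solve 4 (λ a b c d → (a :* b) :* (c :* d) := (a :* c) :* (b :* d)) ≈-refl _ _ _ _))) ⟩
    ∑[ a ← elements ] (∑[ m ← vectors d ] (χ (a *ᶠ x) * conj (χ (a *ᶠ y)) * (χ (dot m xs) * conj (χ (dot m ys)))))
      ≈⟨ ∑-*-∑ elements (vectors d) _ _ ⟨
    (∑[ a ← elements ] (χ (a *ᶠ x) * conj (χ (a *ᶠ y)))) * (∑[ m ← vectors d ] (χ (dot m xs) * conj (χ (dot m ys))))
      ≈⟨ *-cong (orthogonalᶠ x y) (orthogonalᵛ xs ys) ⟩
    ([ y ≟ x ] * nat size) * ([ ys ≟ᵛ xs ] * nat (size ℕ.^ d))
      ≈⟨ solve 4 (λ a b c d → (a :* b) :* (c :* d) := (a :* c) :* (b :* d)) ≈-refl _ _ _ _ ⟩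
    ([ y ≟ x ] * [ ys ≟ᵛ xs ]) * (nat size * nat (size ℕ.^ d))
      ≈⟨ *-cong (indicator (y ≟ x) (ys ≟ᵛ xs) ((y ∷ ys) ≟ᵛ (x ∷ xs))) (≈-sym (nat-* size (size ℕ.^ d))) ⟩
    [ (y ∷ ys) ≟ᵛ (x ∷ xs) ] * nat (size ℕ.^ suc d) ∎
    where
    indicator : (P? : Dec (y ≡ x)) (Q? : Dec (ys ≡ xs)) (R? : Dec (y ∷ ys ≡ x ∷ xs)) → [ P? ] * [ Q? ] ≈ [ R? ]
    indicator (yes refl) (yes refl) R? = ≈-trans (*-identityˡ _) (≈-sym ([]-yes R? refl))
    indicator (yes refl) (no ¬p) R? = ≈-trans (*-identityˡ _) (≈-sym ([]-no R? (λ e → ¬p (proj₂ (∷-injective e)))))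
    indicator (no ¬p) Q? R? = ≈-trans (zeroˡ _) (≈-sym ([]-no R? (λ e → ¬p (proj₁ (∷-injective e)))))

  module Planchᵛ {d} = Plancherel.Kernel K M (_≟ᵛ_ {d}) (vectors d) (λ m x → χ (dot m x)) (nat (size ℕ.^ d)) orthogonalᵛ
  module Planchᶠ = Plancherel.Kernel K M _≟_ elements (λ t x → χ (t *ᶠ x)) (nat size) orthogonalᶠ

module Spectrum (K : FiniteField) (M : CharacterRing K) {d : ℕ} (E : List (Vec (FiniteField.F K) d)) where
  open FiniteField K using (F; size)
  open VectorSpace K
  open Order K M
  open Characters K M

  N : ℕ
  N = length E

  Ê : Vec F d → Carrier
  Ê m = ∑[ x ← E ] χ (dot m x)

  w : Vec F d → Carrier
  w m = norm (Ê m)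

  w-NonNeg : ∀ m → NonNeg (w m)
  w-NonNeg m = NonNeg-norm (Ê m)

  w≼N² : ∀ m → w m ≼ nat (N ℕ.* N)
  w≼N² m = begin
    norm (Ê m)
      ≲⟨ cauchy-schwarz-1 E _ ⟩
    nat N * (∑[ x ← E ] norm (χ (dot m x)))
      ≈⟨ *-congˡ (≈-trans (∑-cong E (λ x → norm-χ _)) (≈-trans (∑-const E 1#) (*-identityʳ _))) ⟩
    nat N * nat N
      ≈⟨ nat-* N N ⟨
    nat (N ℕ.* N) ∎

  parseval : Unique E → ∑ (vectors d) w ≈ nat (size ℕ.^ d ℕ.* N)
  parseval unique = begin-equality
    ∑[ m ← vectors d ] norm (∑[ x ← E ] χ (dot m x))
      ≈⟨ ∑-cong (vectors d) (λ m → norm-cong (∑-cong E (λ x → ≈-sym (*-identityˡ _)))) ⟩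
    ∑[ m ← vectors d ] norm (∑[ x ← E ] (1# * χ (dot m x)))
      ≈⟨ Planchᵛ.plancherel (λ _ → 1#) unique ⟩
    nat (size ℕ.^ d) * (∑[ x ← E ] norm 1#)
      ≈⟨ *-congˡ (≈-trans (∑-cong E (λ _ → norm-1)) (≈-trans (∑-const E 1#) (*-identityʳ _))) ⟩
    nat (size ℕ.^ d) * nat N
      ≈⟨ nat-* (size ℕ.^ d) N ⟨
    nat (size ℕ.^ d ℕ.* N) ∎

-- Counting in the natural numbers

module Counting where
  open Summation ℕP.+-*-commutativeSemiring public
  open import Data.Nat using (_+_; _*_; _≤_)

  ∑-length : ∀ {A : Set} (xs : List A) → ∑[ x ← xs ] 1 ≡ length xs
  ∑-length [] = refl
  ∑-length (x ∷ xs) = ≡.cong suc (∑-length xs)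

  ∑-const : ∀ {A : Set} (xs : List A) c → ∑[ x ← xs ] c ≡ length xs * c
  ∑-const [] c = refl
  ∑-const (x ∷ xs) c = ≡.cong (λ z → c + z) (∑-const xs c)

  count : ∀ {A : Set} {P : A → Set} (P? : ∀ x → Dec (P x)) (xs : List A) →
          ∑[ x ← xs ] [ P? x ] ≡ length (filter P? xs)
  count P? xs = begin
    ∑[ x ← xs ] [ P? x ]           ≡⟨ ∑-cong xs (λ x → ℕP.*-identityʳ _) ⟨
    ∑[ x ← xs ] ([ P? x ] * 1)     ≡⟨ ∑-filter P? xs (λ _ → 1) ⟨
    ∑[ x ← filter P? xs ] 1        ≡⟨ ∑-length (filter P? xs) ⟩
    length (filter P? xs)          ∎
    where open ≡.≡-Reasoning

  ∑-mono : ∀ {A : Set} (xs : List A) {f g : A → ℕ} → (∀ x → f x ≤ g x) → ∑ xs f ≤ ∑ xs g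
  ∑-mono [] p = ℕ.z≤n
  ∑-mono (x ∷ xs) p = ℕP.+-mono-≤ (p x) (∑-mono xs p)

  []-*-mono : ∀ {P : Set} (P? : Dec P) {m n} → (P → m ≤ n) → [ P? ] * m ≤ [ P? ] * n
  []-*-mono (yes p) h = ℕP.+-monoˡ-≤ 0 (h p)
  []-*-mono (no _) h = ℕ.z≤n

  length-cartesianProductWith : ∀ {A B C : Set} (f : A → B → C) xs ys → length (cartesianProductWith f xs ys) ≡ length xs * length ys
  length-cartesianProductWith f [] ys = refl
  length-cartesianProductWith f (x ∷ xs) ys =
    ≡.trans (length-++ (map (f x) ys)) (≡.cong₂ _+_ (length-map (f x) ys) (length-cartesianProductWith f xs ys))

  ∈⇒≤∑ : ∀ {A : Set} {xs : List A} {f : A → ℕ} {y} → y ∈ xs → f y ≤ ∑ xs f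
  ∈⇒≤∑ (here refl) = ℕP.m≤m+n _ _
  ∈⇒≤∑ {xs = x ∷ xs} {f} (there y∈) = ℕP.≤-trans (∈⇒≤∑ y∈) (ℕP.m≤n+m _ (f x))

module NatCount (K : FiniteField) (M : CharacterRing K) where
  private
    module O = Order K M
  open Counting

  nat-[] : ∀ {P : Set} (P? : Dec P) → O.nat [ P? ] O.≈ O.[ P? ]
  nat-[] (yes _) = O.≈-refl
  nat-[] (no _) = O.≈-refl

  nat-∑ : ∀ {A : Set} (xs : List A) (f : A → ℕ) → O.nat (∑ xs f) O.≈ O.∑ xs (λ x → O.nat (f x))
  nat-∑ [] f = O.≈-refl
  nat-∑ (x ∷ xs) f = O.≈-trans (O.nat-+ (f x) _) (O.+-congˡ (nat-∑ xs f))

  nat-count : ∀ {A : Set} {P : A → Set} (P? : ∀ x → Dec (P x)) (xs : List A) →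
              O.nat (∑[ x ← xs ] [ P? x ]) O.≈ O.∑ xs (λ x → O.[ P? x ])
  nat-count P? xs = O.≈-trans (nat-∑ xs _) (O.∑-cong xs (λ x → nat-[] (P? x)))

module Quadratics (K : FiniteField) where
  open FiniteField K using (F; elements; _≟_) renaming (0# to 0ᶠ)
  open VectorSpace K
  open 𝔽 using () renaming (_+_ to _+ᶠ_; -_ to -ᶠ_; _-_ to _-ᶠ_; _*_ to _*ᶠ_)
  open FS using (solve; _:=_; _:+_; _:*_; _:-_; con)
  open Counting
  open import Data.Nat using (_≤_)

  -- With three distinct roots the first divided differences b + (s + t) a vanish for each pair, and
  -- the difference of two of them forces a = 0 and then b = 0. The polynomial is in Horner form,
  -- the shape that a quadratic form takes along a line.
  quadratic-roots : ∀ a b c → a ≢ 0ᶠ ⊎ b ≢ 0ᶠ →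
    ∑[ t ← elements ] [ (c +ᶠ t *ᶠ (b +ᶠ t *ᶠ a)) ≟ 0ᶠ ] ≤ 2
  quadratic-roots a b c a≢0⊎b≢0 = ℕP.≤-trans (ℕP.≤-reflexive (count root? elements))
    (at-most-2 (filter root? elements) (filter⁺ root? (FiniteField.distinct K)) (all-filter root? elements))
    where
    Root : F → Set
    Root t = c +ᶠ t *ᶠ (b +ᶠ t *ᶠ a) ≡ 0ᶠ
    root? : ∀ t → Dec (Root t)
    root? t = (c +ᶠ t *ᶠ (b +ᶠ t *ᶠ a)) ≟ 0ᶠ
    x-y≢0 : ∀ {x y} → x ≢ y → x -ᶠ y ≢ 0ᶠ
    x-y≢0 x≢y p = x≢y (-≡0 p)
    slope : ∀ {s t} → s ≢ t → Root s → Root t → b +ᶠ (s +ᶠ t) *ᶠ a ≡ 0ᶠ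
    slope {s} {t} s≢t p q = *≡0⇒≡0 (x-y≢0 s≢t) (≡.trans
      (solve 5 (λ a b c s t → (s :- t) :* (b :+ (s :+ t) :* a)
         := (c :+ s :* (b :+ s :* a)) :- (c :+ t :* (b :+ t :* a))) refl a b c s t)
      (≡.trans (≡.cong₂ _-ᶠ_ p q) (𝔽.-‿inverseʳ 0ᶠ)))
    absurd : ∀ {s t u} → s ≢ t → s ≢ u → t ≢ u → Root s → Root t → Root u → ⊥
    absurd {s} {t} {u} s≢t s≢u t≢u p q r = contradiction a≢0⊎b≢0
      where
      a≡0 : a ≡ 0ᶠ
      a≡0 = *≡0⇒≡0 (x-y≢0 t≢u) (≡.trans
        (solve 5 (λ a b s t u → (t :- u) :* a := (b :+ (s :+ t) :* a) :- (b :+ (s :+ u) :* a)) refl a b s t u)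
        (≡.trans (≡.cong₂ _-ᶠ_ (slope s≢t p q) (slope s≢u p r)) (𝔽.-‿inverseʳ 0ᶠ)))
      b≡0 : b ≡ 0ᶠ
      b≡0 = ≡.trans (solve 2 (λ b z → b := b :+ z :* con (+ 0)) refl b (s +ᶠ t))
        (≡.trans (≡.cong (λ z → b +ᶠ (s +ᶠ t) *ᶠ z) (≡.sym a≡0)) (slope s≢t p q))
      contradiction : a ≢ 0ᶠ ⊎ b ≢ 0ᶠ → ⊥
      contradiction (inj₁ a≢0) = a≢0 a≡0
      contradiction (inj₂ b≢0) = b≢0 b≡0
    at-most-2 : ∀ ts → Unique ts → All Root ts → length ts ≤ 2
    at-most-2 [] _ _ = ℕ.z≤n
    at-most-2 (_ ∷ []) _ _ = ℕ.s≤s ℕ.z≤n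
    at-most-2 (_ ∷ _ ∷ []) _ _ = ℕ.s≤s (ℕ.s≤s ℕ.z≤n)
    at-most-2 (_ ∷ _ ∷ _ ∷ _) ((s≢t ∷ s≢u ∷ _) ∷ (t≢u ∷ _) ∷ _) (p ∷ q ∷ r ∷ _) = ⊥-elim (absurd s≢t s≢u t≢u p q r)

-- Sections of spheres by affine subspaces

module Subspaces (K : FiniteField) (M : CharacterRing K) (char≢2 : FiniteField.CharNot2 K) (d : ℕ) where
  open FiniteField K using (F; elements; size; _≟_; _⊕_; ‖_‖) renaming (0# to 0ᶠ; 1# to 1ᶠ)
  open VectorSpace K
  open 𝔽 using () renaming (_+_ to _+ᶠ_; -_ to -ᶠ_; _-_ to _-ᶠ_; _*_ to _*ᶠ_)
  open FS using (solve; _:=_; _:+_; _:*_; _:-_; :-_; con)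
  open Counting
  open Quadratics K
  open import Data.Nat using (_+_; _*_; _≤_; _^_)
  open EnumSummation ℕP.+-*-commutativeSemiring (fieldEnumeration K) using (count-≡)
  module Vₙ = EnumSummation ℕP.+-*-commutativeSemiring (vectorEnumeration d)

  V : Set
  V = Vec F d

  2≢0 : 1ᶠ +ᶠ 1ᶠ ≢ 0ᶠ
  2≢0 = char≢2

  x+x≡0⇒x≡0 : ∀ {x} → x +ᶠ x ≡ 0ᶠ → x ≡ 0ᶠ
  x+x≡0⇒x≡0 {x} p = *≡0⇒≡0 2≢0 (≡.trans (solve 1 (λ x → (con (+ 1) :+ con (+ 1)) :* x := x :+ x) refl x) p)

  Direction : List V → V → Set
  Direction zs u = All (λ z → dot u z ≡ 0ᶠ) zs

  direction? : ∀ zs u → Dec (Direction zs u)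
  direction? zs u = All.all? (λ z → dot u z ≟ 0ᶠ) zs

  -- On the sphere ‖a‖ = r this says ‖z + a‖ = r; Direction is the linear part of these conditions.
  OnHyperplane : V → V → Set
  OnHyperplane a z = ‖ z ‖ +ᶠ (dot a z +ᶠ dot a z) ≡ 0ᶠ

  onHyperplane? : ∀ a z → Dec (OnHyperplane a z)
  onHyperplane? a z = (‖ z ‖ +ᶠ (dot a z +ᶠ dot a z)) ≟ 0ᶠ

  Point : List V → V → Set
  Point zs a = All (OnHyperplane a) zs

  point? : ∀ zs a → Dec (Point zs a)
  point? zs a = All.all? (onHyperplane? a) zs

  directions : List V → List V
  directions zs = filter (direction? zs) (vectors d)

  #directions : List V → ℕ
  #directions zs = ∑[ u ← vectors d ] [ direction? zs u ]

  ∈directions : ∀ {zs u} → Direction zs u → u ∈ directions zs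
  ∈directions {zs} p = ∈-filter⁺ (direction? zs) (vectors-complete _) p

  directions∈ : ∀ {zs u} → u ∈ directions zs → Direction zs u
  directions∈ {zs} p = proj₂ (∈-filter⁻ (direction? zs) {xs = vectors d} p)

  -- The double orthogonal complement, hence the span of zs. Testing z against the list of
  -- directions makes linear dependence decidable by enumeration, without coefficients or
  -- elimination.
  Annihilates : List V → V → Set
  Annihilates zs z = All (λ u → dot u z ≡ 0ᶠ) (directions zs)

  annihilates? : ∀ zs z → Dec (Annihilates zs z)
  annihilates? zs z = All.all? (λ u → dot u z ≟ 0ᶠ) (directions zs)

  direction-𝟎 : ∀ zs → Direction zs 𝟎
  direction-𝟎 zs = All.universal (λ z → ≡.trans (dot-comm 𝟎 z) (dot-𝟎 z)) zs

  direction-⊕∙ : ∀ {zs u v} c → Direction zs u → Direction zs v → Direction zs (u ⊕ (c ∙ v))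
  direction-⊕∙ c [] [] = []
  direction-⊕∙ {z ∷ zs} {u} {v} c (p ∷ ps) (q ∷ qs) = eq ∷ direction-⊕∙ {zs} {u} {v} c ps qs
    where
    eq : dot (u ⊕ (c ∙ v)) z ≡ 0ᶠ
    eq = ≡.trans (dot-⊕ˡ u (c ∙ v) z) (≡.trans (≡.cong₂ _+ᶠ_ p (≡.trans (dot-∙ˡ c v z) (≡.cong (c *ᶠ_) q)))
      (solve 1 (λ c → con (+ 0) :+ c :* con (+ 0) := con (+ 0)) refl c))

  direction-⊕∙⁻ : ∀ {zs u v} c → Direction zs (u ⊕ (c ∙ v)) → Direction zs v → Direction zs u
  direction-⊕∙⁻ c [] [] = []
  direction-⊕∙⁻ {z ∷ zs} {u} {v} c (p ∷ ps) (q ∷ qs) = eq ∷ direction-⊕∙⁻ {zs} {u} {v} c ps qs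
    where
    eq : dot u z ≡ 0ᶠ
    eq = ≡.trans (solve 2 (λ c s → s := s :+ c :* con (+ 0)) refl c (dot u z))
      (≡.trans (≡.cong (λ t → dot u z +ᶠ c *ᶠ t) (≡.sym q))
      (≡.trans (≡.cong (dot u z +ᶠ_) (≡.sym (dot-∙ˡ c v z))) (≡.trans (≡.sym (dot-⊕ˡ u (c ∙ v) z)) p)))

  #directions≡length : ∀ zs → #directions zs ≡ length (directions zs)
  #directions≡length zs = count (direction? zs) (vectors d)

  #directions>0 : ∀ zs → 1 ≤ #directions zs
  #directions>0 zs = ℕP.≤-trans (ℕP.≤-reflexive (≡.sym ([]-yes (direction? zs 𝟎) (direction-𝟎 zs))))
    (∈⇒≤∑ {f = λ u → [ direction? zs u ]} (vectors-complete (𝟎 {d})))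

  module _ (zs : List V) where
    private
      module O = Order K M
      module Sp = Spectrum K M (directions zs)
      C = Characters.χ-cong K M

    -- On the annihilator the Fourier transform of the subspace of directions equals its cardinality
    -- n. Keeping only these frequencies in Parseval gives |annihilator| n² ≤ q^d n.
    annihilator-bound : (∑[ z ← vectors d ] [ annihilates? zs z ]) * #directions zs ≤ size ^ d
    annihilator-bound = ℕP.*-cancelʳ-≤ (B * n) (size ^ d) n {{ℕ.>-nonZero (#directions>0 zs)}} (begin
      B * n * n          ≡⟨ ℕP.*-assoc B n n ⟩
      B * (n * n)        ≤⟨ CharacterRing.NonNeg-reflect M inR ⟩
      size ^ d * n       ∎)
      where
      open ℕP.≤-Reasoning
      B n : ℕ
      B = ∑[ z ← vectors d ] [ annihilates? zs z ]
      n = #directions zs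
      n≡ : n ≡ Sp.N
      n≡ = #directions≡length zs
      nat-B : O.nat B O.≈ O.∑ (vectors d) (λ z → O.[ annihilates? zs z ])
      nat-B = NatCount.nat-count K M (annihilates? zs) (vectors d)
      at-annihilator : ∀ z → Annihilates zs z → O.nat (n * n) O.≈ Sp.w z
      at-annihilator z p = O.≈-trans (O.nat-* n n) (O.≈-trans (O.*-congˡ (O.≈-sym (O.conj-nat n))) (O.norm-cong (O.≈-sym Ê≈n)))
        where
        Ê≈n : Sp.Ê z O.≈ O.nat n
        Ê≈n = O.≈-trans
          (O.∑-cong-∈ (directions zs) (λ {u} u∈ → O.≈-trans (C (≡.trans (dot-comm z u) (All.lookup p u∈))) O.χ-0))
          (O.≈-trans (O.∑-const (directions zs) O.1#) (O.≈-trans (O.*-identityʳ _) (O.reflexive (≡.cong O.nat (≡.sym n≡)))))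
      inR : O.nat (B * (n * n)) O.≼ O.nat (size ^ d * n)
      inR = O.begin
        O.nat (B * (n * n))
          O.≈⟨ O.≈-trans (O.nat-* B (n * n)) (O.*-congʳ nat-B) ⟩
        O.∑ (vectors d) (λ z → O.[ annihilates? zs z ]) O.* O.nat (n * n)
          O.≈⟨ O.∑-*ʳ (vectors d) _ _ ⟨
        O.∑ (vectors d) (λ z → O.[ annihilates? zs z ] O.* O.nat (n * n))
          O.≈⟨ O.∑-cong (vectors d) (λ z → O.[]-*-cong (annihilates? zs z) (at-annihilator z)) ⟩
        O.∑ (vectors d) (λ z → O.[ annihilates? zs z ] O.* Sp.w z)
          O.≲⟨ O.∑-mono (vectors d) (λ z → O.[]*≼ (annihilates? zs z) (Sp.w-NonNeg z)) ⟩
        O.∑ (vectors d) Sp.w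
          O.≈⟨ Sp.parseval (filter⁺ (direction? zs) (vectors-unique d)) ⟩
        O.nat (size ^ d * Sp.N)
          O.≈⟨ O.reflexive (≡.cong (λ l → O.nat (size ^ d * l)) (≡.sym n≡)) ⟩
        O.nat (size ^ d * n) O.∎

  -- Averaging over the translates by c v reduces a count to counts on lines parallel to v. Each
  -- base point u is kept, so no representatives of the lines have to be selected.
  ∑-lines : ∀ (v : V) (f : V → ℕ) → size * ∑ (vectors d) f ≡ ∑[ u ← vectors d ] (∑[ c ← elements ] f (u ⊕ (c ∙ v)))
  ∑-lines v f = begin
    size * ∑ (vectors d) f
      ≡⟨ ∑-const elements _ ⟨
    ∑[ c ← elements ] ∑ (vectors d) f
      ≡⟨ ∑-cong elements (λ c → Vₙ.∑-reindex (_⊕ (c ∙ v)) (λ x → x ⊕ (⊖ (c ∙ v))) (λ x → ⊖-⊕ x (c ∙ v)) (λ x → ⊕-⊖ x (c ∙ v)) f) ⟨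
    ∑[ c ← elements ] (∑[ u ← vectors d ] f (u ⊕ (c ∙ v)))
      ≡⟨ ∑-swap elements (vectors d) _ ⟩
    ∑[ u ← vectors d ] (∑[ c ← elements ] f (u ⊕ (c ∙ v))) ∎
    where open ≡.≡-Reasoning

  -- Some direction u₀ has u₀ · z ≠ 0. For a direction u the line u + c u₀ meets the hyperplane
  -- orthogonal to z for exactly one c, so the cardinality falls by exactly the factor q.
  #directions-∷ : ∀ {zs z} → ¬ Annihilates zs z → size * #directions (z ∷ zs) ≡ #directions zs
  #directions-∷ {zs} {z} ¬ann with find (¬All⇒Any¬ (λ u → dot u z ≟ 0ᶠ) (directions zs) ¬ann)
  ... | u₀ , u₀∈ , u₀z≢0 = begin
    size * #directions (z ∷ zs)
      ≡⟨ ∑-lines u₀ _ ⟩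
    ∑[ u ← vectors d ] (∑[ c ← elements ] [ direction? (z ∷ zs) (u ⊕ (c ∙ u₀)) ])
      ≡⟨ ∑-cong (vectors d) (λ u → ∑-cong elements (λ c → indicator u c)) ⟩
    ∑[ u ← vectors d ] (∑[ c ← elements ] ([ direction? zs u ] * [ c ≟ root u ]))
      ≡⟨ ∑-cong (vectors d) (λ u → ≡.trans (∑-*ˡ elements [ direction? zs u ] _)
           (≡.trans (≡.cong ([ direction? zs u ] *_) (count-≡ (root u))) (ℕP.*-identityʳ _))) ⟩
    #directions zs ∎
    where
    open ≡.≡-Reasoning
    direction-u₀ : Direction zs u₀
    direction-u₀ = directions∈ {zs} u₀∈
    root : V → F
    root u = -ᶠ (inv (dot u₀ z) *ᶠ dot u z)
    expand : ∀ u c → dot (u ⊕ (c ∙ u₀)) z ≡ dot u₀ z *ᶠ (c -ᶠ root u)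
    expand u c = ≡.trans (dot-⊕ˡ u (c ∙ u₀) z) (≡.trans (≡.cong (dot u z +ᶠ_) (dot-∙ˡ c u₀ z))
      (≡.trans (≡.cong (_+ᶠ c *ᶠ dot u₀ z) (≡.sym (𝔽.*-identityˡ (dot u z))))
      (≡.trans (≡.cong (λ t → t *ᶠ dot u z +ᶠ c *ᶠ dot u₀ z) (≡.sym (*-inv u₀z≢0)))
      (solve 4 (λ s t i c → (t :* i) :* s :+ c :* t := t :* (c :- (:- (i :* s)))) refl (dot u z) (dot u₀ z) (inv (dot u₀ z)) c))))
    indicator : ∀ u c → [ direction? (z ∷ zs) (u ⊕ (c ∙ u₀)) ] ≡ [ direction? zs u ] * [ c ≟ root u ]
    indicator u c = ≡.trans ([]-cong (direction? (z ∷ zs) (u ⊕ (c ∙ u₀))) (direction? zs u ×-dec (c ≟ root u))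
      (λ { (p ∷ ps) → direction-⊕∙⁻ {zs} {u} {u₀} c ps direction-u₀ , -≡0 (*≡0⇒≡0 u₀z≢0 (≡.trans (≡.sym (expand u c)) p)) })
      (λ { (ps , c≡) → ≡.trans (expand u c) (≡.trans (≡.cong (λ t → dot u₀ z *ᶠ (t -ᶠ root u)) c≡)
             (solve 2 (λ a b → a :* (b :- b) := con (+ 0)) refl (dot u₀ z) (root u))) ∷ direction-⊕∙ {zs} {u} {u₀} c ps direction-u₀ }))
      ([]-× (direction? zs u) (c ≟ root u))

  OnSphere : F → List V → V → Set
  OnSphere r zs a = Point zs a × ‖ a ‖ ≡ r

  onSphere? : ∀ r zs a → Dec (OnSphere r zs a)
  onSphere? r zs a = point? zs a ×-dec (‖ a ‖ ≟ r)

  module _ {r : F} (r≢0 : r ≢ 0ᶠ) {zs : List V} {k : ℕ} (d≡k+k : d ≡ k + k) (#directions≡ : #directions zs ≡ size ^ k) where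

    module _ {a₀ : V} (a₀∈ : OnSphere r zs a₀) where
      private
        -- This is ‖u + a₀‖ - ‖a₀‖: seen from a₀ the sphere becomes a quadric through the origin.
        f : V → F
        f u = ‖ u ‖ +ᶠ (dot u a₀ +ᶠ dot u a₀)

        Tangent : V → Set
        Tangent u = Direction zs u × f u ≡ 0ᶠ

        tangent? : ∀ u → Dec (Tangent u)
        tangent? u = direction? zs u ×-dec (f u ≟ 0ᶠ)

        f-line : ∀ u v c → f (u ⊕ (c ∙ v)) ≡ f u +ᶠ c *ᶠ (((dot u v +ᶠ dot u v) +ᶠ (dot v a₀ +ᶠ dot v a₀)) +ᶠ c *ᶠ ‖ v ‖)
        f-line u v c = ≡.trans
          (≡.cong₂ (λ s t → s +ᶠ (t +ᶠ t))
            (≡.trans (‖⊕‖ u (c ∙ v)) (≡.cong₂ (λ s t → ‖ u ‖ +ᶠ s +ᶠ (t +ᶠ t)) (‖∙‖ c v) (dot-∙ʳ c v u)))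
            (≡.trans (dot-⊕ˡ u (c ∙ v) a₀) (≡.cong (dot u a₀ +ᶠ_) (dot-∙ˡ c v a₀))))
          (solve 6 (λ U W s t x c → (U :+ c :* c :* W :+ (c :* s :+ c :* s)) :+ ((t :+ c :* x) :+ (t :+ c :* x))
             := (U :+ (t :+ t)) :+ c :* (((s :+ s) :+ (x :+ x)) :+ c :* W)) refl (‖ u ‖) (‖ v ‖) (dot u v) (dot u a₀) (dot v a₀) c)

        point-⊕ : ∀ {u} ys → Point ys a₀ → Point ys (u ⊕ a₀) → Direction ys u
        point-⊕ [] _ _ = []
        point-⊕ {u} (z ∷ ys) (p ∷ ps) (q ∷ qs) = x+x≡0⇒x≡0 (≡.trans
          (solve 3 (λ n s t → t :+ t := (n :+ ((t :+ s) :+ (t :+ s))) :- (n :+ (s :+ s))) refl (‖ z ‖) (dot a₀ z) (dot u z))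
          (≡.trans (≡.cong₂ (λ x y → (‖ z ‖ +ᶠ (x +ᶠ x)) -ᶠ y) (≡.sym (dot-⊕ˡ u a₀ z)) p)
          (≡.trans (≡.cong (_-ᶠ 0ᶠ) q) (𝔽.-‿inverseʳ 0ᶠ)))) ∷ point-⊕ {u} ys ps qs

        sphere-tangent : ∀ u → OnSphere r zs (u ⊕ a₀) → Tangent u
        sphere-tangent u (p , q) = point-⊕ {u} zs (proj₁ a₀∈) p ,
          ≡.trans (solve 3 (λ n s a → n :+ s := (n :+ a :+ s) :- a) refl (‖ u ‖) (dot u a₀ +ᶠ dot u a₀) (‖ a₀ ‖))
          (≡.trans (≡.cong₂ _-ᶠ_ (≡.trans (≡.sym (‖⊕‖ u a₀)) q) (proj₂ a₀∈)) (𝔽.-‿inverseʳ r))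

        Z : ℕ
        Z = ∑[ a ← vectors d ] [ onSphere? r zs a ]

        T : ℕ
        T = ∑[ u ← vectors d ] [ tangent? u ]

        []-mono : ∀ {P Q : Set} (P? : Dec P) (Q? : Dec Q) → (P → Q) → [ P? ] ≤ [ Q? ]
        []-mono (yes p) Q? h = ℕP.≤-reflexive (≡.sym ([]-yes Q? (h p)))
        []-mono (no _) Q? h = ℕ.z≤n

        Z≤T : Z ≤ T
        Z≤T = ℕP.≤-trans (ℕP.≤-reflexive (≡.sym (Vₙ.∑-reindex (_⊕ a₀) (λ x → x ⊕ (⊖ a₀)) (λ x → ⊖-⊕ x a₀) (λ x → ⊕-⊖ x a₀) _)))
          (∑-mono (vectors d) (λ u → []-mono (onSphere? r zs (u ⊕ a₀)) (tangent? u) (sphere-tangent u)))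

        -- The hypothesis says that on every line parallel to v through a direction u the polynomial
        -- `f` is not constant. Its degree is at most two, so at most two of the q points of such a
        -- line are zeros.
        transversal : ∀ v → Direction zs v → (∀ u → Direction zs u → ‖ v ‖ ≢ 0ᶠ ⊎ (dot u v +ᶠ dot u v) +ᶠ (dot v a₀ +ᶠ dot v a₀) ≢ 0ᶠ) →
                      size * T ≤ 2 * #directions zs
        transversal v dv h = begin
          size * T
            ≡⟨ ∑-lines v _ ⟩
          ∑[ u ← vectors d ] (∑[ c ← elements ] [ tangent? (u ⊕ (c ∙ v)) ])
            ≤⟨ ∑-mono (vectors d) (λ u → ∑-mono elements (λ c → indicator u c)) ⟩
          ∑[ u ← vectors d ] (∑[ c ← elements ] ([ direction? zs u ] * [ (f u +ᶠ c *ᶠ (slope u +ᶠ c *ᶠ ‖ v ‖)) ≟ 0ᶠ ]))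
            ≡⟨ ∑-cong (vectors d) (λ u → ∑-*ˡ elements [ direction? zs u ] _) ⟩
          ∑[ u ← vectors d ] ([ direction? zs u ] * (∑[ c ← elements ] [ (f u +ᶠ c *ᶠ (slope u +ᶠ c *ᶠ ‖ v ‖)) ≟ 0ᶠ ]))
            ≤⟨ ∑-mono (vectors d) (λ u → []-*-mono (direction? zs u) (λ du → quadratic-roots (‖ v ‖) (slope u) (f u) (h u du))) ⟩
          ∑[ u ← vectors d ] ([ direction? zs u ] * 2)
            ≡⟨ ≡.trans (∑-*ʳ (vectors d) 2 (λ u → [ direction? zs u ])) (ℕP.*-comm (#directions zs) 2) ⟩
          2 * #directions zs ∎
          where
          open ℕP.≤-Reasoning
          slope : V → F
          slope u = (dot u v +ᶠ dot u v) +ᶠ (dot v a₀ +ᶠ dot v a₀)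
          indicator : ∀ u c → [ tangent? (u ⊕ (c ∙ v)) ] ≤ [ direction? zs u ] * [ (f u +ᶠ c *ᶠ (slope u +ᶠ c *ᶠ ‖ v ‖)) ≟ 0ᶠ ]
          indicator u c = ℕP.≤-trans
            ([]-mono (tangent? (u ⊕ (c ∙ v))) (direction? zs u ×-dec ((f u +ᶠ c *ᶠ (slope u +ᶠ c *ᶠ ‖ v ‖)) ≟ 0ᶠ))
               (λ { (p , q) → direction-⊕∙⁻ {zs} {u} {v} c p dv , ≡.trans (≡.sym (f-line u v c)) q }))
            (ℕP.≤-reflexive ([]-× (direction? zs u) ((f u +ᶠ c *ᶠ (slope u +ᶠ c *ᶠ ‖ v ‖)) ≟ 0ᶠ)))

        -- Polarisation: ‖u + v‖ = ‖u‖ + ‖v‖ + 2 u · v, and 2 is invertible.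
        isotropic-dot : All (λ v → ‖ v ‖ ≡ 0ᶠ) (directions zs) → ∀ u v → Direction zs u → Direction zs v → dot u v ≡ 0ᶠ
        isotropic-dot iso u v du dv = x+x≡0⇒x≡0 (≡.trans
          (solve 1 (λ x → x :+ x := con (+ 0) :+ con (+ 0) :+ (x :+ x)) refl (dot u v))
          (≡.trans (≡.cong₂ (λ x y → x +ᶠ y +ᶠ (dot u v +ᶠ dot u v)) (≡.sym (zero-norm u du)) (≡.sym (zero-norm v dv)))
          (≡.trans (≡.sym (‖⊕‖ u v)) (≡.trans (≡.cong (λ x → ‖ u ⊕ x ‖) (≡.sym (1∙ v))) (zero-norm (u ⊕ (1ᶠ ∙ v)) (direction-⊕∙ {zs} {u} {v} 1ᶠ du dv))))))
          where
          zero-norm : ∀ v → Direction zs v → ‖ v ‖ ≡ 0ᶠ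
          zero-norm v dv = All.lookup iso (∈directions {zs} {v} dv)
          1∙ : ∀ {n} (v : Vec F n) → 1ᶠ ∙ v ≡ v
          1∙ [] = refl
          1∙ (x ∷ v) = ≡.cong₂ _∷_ (𝔽.*-identityˡ x) (1∙ v)

        -- The directions U would form a totally isotropic subspace with |U| = |U^⊥|, so a₀ ∈ U^⊥ = U and r = ‖a₀‖ = 0.
        totally-isotropic : All (λ v → ‖ v ‖ ≡ 0ᶠ) (directions zs) → All (λ v → dot v a₀ ≡ 0ᶠ) (directions zs) → ⊥
        totally-isotropic iso a₀⊥ with direction? zs a₀
        ... | yes da₀ = r≢0 (≡.trans (≡.sym (proj₂ a₀∈)) (All.lookup iso (∈directions {zs} {a₀} da₀)))
        ... | no ¬da₀ = ℕP.1+n≰n (ℕP.*-cancelʳ-≤ (suc n) n n {{ℕ.>-nonZero (#directions>0 zs)}} (begin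
            suc n * n                   ≤⟨ ℕP.*-monoˡ-≤ n bigger ⟩
            annihilators * n            ≤⟨ annihilator-bound zs ⟩
            size ^ d                    ≡⟨ ≡.cong (size ^_) d≡k+k ⟩
            size ^ (k + k)              ≡⟨ ℕP.^-distribˡ-+-* size k k ⟩
            size ^ k * size ^ k         ≡⟨ ≡.cong₂ _*_ #directions≡ #directions≡ ⟨
            n * n                       ∎))
          where
          open ℕP.≤-Reasoning
          n annihilators : ℕ
          n = #directions zs
          annihilators = ∑[ z ← vectors d ] [ annihilates? zs z ]
          cases : ∀ u → [ u ≟ᵛ a₀ ] + [ direction? zs u ] ≤ [ annihilates? zs u ]
          cases u with u ≟ᵛ a₀
          ... | yes refl = ℕP.≤-reflexive (≡.trans (≡.cong suc ([]-no (direction? zs u) ¬da₀)) (≡.sym ([]-yes (annihilates? zs u) a₀⊥)))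
          ... | no _ = []-mono (direction? zs u) (annihilates? zs u) (λ du → All.tabulate (λ {v} v∈ → isotropic-dot iso v u (directions∈ {zs} v∈) du))
          bigger : suc n ≤ annihilators
          bigger = begin
            1 + n                                                                         ≡⟨ ≡.cong (_+ n) (Vₙ.count-≡ a₀) ⟨
            (∑[ u ← vectors d ] [ u ≟ᵛ a₀ ]) + n                                          ≡⟨ ∑-+ (vectors d) _ _ ⟨
            ∑[ u ← vectors d ] ([ u ≟ᵛ a₀ ] + [ direction? zs u ])                        ≤⟨ ∑-mono (vectors d) cases ⟩
            annihilators                                                                  ∎

        T-bound : size * T ≤ 2 * #directions zs
        T-bound with All.all? (λ v → ‖ v ‖ ≟ 0ᶠ) (directions zs) | All.all? (λ v → dot v a₀ ≟ 0ᶠ) (directions zs)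
        ... | no ¬iso | _ with find (¬All⇒Any¬ (λ v → ‖ v ‖ ≟ 0ᶠ) (directions zs) ¬iso)
        ...   | v , v∈ , ‖v‖≢0 = transversal v (directions∈ {zs} v∈) (λ _ _ → inj₁ ‖v‖≢0)
        -- All directions being isotropic and mutually orthogonal, the slope along v is 2 v · a₀ for
        -- every u, so one v not orthogonal to a₀ suffices.
        T-bound | yes iso | no ¬a₀⊥ with find (¬All⇒Any¬ (λ v → dot v a₀ ≟ 0ᶠ) (directions zs) ¬a₀⊥)
        ...   | v , v∈ , va₀≢0 = transversal v (directions∈ {zs} v∈) (λ u du → inj₂ (λ p → va₀≢0 (x+x≡0⇒x≡0 (≡.trans
                  (solve 1 (λ x → x := (con (+ 0) :+ con (+ 0)) :+ x) refl (dot v a₀ +ᶠ dot v a₀))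
                  (≡.trans (≡.cong (λ t → (t +ᶠ t) +ᶠ (dot v a₀ +ᶠ dot v a₀)) (≡.sym (isotropic-dot iso u v du (directions∈ {zs} v∈)))) p)))))
        T-bound | yes iso | yes a₀⊥ = ⊥-elim (totally-isotropic iso a₀⊥)

      Z-bound : size * (∑[ a ← vectors d ] [ onSphere? r zs a ]) ≤ 2 * size ^ k
      Z-bound = ℕP.≤-trans (ℕP.*-monoʳ-≤ size Z≤T) (ℕP.≤-trans T-bound (ℕP.≤-reflexive (≡.cong (2 *_) #directions≡)))

    -- An empty section is small for trivial reasons; otherwise any of its points can serve as the
    -- origin a₀.
    sphere-section : size * (∑[ a ← vectors d ] [ onSphere? r zs a ]) ≤ 2 * size ^ k
    sphere-section = go (filter (onSphere? r zs) (vectors d)) refl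
      where
      go : ∀ as → filter (onSphere? r zs) (vectors d) ≡ as → size * (∑[ a ← vectors d ] [ onSphere? r zs a ]) ≤ 2 * size ^ k
      go [] eq = ℕP.≤-trans (ℕP.≤-reflexive (≡.trans
        (≡.cong (size *_) (≡.trans (count (onSphere? r zs) (vectors d)) (≡.cong length eq))) (ℕP.*-zeroʳ size))) ℕ.z≤n
      go (a ∷ as) eq = Z-bound {a} (proj₂ (∈-filter⁻ (onSphere? r zs) {xs = vectors d} (≡.subst (a ∈_) (≡.sym eq) (here refl))))

-- Balancing the powers of q and N

module ExponentArithmetic where
  open import Data.Nat using (_+_; _*_; _^_; _≤_)
  open ℕP.≤-Reasoning
  open +-*-Solver using (solve; _:=_; _:+_; _:*_; con)

  ^-distribʳ-* : ∀ m n k → (m * n) ^ k ≡ m ^ k * n ^ k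
  ^-distribʳ-* m n zero = refl
  ^-distribʳ-* m n (suc k) = ≡.trans (≡.cong (m * n *_) (^-distribʳ-* m n k))
    (solve 4 (λ m n a b → m :* n :* (a :* b) := m :* a :* (n :* b)) refl m n (m ^ k) (n ^ k))

  -- The balance of the two terms of the power mean inequality; this is where the exponent is used.
  balance : ∀ q N k′ → let k = suc k′; d = k + k; A = N ^ 5; B = q ^ (2 + d); Θ = q ^ d * N in
    q ^ (4 * (k * k) + k′) ≤ N ^ (4 * k′ + 3) →
    q * q * (N * N * (N * N) * (B ^ k * ((2 + k) * (N * N * q ^ k′ * Θ ^ k)) + k′ * (A ^ k * Θ))) ≤ (1 + k + k) * (N ^ 10 * (A ^ k′ * B))
  balance q N k′ H = begin
    q * q * (N * N * (N * N) * (B ^ k * ((2 + k) * (N * N * q ^ k′ * Θ ^ k)) + k′ * (A ^ k * Θ)))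
      ≡⟨ solve 9 (λ q N BB c qk Θk k A Θ → q :* q :* (N :* N :* (N :* N) :* (BB :* (c :* (N :* N :* qk :* Θk)) :+ k :* (A :* Θ)))
           := c :* (q :* q :* (N :* N :* (N :* N) :* (N :* N)) :* qk :* BB :* Θk) :+ k :* (q :* q :* (N :* N :* (N :* N)) :* A :* Θ)) refl
           q N (B ^ k) (2 + k) (q ^ k′) (Θ ^ k) k′ (A ^ k) Θ ⟩
    (2 + k) * (q * q * (N * N * (N * N) * (N * N)) * q ^ k′ * B ^ k * Θ ^ k) + k′ * (q * q * (N * N * (N * N)) * A ^ k * Θ)
      ≤⟨ ℕP.+-mono-≤ (ℕP.*-monoʳ-≤ (2 + k) first) (ℕP.≤-reflexive (≡.cong (k′ *_) second)) ⟩
    (2 + k) * (N ^ 10 * (A ^ k′ * B)) + k′ * (N ^ 10 * (A ^ k′ * B))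
      ≡⟨ solve 2 (λ k x → (con 3 :+ k) :* x :+ k :* x := (con 1 :+ (con 1 :+ k) :+ (con 1 :+ k)) :* x) refl k′ (N ^ 10 * (A ^ k′ * B)) ⟩
    (1 + k + k) * (N ^ 10 * (A ^ k′ * B)) ∎
    where
    k d A B Θ : ℕ
    k = suc k′
    d = k + k
    A = N ^ 5
    B = q ^ (2 + d)
    Θ = q ^ d * N
    q-part : q * q * q ^ k′ * B ^ k′ * q ^ (d * k) ≡ q ^ (4 * (k * k) + k′)
    q-part = begin-equality
      q * q * q ^ k′ * B ^ k′ * q ^ (d * k)
        ≡⟨ ≡.cong (λ x → q * q * q ^ k′ * x * q ^ (d * k)) (ℕP.^-*-assoc q (2 + d) k′) ⟩
      q * q * q ^ k′ * q ^ ((2 + d) * k′) * q ^ (d * k)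
        ≡⟨ solve 4 (λ q a b c → q :* q :* a :* b :* c := q :* (q :* con 1) :* (a :* (b :* c))) refl q (q ^ k′) (q ^ ((2 + d) * k′)) (q ^ (d * k)) ⟩
      q ^ 2 * (q ^ k′ * (q ^ ((2 + d) * k′) * q ^ (d * k)))
        ≡⟨ ≡.cong (λ x → q ^ 2 * (q ^ k′ * x)) (ℕP.^-distribˡ-+-* q ((2 + d) * k′) (d * k)) ⟨
      q ^ 2 * (q ^ k′ * q ^ ((2 + d) * k′ + d * k))
        ≡⟨ ≡.cong (q ^ 2 *_) (ℕP.^-distribˡ-+-* q k′ ((2 + d) * k′ + d * k)) ⟨
      q ^ 2 * q ^ (k′ + ((2 + d) * k′ + d * k))
        ≡⟨ ℕP.^-distribˡ-+-* q 2 (k′ + ((2 + d) * k′ + d * k)) ⟨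
      q ^ (2 + (k′ + ((2 + d) * k′ + d * k)))
        ≡⟨ ≡.cong (q ^_) (solve 1 (λ k → let K = con 1 :+ k; D = K :+ K in con 2 :+ (k :+ ((con 2 :+ D) :* k :+ D :* K))
             := con 4 :* (K :* K) :+ k) refl k′) ⟩
      q ^ (4 * (k * k) + k′) ∎
    Θ^k : Θ ^ k ≡ q ^ (d * k) * (N * N ^ k′)
    Θ^k = ≡.trans (^-distribʳ-* (q ^ d) N k) (≡.cong (_* N ^ k) (ℕP.^-*-assoc q d k))
    A^k′ : A ^ k′ ≡ N ^ k′ * N ^ (4 * k′)
    A^k′ = ≡.trans (ℕP.^-*-assoc N 5 k′) (ℕP.^-distribˡ-+-* N k′ (4 * k′))
    first : q * q * (N * N * (N * N) * (N * N)) * q ^ k′ * B ^ k * Θ ^ k ≤ N ^ 10 * (A ^ k′ * B)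
    first = begin
      q * q * (N * N * (N * N) * (N * N)) * q ^ k′ * (B * B ^ k′) * Θ ^ k
        ≡⟨ ≡.cong (q * q * (N * N * (N * N) * (N * N)) * q ^ k′ * (B * B ^ k′) *_) Θ^k ⟩
      q * q * (N * N * (N * N) * (N * N)) * q ^ k′ * (B * B ^ k′) * (q ^ (d * k) * (N * N ^ k′))
        ≡⟨ solve 7 (λ q N a B b c e → q :* q :* (N :* N :* (N :* N) :* (N :* N)) :* a :* (B :* b) :* (c :* (N :* e))
             := (q :* q :* a :* b :* c) :* (N :* N :* (N :* N) :* (N :* N) :* N :* e :* B)) refl q N (q ^ k′) B (B ^ k′) (q ^ (d * k)) (N ^ k′) ⟩
      (q * q * q ^ k′ * B ^ k′ * q ^ (d * k)) * (N * N * (N * N) * (N * N) * N * N ^ k′ * B)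
        ≡⟨ ≡.cong (_* (N * N * (N * N) * (N * N) * N * N ^ k′ * B)) q-part ⟩
      q ^ (4 * (k * k) + k′) * (N * N * (N * N) * (N * N) * N * N ^ k′ * B)
        ≤⟨ ℕP.*-monoˡ-≤ _ H ⟩
      N ^ (4 * k′ + 3) * (N * N * (N * N) * (N * N) * N * N ^ k′ * B)
        ≡⟨ ≡.cong (_* (N * N * (N * N) * (N * N) * N * N ^ k′ * B)) (ℕP.^-distribˡ-+-* N (4 * k′) 3) ⟩
      N ^ (4 * k′) * N ^ 3 * (N * N * (N * N) * (N * N) * N * N ^ k′ * B)
        ≡⟨ solve 4 (λ N a b B → a :* (N :* (N :* (N :* con 1))) :* (N :* N :* (N :* N) :* (N :* N) :* N :* b :* B)
             := N :* (N :* (N :* (N :* (N :* (N :* (N :* (N :* (N :* (N :* con 1))))))))) :* (b :* a :* B)) refl N (N ^ (4 * k′)) (N ^ k′) B ⟩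
      N ^ 10 * (N ^ k′ * N ^ (4 * k′) * B)
        ≡⟨ ≡.cong (λ x → N ^ 10 * (x * B)) A^k′ ⟨
      N ^ 10 * (A ^ k′ * B) ∎
    second : q * q * (N * N * (N * N)) * A ^ k * Θ ≡ N ^ 10 * (A ^ k′ * B)
    second = solve 4 (λ q N a b → q :* q :* (N :* N :* (N :* N)) :* (N :* (N :* (N :* (N :* (N :* con 1)))) :* a) :* (b :* N)
      := N :* (N :* (N :* (N :* (N :* (N :* (N :* (N :* (N :* (N :* con 1))))))))) :* (a :* (q :* (q :* b)))) refl q N (A ^ k′) (q ^ d)

-- Moments of the Fourier transform on spheres and incidences

module Moments (K : FiniteField) (M : CharacterRing K) (char≢2 : FiniteField.CharNot2 K) (k′ : ℕ)
  (E : List (Vec (FiniteField.F K) (suc k′ ℕ.+ suc k′))) (E-unique : Unique E) where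
  k d : ℕ
  k = suc k′
  d = k ℕ.+ k
  open FiniteField K using (F; elements; size; _≟_; _⊕_; ‖_‖)
  open VectorSpace K
  open 𝔽 using () renaming (_+_ to _+ᶠ_; -_ to -ᶠ_; _-_ to _-ᶠ_)
  open Order K M
  open Characters K M
  open Spectrum K M E public
  open Subspaces K M char≢2 d

  Vs : List V
  Vs = vectors d

  Θ N² : ℕ
  Θ = size ℕ.^ d ℕ.* N
  N² = N ℕ.* N

  w-real : ∀ m → conj (w m) ≈ w m
  w-real m = NonNeg-real (w-NonNeg m)

  sphere? : ∀ (r : F) (m : V) → Dec (‖ m ‖ ≡ r)
  sphere? r m = ‖ m ‖ ≟ r

  -- Since w = |Ê|², these are the second and fourth moments of Ê on a sphere, and the weighted
  -- number of pairs (a, z) with both a and z + a on that sphere.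
  W U incidences : F → Carrier
  W r = ∑[ m ← Vs ] ([ sphere? r m ] * w m)
  U r = ∑[ m ← Vs ] ([ sphere? r m ] * (w m * w m))

  Y : V → Carrier
  Y a = ∑[ z ← Vs ] ([ onHyperplane? a z ] * w z)

  incidences r = ∑[ a ← Vs ] ([ sphere? r a ] * (w a * Y a))

  cubes : F → Carrier
  cubes r = ∑[ m ← Vs ] ([ sphere? r m ] * (Ê m * (Ê m * Ê m)))

  W-NonNeg : ∀ r → NonNeg (W r)
  W-NonNeg r = ∑-NonNeg Vs (λ m → NonNeg-* ([]-NonNeg (sphere? r m)) (w-NonNeg m))

  U-NonNeg : ∀ r → NonNeg (U r)
  U-NonNeg r = ∑-NonNeg Vs (λ m → NonNeg-* ([]-NonNeg (sphere? r m)) (NonNeg-* (w-NonNeg m) (w-NonNeg m)))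

  Y-NonNeg : ∀ a → NonNeg (Y a)
  Y-NonNeg a = ∑-NonNeg Vs (λ z → NonNeg-* ([]-NonNeg (onHyperplane? a z)) (w-NonNeg z))

  Y≼Θ : ∀ a → Y a ≼ nat Θ
  Y≼Θ a = ≼-trans (∑-mono Vs (λ z → []*≼ (onHyperplane? a z) (w-NonNeg z))) (≼-reflexive (parseval E-unique))

  ∑-spheres : ∀ (f : V → Carrier) → ∑[ r ← elements ] (∑[ m ← Vs ] ([ sphere? r m ] * f m)) ≈ ∑ Vs f
  ∑-spheres f = begin-equality
    ∑[ r ← elements ] (∑[ m ← Vs ] ([ sphere? r m ] * f m))
      ≈⟨ ∑-swap elements Vs _ ⟩
    ∑[ m ← Vs ] (∑[ r ← elements ] ([ sphere? r m ] * f m))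
      ≈⟨ ∑-cong Vs (λ m → ∑-cong elements (λ r → *-congʳ ([]-cong (sphere? r m) (r ≟ ‖ m ‖) ≡.sym ≡.sym))) ⟩
    ∑[ m ← Vs ] (∑[ r ← elements ] ([ r ≟ ‖ m ‖ ] * f m))
      ≈⟨ ∑-cong Vs (λ m → ∑F-pick (λ _ → f m) (‖ m ‖)) ⟩
    ∑ Vs f ∎

  W-total : ∑ elements W ≈ nat Θ
  W-total = ≈-trans (∑-spheres w) (parseval E-unique)

  W≼Θ : ∀ r → W r ≼ nat Θ
  W≼Θ r = ≼-trans (∑-mono Vs (λ z → []*≼ (sphere? r z) (w-NonNeg z))) (≼-reflexive (parseval E-unique))

  -- The trivial estimate from the maximum of w. It holds for r = 0 too, and it is all that is used
  -- for that sphere and for ν(0).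
  U≼N²Θ : ∀ r → U r ≼ nat (N² ℕ.* Θ)
  U≼N²Θ r = begin
    ∑[ m ← Vs ] ([ sphere? r m ] * (w m * w m))
      ≲⟨ ∑-mono Vs (λ m → *-monoˡ ([]-NonNeg (sphere? r m)) (*-monoʳ (w-NonNeg m) (w≼N² m))) ⟩
    ∑[ m ← Vs ] ([ sphere? r m ] * (nat N² * w m))
      ≈⟨ ∑-cong Vs (λ m → solve 3 (λ a b c → a :* (b :* c) := b :* (a :* c)) ≈-refl [ sphere? r m ] (nat N²) (w m)) ⟩
    ∑[ m ← Vs ] (nat N² * ([ sphere? r m ] * w m))
      ≈⟨ ∑-*ˡ Vs (nat N²) _ ⟩
    nat N² * W r
      ≲⟨ *-monoˡ (nat-NonNeg N²) (W≼Θ r) ⟩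
    nat N² * nat Θ
      ≈⟨ nat-* N² Θ ⟨
    nat (N² ℕ.* Θ) ∎

  -- Ê³ is split as Ê · Ê²: the factor W can then be summed over all r by Parseval, and only U
  -- requires a bound that is uniform in r.
  cubes≼WU : ∀ r → norm (cubes r) ≼ W r * U r
  cubes≼WU r = begin
    norm (∑[ m ← Vs ] ([ sphere? r m ] * (Ê m * (Ê m * Ê m))))
      ≈⟨ norm-cong (∑-cong Vs (λ m → ≈-trans (*-congʳ (≈-sym ([]-idem (sphere? r m))))
           (solve 3 (λ a x y → a :* a :* (x :* y) := (a :* x) :* (a :* y)) ≈-refl [ sphere? r m ] (Ê m) (Ê m * Ê m)))) ⟩
    norm (∑[ m ← Vs ] (([ sphere? r m ] * Ê m) * ([ sphere? r m ] * (Ê m * Ê m))))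
      ≲⟨ cauchy-schwarz _ _ Vs ⟩
    (∑[ m ← Vs ] norm ([ sphere? r m ] * Ê m)) * (∑[ m ← Vs ] norm ([ sphere? r m ] * (Ê m * Ê m)))
      ≈⟨ *-cong (∑-cong Vs (λ m → norm-[]* (sphere? r m) (Ê m)))
           (∑-cong Vs (λ m → ≈-trans (norm-[]* (sphere? r m) (Ê m * Ê m)) (*-congˡ (norm-* (Ê m) (Ê m))))) ⟩
    W r * U r ∎

  ∑-cubes : ∑[ r ← elements ] norm (cubes r) ≼ nat (Θ ℕ.* (N² ℕ.* Θ))
  ∑-cubes = begin
    ∑[ r ← elements ] norm (cubes r)
      ≲⟨ ∑-mono elements cubes≼WU ⟩
    ∑[ r ← elements ] (W r * U r)
      ≲⟨ ∑-mono elements (λ r → *-monoˡ (W-NonNeg r) (U≼N²Θ r)) ⟩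
    ∑[ r ← elements ] (W r * nat (N² ℕ.* Θ))
      ≈⟨ ∑-*ʳ elements _ W ⟩
    ∑ elements W * nat (N² ℕ.* Θ)
      ≈⟨ *-congʳ W-total ⟩
    nat Θ * nat (N² ℕ.* Θ)
      ≈⟨ nat-* Θ (N² ℕ.* Θ) ⟨
    nat (Θ ℕ.* (N² ℕ.* Θ)) ∎

  module _ (r : F) where
    private
      S : V → Carrier
      S a = [ sphere? r a ]

      e : V → V → Carrier
      e a x = χ (dot a x)

      -- In U one of the two factors w is kept as a weight on the sphere and the other is opened as
      -- a double sum over E; this is what remains for each pair (x, y).
      kernel : V → V → Carrier
      kernel x y = ∑[ a ← Vs ] (S a * w a * (e a x * conj (e a y)))

      correlation : V → V → Carrier
      correlation a b = ∑[ x ← E ] (e a x * conj (e b x))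

    ∑-kernel : ∑[ x ← E ] (∑[ y ← E ] kernel x y) ≈ U r
    ∑-kernel = begin-equality
      ∑[ x ← E ] (∑[ y ← E ] (∑[ a ← Vs ] (S a * w a * (e a x * conj (e a y)))))
        ≈⟨ ∑-cong E (λ x → ∑-swap E Vs _) ⟩
      ∑[ x ← E ] (∑[ a ← Vs ] (∑[ y ← E ] (S a * w a * (e a x * conj (e a y)))))
        ≈⟨ ∑-swap E Vs _ ⟩
      ∑[ a ← Vs ] (∑[ x ← E ] (∑[ y ← E ] (S a * w a * (e a x * conj (e a y)))))
        ≈⟨ ∑-cong Vs (λ a → ≈-trans (∑-cong E (λ x → ∑-*ˡ E _ _)) (∑-*ˡ E _ _)) ⟩
      ∑[ a ← Vs ] (S a * w a * (∑[ x ← E ] (∑[ y ← E ] (e a x * conj (e a y)))))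
        ≈⟨ ∑-cong Vs (λ a → *-congˡ (≈-trans (≈-sym (∑-*-∑ E E _ _)) (*-congˡ (≈-sym (conj-∑ E _))))) ⟩
      ∑[ a ← Vs ] (S a * w a * w a)
        ≈⟨ ∑-cong Vs (λ a → *-assoc _ _ _) ⟩
      U r ∎

    ∑-norm-kernel : ∑[ x ← E ] (∑[ y ← E ] norm (kernel x y)) ≈
                    ∑[ a ← Vs ] (∑[ b ← Vs ] (S a * w a * (S b * w b) * norm (correlation a b)))
    ∑-norm-kernel = begin-equality
      ∑[ x ← E ] (∑[ y ← E ] norm (kernel x y))
        ≈⟨ ∑-cong E (λ x → ∑-cong E (λ y → ≈-trans (*-congˡ (conj-∑ Vs _)) (∑-*-∑ Vs Vs _ _))) ⟩
      ∑[ x ← E ] (∑[ y ← E ] (∑[ a ← Vs ] (∑[ b ← Vs ] (S a * w a * (e a x * conj (e a y)) * conj (S b * w b * (e b x * conj (e b y)))))))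
        ≈⟨ ∑-cong E (λ x → ≈-trans (∑-swap E Vs _) (∑-cong Vs (λ a → ∑-swap E Vs _))) ⟩
      ∑[ x ← E ] (∑[ a ← Vs ] (∑[ b ← Vs ] (∑[ y ← E ] (S a * w a * (e a x * conj (e a y)) * conj (S b * w b * (e b x * conj (e b y)))))))
        ≈⟨ ≈-trans (∑-swap E Vs _) (∑-cong Vs (λ a → ∑-swap E Vs _)) ⟩
      ∑[ a ← Vs ] (∑[ b ← Vs ] (∑[ x ← E ] (∑[ y ← E ] (S a * w a * (e a x * conj (e a y)) * conj (S b * w b * (e b x * conj (e b y)))))))
        ≈⟨ ∑-cong Vs (λ a → ∑-cong Vs (λ b → inner a b)) ⟩
      ∑[ a ← Vs ] (∑[ b ← Vs ] (S a * w a * (S b * w b) * norm (correlation a b))) ∎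
      where
      conj-term : ∀ b x y → conj (S b * w b * (e b x * conj (e b y))) ≈ S b * w b * (conj (e b x) * e b y)
      conj-term b x y = conj-*′ (conj-*′ (conj-[] (sphere? r b)) (w-real b)) (conj-*′ ≈-refl (conj-conj _))
      inner : ∀ a b → ∑[ x ← E ] (∑[ y ← E ] (S a * w a * (e a x * conj (e a y)) * conj (S b * w b * (e b x * conj (e b y)))))
                      ≈ S a * w a * (S b * w b) * norm (correlation a b)
      inner a b = begin-equality
        ∑[ x ← E ] (∑[ y ← E ] (S a * w a * (e a x * conj (e a y)) * conj (S b * w b * (e b x * conj (e b y)))))
          ≈⟨ ∑-cong E (λ x → ∑-cong E (λ y → ≈-trans (*-congˡ (conj-term b x y))
               (solve 6 (λ s t p q u v → s :* (p :* q) :* (t :* (u :* v)) := s :* t :* ((p :* u) :* (q :* v))) ≈-refl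
                  (S a * w a) (S b * w b) (e a x) (conj (e a y)) (conj (e b x)) (e b y)))) ⟩
        ∑[ x ← E ] (∑[ y ← E ] (S a * w a * (S b * w b) * ((e a x * conj (e b x)) * (conj (e a y) * e b y))))
          ≈⟨ ≈-trans (∑-cong E (λ x → ∑-*ˡ E _ _)) (∑-*ˡ E _ _) ⟩
        S a * w a * (S b * w b) * (∑[ x ← E ] (∑[ y ← E ] ((e a x * conj (e b x)) * (conj (e a y) * e b y))))
          ≈⟨ *-congˡ (≈-trans (≈-sym (∑-*-∑ E E _ _)) (*-congˡ
               (≈-trans (∑-cong E (λ y → ≈-sym (conj-*′ ≈-refl (conj-conj _)))) (≈-sym (conj-∑ E _))))) ⟩
        S a * w a * (S b * w b) * norm (correlation a b) ∎

    correlation-translate : ∀ z a → norm (correlation a (z ⊕ a)) ≈ w z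
    correlation-translate z a = ≈-trans (norm-cong (≈-trans (∑-cong E pointwise) (≈-sym (conj-∑ E _)))) (norm-conj (Ê z))
      where
      pointwise : ∀ x → e a x * conj (e (z ⊕ a) x) ≈ conj (e z x)
      pointwise x = ≈-trans (χ-conj _ _) (≈-trans (χ-cong (≡.trans (≡.cong (λ t → dot a x -ᶠ t) (dot-⊕ˡ z a x))
        (FS.solve 2 (λ s t → s FS.:- (t FS.:+ s) FS.:= FS.:- t) refl (dot a x) (dot z x)))) (≈-sym (conj-χ _)))

    -- In the substitution b = z + a the correlation depends on z alone, and for a on the sphere the
    -- condition on b becomes linear in a.
    ∑-correlation : ∀ a → ‖ a ‖ ≡ r → ∑[ b ← Vs ] (S b * norm (correlation a b)) ≈ Y a
    ∑-correlation a a∈ = ≈-trans (≈-sym (∑V-translate a _))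
      (∑-cong Vs (λ z → *-cong ([]-cong (sphere? r (z ⊕ a)) (onHyperplane? a z) (to z) (from z)) (correlation-translate z a)))
      where
      expand : ∀ z → ‖ z ⊕ a ‖ ≡ (‖ z ‖ +ᶠ (dot a z +ᶠ dot a z)) +ᶠ r
      expand z = ≡.trans (‖⊕‖ z a) (≡.trans (≡.cong₂ (λ x y → ‖ z ‖ +ᶠ x +ᶠ (y +ᶠ y)) a∈ (dot-comm z a))
        (FS.solve 3 (λ n r t → n FS.:+ r FS.:+ t FS.:= (n FS.:+ t) FS.:+ r) refl (‖ z ‖) r (dot a z +ᶠ dot a z)))
      to : ∀ z → ‖ z ⊕ a ‖ ≡ r → OnHyperplane a z
      to z p = ≡.trans (FS.solve 2 (λ x r → x FS.:= (x FS.:+ r) FS.:- r) refl _ r)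
        (≡.trans (≡.cong (_-ᶠ r) (≡.trans (≡.sym (expand z)) p)) (𝔽.-‿inverseʳ r))
      from : ∀ z → OnHyperplane a z → ‖ z ⊕ a ‖ ≡ r
      from z p = ≡.trans (expand z) (≡.trans (≡.cong (_+ᶠ r) p) (𝔽.+-identityˡ r))

    -- The factor N⁴ has two sources: Cauchy-Schwarz over x and then over y in E costs N², and
    -- replacing w b by its maximum costs another N². The weights w a and w z survive.
    U²≼ : U r * U r ≼ nat (N² ℕ.* N²) * incidences r
    U²≼ = begin
      U r * U r
        ≈⟨ norm-real (NonNeg-real (U-NonNeg r)) ⟨
      norm (U r)
        ≈⟨ norm-cong ∑-kernel ⟨
      norm (∑[ x ← E ] (∑[ y ← E ] kernel x y))
        ≲⟨ cauchy-schwarz-1 E _ ⟩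
      nat N * (∑[ x ← E ] norm (∑[ y ← E ] kernel x y))
        ≲⟨ *-monoˡ (nat-NonNeg N) (∑-mono E (λ x → cauchy-schwarz-1 E _)) ⟩
      nat N * (∑[ x ← E ] (nat N * (∑[ y ← E ] norm (kernel x y))))
        ≈⟨ ≈-trans (*-congˡ (∑-*ˡ E (nat N) _)) (≈-trans (≈-sym (*-assoc _ _ _)) (*-cong (≈-sym (nat-* N N)) ∑-norm-kernel)) ⟩
      nat N² * (∑[ a ← Vs ] (∑[ b ← Vs ] (S a * w a * (S b * w b) * norm (correlation a b))))
        ≲⟨ *-monoˡ (nat-NonNeg N²) (∑-mono Vs inner) ⟩
      nat N² * (∑[ a ← Vs ] (nat N² * (S a * (w a * Y a))))
        ≈⟨ ≈-trans (*-congˡ (∑-*ˡ Vs (nat N²) _)) (≈-trans (≈-sym (*-assoc _ _ _)) (*-congʳ (≈-sym (nat-* N² N²)))) ⟩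
      nat (N² ℕ.* N²) * incidences r ∎
      where
      inner : ∀ a → ∑[ b ← Vs ] (S a * w a * (S b * w b) * norm (correlation a b)) ≼ nat N² * (S a * (w a * Y a))
      inner a = begin
        ∑[ b ← Vs ] (S a * w a * (S b * w b) * norm (correlation a b))
          ≲⟨ ∑-mono Vs (λ b → *-monoʳ (NonNeg-norm _) (*-monoˡ (NonNeg-* ([]-NonNeg (sphere? r a)) (w-NonNeg a))
               (*-monoˡ ([]-NonNeg (sphere? r b)) (w≼N² b)))) ⟩
        ∑[ b ← Vs ] (S a * w a * (S b * nat N²) * norm (correlation a b))
          ≈⟨ ∑-cong Vs (λ b → solve 5 (λ s w t n c → s :* w :* (t :* n) :* c := n :* (s :* w) :* (t :* c)) ≈-refl
               (S a) (w a) (S b) (nat N²) (norm (correlation a b))) ⟩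
        ∑[ b ← Vs ] (nat N² * (S a * w a) * (S b * norm (correlation a b)))
          ≈⟨ ∑-*ˡ Vs _ _ ⟩
        nat N² * (S a * w a) * (∑[ b ← Vs ] (S b * norm (correlation a b)))
          ≈⟨ ≈-trans (*-assoc _ _ _) (*-congˡ (*-assoc _ _ _)) ⟩
        nat N² * (S a * (w a * (∑[ b ← Vs ] (S b * norm (correlation a b)))))
          ≈⟨ *-congˡ ([]-*-cong (sphere? r a) (λ a∈ → *-congˡ (∑-correlation a a∈))) ⟩
        nat N² * (S a * (w a * Y a)) ∎

-- Higher moments of the incidences and the bound for U

module Restriction (K : FiniteField) (M : CharacterRing K) (char≢2 : FiniteField.CharNot2 K) (k′ : ℕ)
  (E : List (Vec (FiniteField.F K) (suc k′ ℕ.+ suc k′))) (E-unique : Unique E) where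
  open FiniteField K using (F; elements; size; _≟_) renaming (0# to 0ᶠ)
  open VectorSpace K
  open Order K M
  open Moments K M char≢2 k′ E E-unique
  open Subspaces K M char≢2 d
  open NatCount K M
  open CommutativeExp commutativeSemiring using (^-distrib-*)
  open +-*-Solver using () renaming (solve to solveₙ; _:=_ to _≔_; _:+_ to _⊹_; _:*_ to _⊠_; con to conₙ)

  private
    instance
      size-nonZero : ℕ.NonZero size
      size-nonZero = ℕ.>-nonZero (ℕP.≤-trans (ℕ.s≤s ℕ.z≤n) (size≥2 K))

    q^k′ : ℕ
    q^k′ = size ℕ.^ k′

  module _ {r : F} (r≢0 : r ≢ 0ᶠ) where

    -- The list zs holds the hyperplanes already extracted, and i is the number of factors Y a that
    -- are still to be expanded.
    moment : ℕ → List V → Carrier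
    moment i zs = ∑[ a ← Vs ] ([ onSphere? r zs a ] * (w a * Y a ^ i))

    moment≼Θ : ∀ i zs → moment i zs ≼ nat (Θ ℕ.* Θ ℕ.^ i)
    moment≼Θ i zs = begin
      ∑[ a ← Vs ] ([ onSphere? r zs a ] * (w a * Y a ^ i))
        ≲⟨ ∑-mono Vs (λ a → []*≼ (onSphere? r zs a) (NonNeg-* (w-NonNeg a) (^-NonNeg i (Y-NonNeg a)))) ⟩
      ∑[ a ← Vs ] (w a * Y a ^ i)
        ≲⟨ ∑-mono Vs (λ a → *-monoˡ (w-NonNeg a) (^-mono i (Y-NonNeg a) (Y≼Θ a))) ⟩
      ∑[ a ← Vs ] (w a * nat Θ ^ i)
        ≈⟨ ≈-trans (∑-*ʳ Vs _ w) (*-cong (parseval E-unique) (≈-sym (nat-^ Θ i))) ⟩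
      nat Θ * nat (Θ ℕ.^ i)
        ≈⟨ nat-* Θ (Θ ℕ.^ i) ⟨
      nat (Θ ℕ.* Θ ℕ.^ i) ∎

    -- One factor Y a is written out as a sum over z, and its condition joins those on a that come
    -- from zs.
    moment-suc : ∀ i zs → moment (suc i) zs ≈ ∑[ z ← Vs ] (w z * moment i (z ∷ zs))
    moment-suc i zs = begin-equality
      ∑[ a ← Vs ] ([ onSphere? r zs a ] * (w a * (Y a * Y a ^ i)))
        ≈⟨ ∑-cong Vs (λ a → ≈-trans (solve 4 (λ s w y p → s :* (w :* (y :* p)) := y :* (s :* (w :* p))) ≈-refl
             [ onSphere? r zs a ] (w a) (Y a) (Y a ^ i)) (≈-sym (∑-*ʳ Vs _ _))) ⟩
      ∑[ a ← Vs ] (∑[ z ← Vs ] ([ onHyperplane? a z ] * w z * ([ onSphere? r zs a ] * (w a * Y a ^ i))))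
        ≈⟨ ∑-swap Vs Vs _ ⟩
      ∑[ z ← Vs ] (∑[ a ← Vs ] ([ onHyperplane? a z ] * w z * ([ onSphere? r zs a ] * (w a * Y a ^ i))))
        ≈⟨ ∑-cong Vs (λ z → ≈-trans (∑-cong Vs (λ a → ≈-trans
             (solve 4 (λ h w s x → h :* w :* (s :* x) := w :* (h :* s :* x)) ≈-refl [ onHyperplane? a z ] (w z) [ onSphere? r zs a ] (w a * Y a ^ i))
             (*-congˡ (*-congʳ (≈-sym (indicator a z)))))) (∑-*ˡ Vs (w z) _)) ⟩
      ∑[ z ← Vs ] (w z * moment i (z ∷ zs)) ∎
      where
      indicator : ∀ a z → [ onSphere? r (z ∷ zs) a ] ≈ [ onHyperplane? a z ] * [ onSphere? r zs a ]
      indicator a z = ≈-trans ([]-cong (onSphere? r (z ∷ zs) a) (onHyperplane? a z ×-dec onSphere? r zs a)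
        (λ { (p ∷ ps , e) → p , ps , e }) (λ { (p , ps , e) → p ∷ ps , e })) ([]-× (onHyperplane? a z) (onSphere? r zs a))

    -- The hypothesis says that zs imposes k - i independent conditions, so the induction ends with
    -- an affine k-space. The coefficient is 2 there, from `sphere-section`, and each expansion adds
    -- 1 for the z that depend on zs.
    moment-bound : ∀ i zs → #directions zs ≡ size ℕ.^ (i ℕ.+ k) → moment i zs ≼ nat ((2 ℕ.+ i) ℕ.* (N² ℕ.* q^k′ ℕ.* Θ ℕ.^ i))
    moment-bound zero zs #≡ = begin
      ∑[ a ← Vs ] ([ onSphere? r zs a ] * (w a * 1#))
        ≲⟨ ∑-mono Vs (λ a → *-monoˡ ([]-NonNeg (onSphere? r zs a)) (≼-trans (≼-reflexive (*-identityʳ _)) (w≼N² a))) ⟩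
      ∑[ a ← Vs ] ([ onSphere? r zs a ] * nat N²)
        ≈⟨ ≈-trans (∑-*ʳ Vs _ _) (*-congʳ (≈-sym (nat-count (onSphere? r zs) Vs))) ⟩
      nat Z * nat N²
        ≈⟨ nat-* Z N² ⟨
      nat (Z ℕ.* N²)
        ≲⟨ nat-mono (ℕP.≤-trans (ℕP.*-monoˡ-≤ N² Z≤) (ℕP.≤-reflexive (rearrange N² q^k′))) ⟩
      nat (2 ℕ.* (N² ℕ.* q^k′ ℕ.* 1)) ∎
      where
      Z : ℕ
      Z = Counting.∑ Vs (λ a → Counting.[ onSphere? r zs a ])
      Z≤ : Z ℕ.≤ 2 ℕ.* q^k′
      Z≤ = ℕP.*-cancelˡ-≤ size (ℕP.≤-trans (sphere-section r≢0 {zs} {k} refl #≡)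
        (ℕP.≤-reflexive (solveₙ 2 (λ q x → conₙ 2 ⊠ (q ⊠ x) ≔ q ⊠ (conₙ 2 ⊠ x)) refl size q^k′)))
      rearrange : ∀ n x → 2 ℕ.* x ℕ.* n ≡ 2 ℕ.* (n ℕ.* x ℕ.* 1)
      rearrange = solveₙ 2 (λ n x → conₙ 2 ⊠ x ⊠ n ≔ conₙ 2 ⊠ (n ⊠ x ⊠ conₙ 1)) refl
    moment-bound (suc i) zs #≡ = begin
      moment (suc i) zs
        ≈⟨ moment-suc i zs ⟩
      ∑[ z ← Vs ] (w z * moment i (z ∷ zs))
        ≲⟨ ∑-mono Vs split ⟩
      ∑[ z ← Vs ] ([ annihilates? zs z ] * nat (N² ℕ.* (Θ ℕ.* Θ ℕ.^ i)) + w z * nat c)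
        ≈⟨ ≈-trans (∑-+ Vs _ _) (+-cong (≈-trans (∑-*ʳ Vs _ _) (*-congʳ (≈-sym (nat-count (annihilates? zs) Vs))))
             (≈-trans (∑-*ʳ Vs _ w) (*-congʳ (parseval E-unique)))) ⟩
      nat annihilators * nat (N² ℕ.* (Θ ℕ.* Θ ℕ.^ i)) + nat Θ * nat c
        ≈⟨ ≈-trans (nat-+ (annihilators ℕ.* (N² ℕ.* (Θ ℕ.* Θ ℕ.^ i))) (Θ ℕ.* c)) (+-cong (nat-* annihilators (N² ℕ.* (Θ ℕ.* Θ ℕ.^ i))) (nat-* Θ c)) ⟨
      nat (annihilators ℕ.* (N² ℕ.* (Θ ℕ.* Θ ℕ.^ i)) ℕ.+ Θ ℕ.* c)
        ≲⟨ nat-mono (ℕP.≤-trans (ℕP.+-monoˡ-≤ (Θ ℕ.* c) (ℕP.*-monoˡ-≤ (N² ℕ.* (Θ ℕ.* Θ ℕ.^ i)) few-annihilators))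
             (ℕP.≤-reflexive (rearrange q^k′ N² Θ (Θ ℕ.^ i) i))) ⟩
      nat ((3 ℕ.+ i) ℕ.* (N² ℕ.* q^k′ ℕ.* (Θ ℕ.* Θ ℕ.^ i))) ∎
      where
      c annihilators : ℕ
      c = (2 ℕ.+ i) ℕ.* (N² ℕ.* q^k′ ℕ.* Θ ℕ.^ i)
      annihilators = Counting.∑ Vs (λ z → Counting.[ annihilates? zs z ])
      rearrange : ∀ p n t u i → p ℕ.* (n ℕ.* (t ℕ.* u)) ℕ.+ t ℕ.* ((2 ℕ.+ i) ℕ.* (n ℕ.* p ℕ.* u)) ≡ (3 ℕ.+ i) ℕ.* (n ℕ.* p ℕ.* (t ℕ.* u))
      rearrange = solveₙ 5 (λ p n t u i → p ⊠ (n ⊠ (t ⊠ u)) ⊹ t ⊠ ((conₙ 2 ⊹ i) ⊠ (n ⊠ p ⊠ u)) ≔ (conₙ 3 ⊹ i) ⊠ (n ⊠ p ⊠ (t ⊠ u))) refl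
      -- At most q^(k′-i) vectors are dependent on zs. The cruder bound q^k′ is as good here,
      -- because it equals the power of q contributed by the base case.
      few-annihilators : annihilators ℕ.≤ q^k′
      few-annihilators = ℕP.*-cancelʳ-≤ annihilators q^k′ (#directions zs) {{ℕ.>-nonZero (#directions>0 zs)}}
        (ℕP.≤-trans (annihilator-bound zs) (ℕP.≤-trans (ℕP.^-monoʳ-≤ size (d≤ i))
          (ℕP.≤-reflexive (≡.trans (ℕP.^-distribˡ-+-* size k′ (suc i ℕ.+ k)) (≡.cong (q^k′ ℕ.*_) (≡.sym #≡))))))
        where
        d≤ : ∀ i → d ℕ.≤ k′ ℕ.+ (suc i ℕ.+ k)
        d≤ i = ℕP.≤-trans (ℕP.m≤m+n d i) (ℕP.≤-reflexive (solveₙ 2 (λ k i → conₙ 1 ⊹ k ⊹ (conₙ 1 ⊹ k) ⊹ i ≔ k ⊹ (conₙ 1 ⊹ i ⊹ (conₙ 1 ⊹ k))) refl k′ i))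
      split : ∀ z → w z * moment i (z ∷ zs) ≼ [ annihilates? zs z ] * nat (N² ℕ.* (Θ ℕ.* Θ ℕ.^ i)) + w z * nat c
      split z with annihilates? zs z
      -- A dependent z brings no new condition, so the remaining moment is estimated trivially; the
      -- scarcity of such z compensates for it.
      ... | yes _ = begin
        w z * moment i (z ∷ zs)
          ≲⟨ *-mono (nat-NonNeg N²) (∑-NonNeg Vs (λ a → NonNeg-* ([]-NonNeg (onSphere? r (z ∷ zs) a)) (NonNeg-* (w-NonNeg a) (^-NonNeg i (Y-NonNeg a)))))
               (w≼N² z) (moment≼Θ i (z ∷ zs)) ⟩
        nat N² * nat (Θ ℕ.* Θ ℕ.^ i)
          ≈⟨ ≈-trans (+-identityʳ _) (≈-trans (*-identityˡ _) (nat-* N² (Θ ℕ.* Θ ℕ.^ i))) ⟨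
        1# * nat (N² ℕ.* (Θ ℕ.* Θ ℕ.^ i)) + 0#
          ≲⟨ +-mono ≼-refl (0≼ (NonNeg-* (w-NonNeg z) (nat-NonNeg c))) ⟩
        1# * nat (N² ℕ.* (Θ ℕ.* Θ ℕ.^ i)) + w z * nat c ∎
      ... | no ¬ann = begin
        w z * moment i (z ∷ zs)
          ≲⟨ *-monoˡ (w-NonNeg z) (moment-bound i (z ∷ zs) (ℕP.*-cancelˡ-≡ _ _ size (≡.trans (#directions-∷ ¬ann) #≡))) ⟩
        w z * nat c
          ≈⟨ ≈-trans (+-congʳ (zeroˡ _)) (+-identityˡ _) ⟨
        0# * nat (N² ℕ.* (Θ ℕ.* Θ ℕ.^ i)) + w z * nat c ∎

    #directions-[] : #directions [] ≡ size ℕ.^ (k ℕ.+ k)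
    #directions-[] = ≡.trans (Counting.∑-length Vs) (length-vectors (k ℕ.+ k))
      where
      length-vectors : ∀ n → length (vectors n) ≡ size ℕ.^ n
      length-vectors zero = refl
      length-vectors (suc n) = ≡.trans (Counting.length-cartesianProductWith _∷_ elements (vectors n)) (≡.cong (size ℕ.*_) (length-vectors n))

    private
      -- The quotient A/B = N⁵/q^(d+2) is the threshold for Y: multiplied by the total weight Θ it
      -- gives N⁶/q², the size wanted for `incidences r`. The number P is the factor that clears
      -- denominators in the power mean inequality.
      A B X P : ℕ
      A = N ℕ.^ 5
      B = size ℕ.^ (2 ℕ.+ d)
      X = A ℕ.^ k′ ℕ.* B
      P = k ℕ.* X

    -- The power mean inequality is applied to B · Y a and A, which avoids the quotient A/B. Its
    -- k-th power is handled by `moment-bound`, its constant term by Parseval.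
    incidences-bound : nat P * incidences r ≼ nat (B ℕ.^ k ℕ.* ((2 ℕ.+ k) ℕ.* (N² ℕ.* q^k′ ℕ.* Θ ℕ.^ k)) ℕ.+ k′ ℕ.* (A ℕ.^ k ℕ.* Θ))
    incidences-bound = begin
      nat P * incidences r
        ≈⟨ *-congʳ (≈-trans (nat-* k X) (≈-trans (*-congˡ (≈-trans (nat-* (A ℕ.^ k′) B) (*-congʳ (nat-^ A k′)))) (≈-sym (*-assoc _ _ _)))) ⟩
      nat k * nat A ^ k′ * nat B * incidences r
        ≈⟨ ∑-*ˡ Vs _ _ ⟨
      ∑[ a ← Vs ] (nat k * nat A ^ k′ * nat B * ([ sphere? r a ] * (w a * Y a)))
        ≈⟨ ∑-cong Vs (λ a → solve 5 (λ p b s w y → p :* b :* (s :* (w :* y)) := s :* (w :* (p :* (b :* y)))) ≈-refl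
             (nat k * nat A ^ k′) (nat B) [ sphere? r a ] (w a) (Y a)) ⟩
      ∑[ a ← Vs ] ([ sphere? r a ] * (w a * (nat k * nat A ^ k′ * (nat B * Y a))))
        ≲⟨ ∑-mono Vs (λ a → *-monoˡ ([]-NonNeg (sphere? r a)) (*-monoˡ (w-NonNeg a)
             (power-mean k′ (NonNeg-* (nat-NonNeg B) (Y-NonNeg a)) (nat-NonNeg A)))) ⟩
      ∑[ a ← Vs ] ([ sphere? r a ] * (w a * ((nat B * Y a) ^ k + nat k′ * nat A ^ k)))
        ≈⟨ ∑-cong Vs (λ a → ≈-trans (*-congˡ (*-congˡ (+-congʳ (^-distrib-* (nat B) (Y a) k))))
             (solve 5 (λ s w b y c → s :* (w :* (b :* y :+ c)) := b :* (s :* (w :* y)) :+ c :* (s :* w)) ≈-refl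
               [ sphere? r a ] (w a) (nat B ^ k) (Y a ^ k) (nat k′ * nat A ^ k))) ⟩
      ∑[ a ← Vs ] (nat B ^ k * ([ sphere? r a ] * (w a * Y a ^ k)) + nat k′ * nat A ^ k * ([ sphere? r a ] * w a))
        ≈⟨ ≈-trans (∑-+ Vs _ _) (+-cong (∑-*ˡ Vs _ _) (∑-*ˡ Vs _ _)) ⟩
      nat B ^ k * (∑[ a ← Vs ] ([ sphere? r a ] * (w a * Y a ^ k))) + nat k′ * nat A ^ k * W r
        ≈⟨ +-congʳ (*-congˡ (∑-cong Vs (λ a → *-congʳ ([]-cong (sphere? r a) (onSphere? r [] a) (λ p → [] , p) proj₂)))) ⟩
      nat B ^ k * moment k [] + nat k′ * nat A ^ k * W r
        ≲⟨ +-mono (*-monoˡ (^-NonNeg k (nat-NonNeg B)) (moment-bound k [] #directions-[]))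
             (*-monoˡ (NonNeg-* (nat-NonNeg k′) (^-NonNeg k (nat-NonNeg A))) (W≼Θ r)) ⟩
      nat B ^ k * nat m + nat k′ * nat A ^ k * nat Θ
        ≈⟨ ≈-trans (nat-+ (B ℕ.^ k ℕ.* m) (k′ ℕ.* (A ℕ.^ k ℕ.* Θ))) (+-cong
             (≈-trans (nat-* (B ℕ.^ k) m) (*-congʳ (nat-^ B k)))
             (≈-trans (nat-* k′ (A ℕ.^ k ℕ.* Θ)) (≈-trans (*-congˡ (≈-trans (nat-* (A ℕ.^ k) Θ) (*-congʳ (nat-^ A k)))) (≈-sym (*-assoc _ _ _))))) ⟨
      nat (B ℕ.^ k ℕ.* m ℕ.+ k′ ℕ.* (A ℕ.^ k ℕ.* Θ)) ∎
      where
      m : ℕ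
      m = (2 ℕ.+ k) ℕ.* (N² ℕ.* q^k′ ℕ.* Θ ℕ.^ k)

    module _ (H : size ℕ.^ (4 ℕ.* (k ℕ.* k) ℕ.+ k′) ℕ.≤ N ℕ.^ (4 ℕ.* k′ ℕ.+ 3)) where

      U²-bound : nat P * (nat (size ℕ.* size) * (U r * U r)) ≼ nat ((1 ℕ.+ k ℕ.+ k) ℕ.* (N ℕ.^ 10 ℕ.* X))
      U²-bound = begin
        nat P * (nat q² * (U r * U r))
          ≲⟨ *-monoˡ (nat-NonNeg P) (*-monoˡ (nat-NonNeg q²) (U²≼ r)) ⟩
        nat P * (nat q² * (nat (N² ℕ.* N²) * incidences r))
          ≈⟨ solve 4 (λ p q n y → p :* (q :* (n :* y)) := q :* (n :* (p :* y))) ≈-refl (nat P) (nat q²) (nat (N² ℕ.* N²)) (incidences r) ⟩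
        nat q² * (nat (N² ℕ.* N²) * (nat P * incidences r))
          ≲⟨ *-monoˡ (nat-NonNeg q²) (*-monoˡ (nat-NonNeg (N² ℕ.* N²)) incidences-bound) ⟩
        nat q² * (nat (N² ℕ.* N²) * nat m)
          ≈⟨ ≈-trans (nat-* q² (N² ℕ.* N² ℕ.* m)) (*-congˡ (nat-* (N² ℕ.* N²) m)) ⟨
        nat (q² ℕ.* (N² ℕ.* N² ℕ.* m))
          ≲⟨ nat-mono (ExponentArithmetic.balance size N k′ H) ⟩
        nat ((1 ℕ.+ k ℕ.+ k) ℕ.* (N ℕ.^ 10 ℕ.* X)) ∎
        where
        q² m : ℕ
        q² = size ℕ.* size
        m = B ℕ.^ k ℕ.* ((2 ℕ.+ k) ℕ.* (N² ℕ.* q^k′ ℕ.* Θ ℕ.^ k)) ℕ.+ k′ ℕ.* (A ℕ.^ k ℕ.* Θ)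

      -- The previous bound amounts to (qU)² ≤ 3N¹⁰. In place of a square root, 2N⁵(qU) ≤ N¹⁰ +
      -- (qU)² turns it into qU ≤ 2N⁵; both sides keep the common factor 2PN⁵.
      U-bound : nat (P ℕ.* (2 ℕ.* (N ℕ.^ 5 ℕ.* size))) * U r ≼ nat (P ℕ.* (4 ℕ.* N ℕ.^ 10))
      U-bound = begin
        nat (P ℕ.* (2 ℕ.* (N ℕ.^ 5 ℕ.* size))) * U r
          ≈⟨ *-congʳ (≈-trans (nat-* P _) (*-congˡ (≈-trans (nat-* 2 (N ℕ.^ 5 ℕ.* size)) (*-congˡ (nat-* (N ℕ.^ 5) size))))) ⟩
        nat P * (nat 2 * (nat (N ℕ.^ 5) * nat size)) * U r
          ≈⟨ solve 4 (λ p n q u → p :* (con (+ 2) :* (n :* q)) :* u := p :* (n :* (q :* u) :+ n :* (q :* u))) ≈-refl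
               (nat P) (nat (N ℕ.^ 5)) (nat size) (U r) ⟩
        nat P * (nat (N ℕ.^ 5) * (nat size * U r) + nat (N ℕ.^ 5) * (nat size * U r))
          ≲⟨ *-monoˡ (nat-NonNeg P) (2xy≼x²+y² (conj-nat (N ℕ.^ 5)) (conj-*′ (conj-nat size) (NonNeg-real (U-NonNeg r)))) ⟩
        nat P * (nat (N ℕ.^ 5) * nat (N ℕ.^ 5) + (nat size * U r) * (nat size * U r))
          ≈⟨ ≈-trans (distribˡ _ _ _) (+-cong
               (≈-trans (*-congˡ (≈-sym (nat-* (N ℕ.^ 5) (N ℕ.^ 5)))) (≈-sym (nat-* P (N ℕ.^ 5 ℕ.* N ℕ.^ 5))))
               (*-congˡ (≈-trans (solve 2 (λ q u → (q :* u) :* (q :* u) := q :* q :* (u :* u)) ≈-refl (nat size) (U r)) (*-congʳ (≈-sym (nat-* size size)))))) ⟩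
        nat (P ℕ.* (N ℕ.^ 5 ℕ.* N ℕ.^ 5)) + nat P * (nat (size ℕ.* size) * (U r * U r))
          ≲⟨ +-mono ≼-refl U²-bound ⟩
        nat (P ℕ.* (N ℕ.^ 5 ℕ.* N ℕ.^ 5)) + nat ((1 ℕ.+ k ℕ.+ k) ℕ.* (N ℕ.^ 10 ℕ.* X))
          ≈⟨ nat-+ (P ℕ.* (N ℕ.^ 5 ℕ.* N ℕ.^ 5)) _ ⟨
        nat (P ℕ.* (N ℕ.^ 5 ℕ.* N ℕ.^ 5) ℕ.+ (1 ℕ.+ k ℕ.+ k) ℕ.* (N ℕ.^ 10 ℕ.* X))
          -- Here 1 + 2k = 3k - k′, so adding k′ X N¹⁰ completes the sum to 4kX N¹⁰.
          ≲⟨ nat-mono (ℕP.≤-trans (ℕP.m≤m+n _ (k′ ℕ.* (X ℕ.* N ℕ.^ 10))) (ℕP.≤-reflexive numbers)) ⟩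
        nat (P ℕ.* (4 ℕ.* N ℕ.^ 10)) ∎
        where
        numbers : P ℕ.* (N ℕ.^ 5 ℕ.* N ℕ.^ 5) ℕ.+ (1 ℕ.+ k ℕ.+ k) ℕ.* (N ℕ.^ 10 ℕ.* X) ℕ.+ k′ ℕ.* (X ℕ.* N ℕ.^ 10) ≡ P ℕ.* (4 ℕ.* N ℕ.^ 10)
        numbers = ≡.trans
          (≡.cong (λ t → P ℕ.* t ℕ.+ (1 ℕ.+ k ℕ.+ k) ℕ.* (N ℕ.^ 10 ℕ.* X) ℕ.+ k′ ℕ.* (X ℕ.* N ℕ.^ 10)) (≡.sym (ℕP.^-distribˡ-+-* N 5 5)))
          (solveₙ 3 (λ k x n → (conₙ 1 ⊹ k) ⊠ x ⊠ n ⊹ (conₙ 1 ⊹ (conₙ 1 ⊹ k) ⊹ (conₙ 1 ⊹ k)) ⊠ (n ⊠ x) ⊹ k ⊠ (x ⊠ n)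
             ≔ (conₙ 1 ⊹ k) ⊠ x ⊠ (conₙ 4 ⊠ n)) refl k′ X (N ℕ.^ 10))

  nonzero? : ∀ (r : F) → Dec (r ≢ 0ᶠ)
  nonzero? r = ¬? (r ≟ 0ᶠ)

  cubes-energy : Carrier
  cubes-energy = ∑[ r ← elements ] ([ nonzero? r ] * norm (cubes r))

  -- The factor c gathers everything by which `U-bound` had to be multiplied. It is hidden by the
  -- existential, since positivity is enough to cancel it later in ℕ.
  cubes-energy-bound : 1 ℕ.≤ N → size ℕ.^ (4 ℕ.* (k ℕ.* k) ℕ.+ k′) ℕ.≤ N ℕ.^ (4 ℕ.* k′ ℕ.+ 3) →
    ∃[ c ] (1 ℕ.≤ c × nat c * (nat (size ℕ.* size) * cubes-energy) ≼ nat (c ℕ.* (2 ℕ.* (size ℕ.^ suc d ℕ.* N ℕ.^ 6))))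
  cubes-energy-bound 1≤N H = c , 1≤c , bound
    where
    X P c : ℕ
    X = (N ℕ.^ 5) ℕ.^ k′ ℕ.* size ℕ.^ (2 ℕ.+ d)
    P = k ℕ.* X
    c = P ℕ.* (2 ℕ.* (N ℕ.^ 5 ℕ.* size))
    *≥1 : ∀ {m n} → 1 ℕ.≤ m → 1 ℕ.≤ n → 1 ℕ.≤ m ℕ.* n
    *≥1 p q = ℕP.*-mono-≤ p q
    ^≥1 : ∀ {m} n → 1 ℕ.≤ m → 1 ℕ.≤ m ℕ.^ n
    ^≥1 zero p = ℕP.≤-refl
    ^≥1 (suc n) p = *≥1 p (^≥1 n p)
    1≤size : 1 ℕ.≤ size
    1≤size = ℕP.≤-trans (ℕ.s≤s ℕ.z≤n) (size≥2 K)
    1≤c : 1 ℕ.≤ c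
    1≤c = *≥1 (*≥1 {k} (ℕ.s≤s ℕ.z≤n) (*≥1 (^≥1 k′ (^≥1 5 1≤N)) (^≥1 (2 ℕ.+ d) 1≤size))) (*≥1 {2} (ℕ.s≤s ℕ.z≤n) (*≥1 (^≥1 5 1≤N) 1≤size))
    single : ∀ r → nat c * ([ nonzero? r ] * norm (cubes r)) ≼ W r * nat (P ℕ.* (4 ℕ.* N ℕ.^ 10))
    single r with r ≟ 0ᶠ
    ... | yes _ = ≼-trans (≼-reflexive (≈-trans (*-congˡ (zeroˡ _)) (zeroʳ _))) (0≼ (NonNeg-* (W-NonNeg r) (nat-NonNeg (P ℕ.* (4 ℕ.* N ℕ.^ 10)))))
    ... | no r≢0 = begin
      nat c * (1# * norm (cubes r))
        ≲⟨ *-monoˡ (nat-NonNeg c) (≼-trans (≼-reflexive (*-identityˡ _)) (cubes≼WU r)) ⟩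
      nat c * (W r * U r)
        ≈⟨ solve 3 (λ c w u → c :* (w :* u) := w :* (c :* u)) ≈-refl (nat c) (W r) (U r) ⟩
      W r * (nat c * U r)
        ≲⟨ *-monoˡ (W-NonNeg r) (U-bound r≢0 H) ⟩
      W r * nat (P ℕ.* (4 ℕ.* N ℕ.^ 10)) ∎
    bound : nat c * (nat (size ℕ.* size) * cubes-energy) ≼ nat (c ℕ.* (2 ℕ.* (size ℕ.^ suc d ℕ.* N ℕ.^ 6)))
    bound = begin
      nat c * (nat (size ℕ.* size) * cubes-energy)
        ≈⟨ solve 3 (λ c q t → c :* (q :* t) := q :* (c :* t)) ≈-refl (nat c) (nat (size ℕ.* size)) cubes-energy ⟩
      nat (size ℕ.* size) * (nat c * cubes-energy)
        ≈⟨ *-congˡ (∑-*ˡ elements (nat c) _) ⟨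
      nat (size ℕ.* size) * (∑[ r ← elements ] (nat c * ([ nonzero? r ] * norm (cubes r))))
        ≲⟨ *-monoˡ (nat-NonNeg (size ℕ.* size)) (∑-mono elements single) ⟩
      nat (size ℕ.* size) * (∑[ r ← elements ] (W r * nat (P ℕ.* (4 ℕ.* N ℕ.^ 10))))
        ≈⟨ *-congˡ (≈-trans (∑-*ʳ elements _ W) (*-congʳ W-total)) ⟩
      nat (size ℕ.* size) * (nat Θ * nat (P ℕ.* (4 ℕ.* N ℕ.^ 10)))
        ≈⟨ ≈-trans (nat-* (size ℕ.* size) (Θ ℕ.* (P ℕ.* (4 ℕ.* N ℕ.^ 10)))) (*-congˡ (nat-* Θ (P ℕ.* (4 ℕ.* N ℕ.^ 10)))) ⟨
      nat (size ℕ.* size ℕ.* (Θ ℕ.* (P ℕ.* (4 ℕ.* N ℕ.^ 10))))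
        ≈⟨ reflexive (≡.cong nat numbers) ⟩
      nat (c ℕ.* (2 ℕ.* (size ℕ.^ suc d ℕ.* N ℕ.^ 6))) ∎
      where
      numbers : size ℕ.* size ℕ.* (Θ ℕ.* (P ℕ.* (4 ℕ.* N ℕ.^ 10))) ≡ c ℕ.* (2 ℕ.* (size ℕ.^ suc d ℕ.* N ℕ.^ 6))
      numbers = ≡.trans (≡.cong (λ t → size ℕ.* size ℕ.* (Θ ℕ.* (P ℕ.* (4 ℕ.* t)))) (ℕP.^-distribˡ-+-* N 5 5))
        (solveₙ 5 (λ q p x n y → q ⊠ q ⊠ (p ⊠ n ⊠ (x ⊠ (conₙ 4 ⊠ (y ⊠ y)))) ≔ x ⊠ (conₙ 2 ⊠ (y ⊠ q)) ⊠ (conₙ 2 ⊠ (q ⊠ p ⊠ (n ⊠ y)))) refl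
          size (size ℕ.^ d) P N (N ℕ.^ 5))

-- Gauss sums and completing the square

module GaussSums (K : FiniteField) (M : CharacterRing K) (char≢2 : FiniteField.CharNot2 K) where
  open FiniteField K using (F; elements; size; complete; _≟_; _⊕_; ‖_‖) renaming (0# to 0ᶠ; 1# to 1ᶠ)
  open VectorSpace K
  open 𝔽 using () renaming (_+_ to _+ᶠ_; -_ to -ᶠ_; _-_ to _-ᶠ_; _*_ to _*ᶠ_)
  open Order K M
  open Characters K M
  open Quadratics K
  open NatCount K M
  open CommutativeExp commutativeSemiring using (^-distrib-*)
  module ℕΣ = Counting

  s+s≢0 : ∀ {s} → s ≢ 0ᶠ → s +ᶠ s ≢ 0ᶠ
  s+s≢0 {s} s≢0 p = *-≢0 char≢2 s≢0
    (≡.trans (FS.solve 1 (λ s → (FS.con (+ 1) FS.:+ FS.con (+ 1)) FS.:* s FS.:= s FS.:+ s) refl s) p)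

  γ : F → Carrier
  γ s = ∑[ u ← elements ] χ (s *ᶠ (u *ᶠ u))

  Γ : ∀ n → F → Carrier
  Γ n s = ∑[ v ← vectors n ] χ (s *ᶠ ‖ v ‖)

  -- Pigeonhole for sums: a deficit in one term could not be made up by the others, which are at
  -- most c.
  saturated : ∀ {A : Set} (xs : List A) (f : A → ℕ) c → (∀ x → f x ℕ.≤ c) →
              length xs ℕ.* c ℕ.≤ ℕΣ.∑ xs f → ∀ {x} → x ∈ xs → f x ≡ c
  saturated (x ∷ xs) f c f≤c total (here refl) = ℕP.≤-antisym (f≤c x)
    (ℕP.+-cancelʳ-≤ (length xs ℕ.* c) c (f x) (ℕP.≤-trans total (ℕP.+-monoʳ-≤ (f x)
      (ℕP.≤-trans (ℕΣ.∑-mono xs f≤c) (ℕP.≤-reflexive (ℕΣ.∑-const xs c))))))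
  saturated (x ∷ xs) f c f≤c total (there y∈) = saturated xs f c f≤c
    (ℕP.+-cancelˡ-≤ c _ _ (ℕP.≤-trans total (ℕP.+-monoˡ-≤ _ (f≤c x)))) y∈

  square? : ∀ s → Dec (∃[ v ] (v *ᶠ v ≡ s))
  square? s with any? (λ v → (v *ᶠ v) ≟ s) elements
  ... | yes p with find p
  ...   | v , _ , vv≡s = yes (v , vv≡s)
  square? s | no ¬p = no (λ { (v , vv≡s) → ¬p (lose (complete v) vv≡s) })
    where open import Data.List.Membership.Propositional using (lose)

  γ-square : ∀ v → v ≢ 0ᶠ → γ (v *ᶠ v) ≈ γ 1ᶠ
  γ-square v v≢0 = ≈-trans
    (∑-cong elements (λ u → χ-cong (FS.solve 2 (λ u v → v FS.:* v FS.:* (u FS.:* u) FS.:= FS.con (+ 1) FS.:* ((v FS.:* u) FS.:* (v FS.:* u))) refl u v)))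
    (∑F-reindex (v *ᶠ_) (inv v *ᶠ_) (λ u → undo v (inv v) u (*-inv v≢0)) (λ u → undo (inv v) v u (≡.trans (𝔽.*-comm _ _) (*-inv v≢0)))
      (λ u → χ (1ᶠ *ᶠ (u *ᶠ u))))
    where
    undo : ∀ a b u → a *ᶠ b ≡ 1ᶠ → a *ᶠ (b *ᶠ u) ≡ u
    undo a b u ab≡1 = ≡.trans (≡.sym (𝔽.*-assoc a b u)) (≡.trans (≡.cong (_*ᶠ u) ab≡1) (𝔽.*-identityˡ u))

  -- For s not a square, every t is represented exactly twice by u² and su² together:
  -- at most twice, since t and st cannot both be nonzero squares, and 2q times in total.
  module _ {s : F} (s≢0 : s ≢ 0ᶠ) (nonsquare : ¬ (∃[ v ] (v *ᶠ v ≡ s))) where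
    private
      ones ss : F → ℕ
      ones t = ℕΣ.∑ elements (λ u → ℕΣ.[ (1ᶠ *ᶠ (u *ᶠ u)) ≟ t ])
      ss t = ℕΣ.∑ elements (λ u → ℕΣ.[ (s *ᶠ (u *ᶠ u)) ≟ t ])

      roots≤2 : ∀ a t → a ≢ 0ᶠ → ℕΣ.∑ elements (λ u → ℕΣ.[ (a *ᶠ (u *ᶠ u)) ≟ t ]) ℕ.≤ 2
      roots≤2 a t a≢0 = ℕP.≤-trans
        (ℕP.≤-reflexive (ℕΣ.∑-cong elements (λ u → ℕΣ.[]-cong ((a *ᶠ (u *ᶠ u)) ≟ t) (((-ᶠ t) +ᶠ u *ᶠ (0ᶠ +ᶠ u *ᶠ a)) ≟ 0ᶠ)
          (λ e → ≡.trans (expand u) (≡.trans (≡.cong (_-ᶠ t) e) (𝔽.-‿inverseʳ t)))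
          (λ e → -≡0 (≡.trans (≡.sym (expand u)) e)))))
        (quadratic-roots a 0ᶠ (-ᶠ t) (inj₁ a≢0))
        where
        expand : ∀ u → (-ᶠ t) +ᶠ u *ᶠ (0ᶠ +ᶠ u *ᶠ a) ≡ a *ᶠ (u *ᶠ u) -ᶠ t
        expand u = FS.solve 3 (λ a t u → (FS.:- t) FS.:+ u FS.:* (FS.con (+ 0) FS.:+ u FS.:* a) FS.:= a FS.:* (u FS.:* u) FS.:- t) refl a t u

      none : ∀ a t → (∀ u → a *ᶠ (u *ᶠ u) ≢ t) → ℕΣ.∑ elements (λ u → ℕΣ.[ (a *ᶠ (u *ᶠ u)) ≟ t ]) ≡ 0
      none a t h = ≡.trans (ℕΣ.∑-cong elements (λ u → ℕΣ.[]-no ((a *ᶠ (u *ᶠ u)) ≟ t) (h u))) (ℕΣ.∑-0 elements)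

      only-0 : ∀ a → a ≢ 0ᶠ → ℕΣ.∑ elements (λ u → ℕΣ.[ (a *ᶠ (u *ᶠ u)) ≟ 0ᶠ ]) ≡ 1
      only-0 a a≢0 = ≡.trans (ℕΣ.∑-cong elements (λ u → ℕΣ.[]-cong ((a *ᶠ (u *ᶠ u)) ≟ 0ᶠ) (u ≟ 0ᶠ) (to u)
          (λ e → ≡.trans (≡.cong (λ u → a *ᶠ (u *ᶠ u)) e) (FS.solve 1 (λ a → a FS.:* (FS.con (+ 0) FS.:* FS.con (+ 0)) FS.:= FS.con (+ 0)) refl a))))
        (EnumSummation.count-≡ ℕP.+-*-commutativeSemiring (fieldEnumeration K) 0ᶠ)
        where
        to : ∀ u → a *ᶠ (u *ᶠ u) ≡ 0ᶠ → u ≡ 0ᶠ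
        to u e with u ≟ 0ᶠ
        ... | yes u≡0 = u≡0
        ... | no u≢0 = *≡0⇒≡0 u≢0 (*≡0⇒≡0 a≢0 e)

      1≢0 : 1ᶠ ≢ 0ᶠ
      1≢0 e = FiniteField.0≢1 K (≡.sym e)

      both≤2 : ∀ t → ss t ℕ.+ ones t ℕ.≤ 2
      both≤2 t with t ≟ 0ᶠ
      ... | yes refl = ℕP.≤-reflexive (≡.cong₂ ℕ._+_ (only-0 s s≢0) (only-0 1ᶠ 1≢0))
      ... | no t≢0 with square? t
      ...   | no ¬sq = ℕP.≤-trans (ℕP.≤-reflexive (≡.trans
                (≡.cong (ss t ℕ.+_) (none 1ᶠ t (λ u e → ¬sq (u , ≡.trans (≡.sym (𝔽.*-identityˡ _)) e)))) (ℕP.+-identityʳ (ss t)))) (roots≤2 s t s≢0)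
      ...   | yes (v , vv≡t) = ℕP.≤-trans (ℕP.≤-reflexive (≡.cong (ℕ._+ ones t) (none s t contradiction))) (roots≤2 1ᶠ t 1≢0)
        where
        contradiction : ∀ u → s *ᶠ (u *ᶠ u) ≢ t
        contradiction u suu≡t = nonsquare (v *ᶠ inv u , square-quotient u≢0 suu≡t vv≡t)
          where
          u≢0 : u ≢ 0ᶠ
          u≢0 refl = t≢0 (≡.trans (≡.sym suu≡t) (FS.solve 1 (λ s → s FS.:* (FS.con (+ 0) FS.:* FS.con (+ 0)) FS.:= FS.con (+ 0)) refl s))

      total : ∀ a → ℕΣ.∑ elements (λ t → ℕΣ.∑ elements (λ u → ℕΣ.[ (a *ᶠ (u *ᶠ u)) ≟ t ])) ≡ size
      total a = ≡.trans (ℕΣ.∑-swap elements elements _) (≡.trans (ℕΣ.∑-cong elements (λ u → ≡.trans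
        (ℕΣ.∑-cong elements (λ t → ℕΣ.[]-cong ((a *ᶠ (u *ᶠ u)) ≟ t) (t ≟ (a *ᶠ (u *ᶠ u))) ≡.sym ≡.sym))
        (EnumSummation.count-≡ ℕP.+-*-commutativeSemiring (fieldEnumeration K) (a *ᶠ (u *ᶠ u))))) (ℕΣ.∑-length elements))

      both≡2 : ∀ t → ss t ℕ.+ ones t ≡ 2
      both≡2 t = saturated elements (λ t → ss t ℕ.+ ones t) 2 both≤2
        (ℕP.≤-reflexive (≡.trans (≡.trans (ℕP.*-comm size 2) (≡.cong (size ℕ.+_) (ℕP.+-identityʳ size)))
          (≡.sym (≡.trans (ℕΣ.∑-+ elements ss ones) (≡.cong₂ ℕ._+_ (total s) (total 1ᶠ)))))) (complete t)

      γ-count : ∀ a → γ a ≈ ∑[ t ← elements ] (nat (ℕΣ.∑ elements (λ u → ℕΣ.[ (a *ᶠ (u *ᶠ u)) ≟ t ])) * χ t)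
      γ-count a = ≈-sym (begin-equality
        ∑[ t ← elements ] (nat (ℕΣ.∑ elements (λ u → ℕΣ.[ (a *ᶠ (u *ᶠ u)) ≟ t ])) * χ t)
          ≈⟨ ∑-cong elements (λ t → ≈-trans (*-congʳ (nat-count (λ u → (a *ᶠ (u *ᶠ u)) ≟ t) elements)) (≈-sym (∑-*ʳ elements (χ t) _))) ⟩
        ∑[ t ← elements ] (∑[ u ← elements ] ([ (a *ᶠ (u *ᶠ u)) ≟ t ] * χ t))
          ≈⟨ ∑-swap elements elements _ ⟩
        ∑[ u ← elements ] (∑[ t ← elements ] ([ (a *ᶠ (u *ᶠ u)) ≟ t ] * χ t))
          ≈⟨ ∑-cong elements (λ u → ≈-trans (∑-cong elements (λ t → *-congʳ ([]-cong ((a *ᶠ (u *ᶠ u)) ≟ t) (t ≟ (a *ᶠ (u *ᶠ u))) ≡.sym ≡.sym)))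
               (∑F-pick χ (a *ᶠ (u *ᶠ u)))) ⟩
        γ a ∎)

    γ-nonsquare : γ s + γ 1ᶠ ≈ 0#
    γ-nonsquare = begin-equality
      γ s + γ 1ᶠ
        ≈⟨ +-cong (γ-count s) (γ-count 1ᶠ) ⟩
      (∑[ t ← elements ] (nat (ss t) * χ t)) + (∑[ t ← elements ] (nat (ones t) * χ t))
        ≈⟨ ∑-+ elements _ _ ⟨
      ∑[ t ← elements ] (nat (ss t) * χ t + nat (ones t) * χ t)
        ≈⟨ ∑-cong elements (λ t → ≈-trans (≈-sym (distribʳ (χ t) _ _)) (*-congʳ (≈-trans (≈-sym (nat-+ (ss t) (ones t))) (reflexive (≡.cong nat (both≡2 t)))))) ⟩
      ∑[ t ← elements ] (nat 2 * χ t)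
        ≈⟨ ≈-trans (∑-*ˡ elements (nat 2) χ) (≈-trans (*-congˡ ∑-χ) (zeroʳ _)) ⟩
      0# ∎

  -- In fact γ s = ± γ 1, the sign being the quadratic character of s; squaring removes the sign, so
  -- the character itself is never introduced. In even dimension only this square occurs.
  γ² : ∀ s → s ≢ 0ᶠ → γ s * γ s ≈ γ 1ᶠ * γ 1ᶠ
  γ² s s≢0 with square? s
  ... | yes (v , refl) = *-cong (γ-square v v≢0) (γ-square v v≢0)
    where
    v≢0 : v ≢ 0ᶠ
    v≢0 refl = s≢0 (𝔽.zeroˡ 0ᶠ)
  ... | no ¬sq = begin-equality
    γ s * γ s
      ≈⟨ solve 2 (λ x y → x :* x := (x :+ y) :* (x :- y) :+ y :* y) ≈-refl (γ s) (γ 1ᶠ) ⟩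
    (γ s + γ 1ᶠ) * (γ s - γ 1ᶠ) + γ 1ᶠ * γ 1ᶠ
      ≈⟨ +-congʳ (≈-trans (*-congʳ (γ-nonsquare s≢0 ¬sq)) (zeroˡ _)) ⟩
    0# + γ 1ᶠ * γ 1ᶠ
      ≈⟨ +-identityˡ _ ⟩
    γ 1ᶠ * γ 1ᶠ ∎

  Γ≈γ^ : ∀ n s → Γ n s ≈ γ s ^ n
  Γ≈γ^ zero s = ≈-trans (+-identityʳ _) (≈-trans (χ-cong (𝔽.zeroʳ s)) χ-0)
  Γ≈γ^ (suc n) s = begin-equality
    Γ (suc n) s
      ≈⟨ ∑-cartesianProductWith _∷_ elements (vectors n) _ ⟩
    ∑[ u ← elements ] (∑[ v ← vectors n ] χ (s *ᶠ (u *ᶠ u +ᶠ ‖ v ‖)))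
      ≈⟨ ∑-cong elements (λ u → ∑-cong (vectors n) (λ v → ≈-trans (χ-cong (𝔽.distribˡ s _ _)) (χ-+ _ _))) ⟩
    ∑[ u ← elements ] (∑[ v ← vectors n ] (χ (s *ᶠ (u *ᶠ u)) * χ (s *ᶠ ‖ v ‖)))
      ≈⟨ ∑-*-∑ elements (vectors n) _ _ ⟨
    γ s * Γ n s
      ≈⟨ *-congˡ (Γ≈γ^ n s) ⟩
    γ s ^ suc n ∎

  Γ-even : ∀ k s → s ≢ 0ᶠ → Γ (k ℕ.+ k) s ≈ Γ (k ℕ.+ k) 1ᶠ
  Γ-even k s s≢0 = ≈-trans (square s) (≈-trans (^-congˡ k (γ² s s≢0)) (≈-sym (square 1ᶠ)))
    where
    square : ∀ s → Γ (k ℕ.+ k) s ≈ (γ s * γ s) ^ k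
    square s = ≈-trans (Γ≈γ^ (k ℕ.+ k) s) (≈-trans (^-homo-* (γ s) k k) (≈-sym (^-distrib-* (γ s) (γ s) k)))

  -- With u = h + v the difference of the two phases is linear in v with coefficient vector 2s h.
  -- The sum over v vanishes unless this vector is 0, that is, unless h = 0.
  norm-Γ : ∀ n s → s ≢ 0ᶠ → norm (Γ n s) ≈ nat (size ℕ.^ n)
  norm-Γ n s s≢0 = begin-equality
    norm (Γ n s)
      ≈⟨ ≈-trans (*-congˡ (conj-∑ Vn _)) (≈-trans (∑-*-∑ Vn Vn _ _) (∑-swap Vn Vn _)) ⟩
    ∑[ v ← Vn ] (∑[ u ← Vn ] (χ (s *ᶠ ‖ u ‖) * conj (χ (s *ᶠ ‖ v ‖))))
      ≈⟨ ∑-cong Vn (λ v → ≈-sym (∑V-translate v _)) ⟩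
    ∑[ v ← Vn ] (∑[ h ← Vn ] (χ (s *ᶠ ‖ h ⊕ v ‖) * conj (χ (s *ᶠ ‖ v ‖))))
      ≈⟨ ∑-cong Vn (λ v → ∑-cong Vn (λ h → expand h v)) ⟩
    ∑[ v ← Vn ] (∑[ h ← Vn ] (χ (s *ᶠ ‖ h ‖) * (χ (dot v ((s +ᶠ s) ∙ h)) * conj (χ (dot v 𝟎)))))
      ≈⟨ ≈-trans (∑-swap Vn Vn _) (∑-cong Vn (λ h → ∑-*ˡ Vn _ _)) ⟩
    ∑[ h ← Vn ] (χ (s *ᶠ ‖ h ‖) * (∑[ v ← Vn ] (χ (dot v ((s +ᶠ s) ∙ h)) * conj (χ (dot v 𝟎)))))
      ≈⟨ ∑-cong Vn (λ h → ≈-trans (*-congˡ (≈-trans (orthogonalᵛ ((s +ᶠ s) ∙ h) 𝟎) (*-congʳ (indicator h))))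
           (solve 3 (λ x i q → x :* (i :* q) := i :* (x :* q)) ≈-refl _ _ _)) ⟩
    ∑[ h ← Vn ] ([ h ≟ᵛ 𝟎 ] * (χ (s *ᶠ ‖ h ‖) * nat (size ℕ.^ n)))
      ≈⟨ EnumSummation.pick commutativeSemiring (vectorEnumeration n) (λ h → χ (s *ᶠ ‖ h ‖) * nat (size ℕ.^ n)) 𝟎 ⟩
    χ (s *ᶠ ‖ 𝟎 {n} ‖) * nat (size ℕ.^ n)
      ≈⟨ *-congʳ (≈-trans (χ-cong (≡.trans (≡.cong (s *ᶠ_) (‖𝟎‖ {n})) (𝔽.zeroʳ s))) χ-0) ⟩
    1# * nat (size ℕ.^ n)
      ≈⟨ *-identityˡ _ ⟩
    nat (size ℕ.^ n) ∎
    where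
    Vn : List (Vec F n)
    Vn = vectors n
    indicator : ∀ (h : Vec F n) → [ 𝟎 ≟ᵛ ((s +ᶠ s) ∙ h) ] ≈ [ h ≟ᵛ 𝟎 ]
    indicator h = []-cong (𝟎 ≟ᵛ ((s +ᶠ s) ∙ h)) (h ≟ᵛ 𝟎)
      (λ e → ∙-≡𝟎 (s+s≢0 s≢0) h (≡.sym e)) (λ e → ≡.sym (≡.trans (≡.cong ((s +ᶠ s) ∙_) e) (∙-𝟎 (s +ᶠ s))))
    expand : ∀ (h v : Vec F n) → χ (s *ᶠ ‖ h ⊕ v ‖) * conj (χ (s *ᶠ ‖ v ‖)) ≈ χ (s *ᶠ ‖ h ‖) * (χ (dot v ((s +ᶠ s) ∙ h)) * conj (χ (dot v 𝟎)))
    expand h v = begin-equality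
      χ (s *ᶠ ‖ h ⊕ v ‖) * conj (χ (s *ᶠ ‖ v ‖))
        ≈⟨ χ-conj _ _ ⟩
      χ (s *ᶠ ‖ h ⊕ v ‖ -ᶠ s *ᶠ ‖ v ‖)
        ≈⟨ χ-cong (≡.trans (≡.cong (λ x → s *ᶠ x -ᶠ s *ᶠ ‖ v ‖) (‖⊕‖ h v))
             (≡.trans (FS.solve 4 (λ s h v t → s FS.:* (h FS.:+ v FS.:+ (t FS.:+ t)) FS.:- s FS.:* v FS.:= s FS.:* h FS.:+ ((s FS.:+ s) FS.:* t FS.:- FS.con (+ 0)))
               refl s (‖ h ‖) (‖ v ‖) (dot h v))
             (≡.cong₂ (λ x y → s *ᶠ ‖ h ‖ +ᶠ (x -ᶠ y)) (≡.sym (≡.trans (dot-∙ʳ (s +ᶠ s) h v) (≡.cong ((s +ᶠ s) *ᶠ_) (dot-comm v h)))) (≡.sym (dot-𝟎 v))))) ⟩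
      χ (s *ᶠ ‖ h ‖ +ᶠ (dot v ((s +ᶠ s) ∙ h) -ᶠ dot v 𝟎))
        ≈⟨ ≈-trans (χ-+ _ _) (*-congˡ (≈-sym (χ-conj _ _))) ⟩
      χ (s *ᶠ ‖ h ‖) * (χ (dot v ((s +ᶠ s) ∙ h)) * conj (χ (dot v 𝟎))) ∎

  -- σ s = -1/(4s), and σ 0 = 0.
  shift σ : F → F
  shift s = -ᶠ inv (s +ᶠ s)
  σ s = shift s +ᶠ s *ᶠ (shift s *ᶠ shift s)

  s+s*shift : ∀ {s} → s ≢ 0ᶠ → (s +ᶠ s) *ᶠ shift s ≡ -ᶠ 1ᶠ
  s+s*shift {s} s≢0 = ≡.trans (FS.solve 2 (λ s i → s FS.:* (FS.:- i) FS.:= FS.:- (s FS.:* i)) refl (s +ᶠ s) (inv (s +ᶠ s)))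
    (≡.cong -ᶠ_ (*-inv (s+s≢0 s≢0)))

  4s*σ : ∀ {s} → s ≢ 0ᶠ → (s +ᶠ s +ᶠ (s +ᶠ s)) *ᶠ σ s ≡ -ᶠ 1ᶠ
  4s*σ {s} s≢0 = ≡.trans
    (FS.solve 2 (λ s c → (s FS.:+ s FS.:+ (s FS.:+ s)) FS.:* (c FS.:+ s FS.:* (c FS.:* c))
      FS.:= (s FS.:+ s) FS.:* c FS.:+ (s FS.:+ s) FS.:* c FS.:+ ((s FS.:+ s) FS.:* c) FS.:* ((s FS.:+ s) FS.:* c)) refl s (shift s))
    (≡.trans (≡.cong (λ x → x +ᶠ x +ᶠ x *ᶠ x) (s+s*shift s≢0))
      (FS.solve 1 (λ o → (FS.:- FS.con (+ 1)) FS.:+ (FS.:- FS.con (+ 1)) FS.:+ (FS.:- FS.con (+ 1)) FS.:* (FS.:- FS.con (+ 1)) FS.:= FS.:- FS.con (+ 1)) refl 0ᶠ))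

  σ-0 : σ 0ᶠ ≡ 0ᶠ
  σ-0 = ≡.trans (≡.cong (λ c → c +ᶠ 0ᶠ *ᶠ (c *ᶠ c)) shift-0)
    (FS.solve 0 (FS.con (+ 0) FS.:+ FS.con (+ 0) FS.:* (FS.con (+ 0) FS.:* FS.con (+ 0)) FS.:= FS.con (+ 0)) refl)
    where
    shift-0 : shift 0ᶠ ≡ 0ᶠ
    shift-0 = ≡.trans (≡.cong (λ x → -ᶠ inv x) (𝔽.+-identityˡ 0ᶠ)) (≡.trans (≡.cong -ᶠ_ inv-0) (FS.solve 0 (FS.:- FS.con (+ 0) FS.:= FS.con (+ 0)) refl))

  σ≢0 : ∀ {s} → s ≢ 0ᶠ → σ s ≢ 0ᶠ
  σ≢0 {s} s≢0 p = FiniteField.0≢1 K (≡.trans (FS.solve 1 (λ s → FS.con (+ 0) FS.:= FS.:- (s FS.:* FS.con (+ 0))) refl (s +ᶠ s +ᶠ (s +ᶠ s)))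
    (≡.trans (≡.cong (λ x → -ᶠ ((s +ᶠ s +ᶠ (s +ᶠ s)) *ᶠ x)) (≡.sym p))
    (≡.trans (≡.cong -ᶠ_ (4s*σ s≢0)) (FS.solve 0 (FS.:- (FS.:- FS.con (+ 1)) FS.:= FS.con (+ 1)) refl))))

  -- Because `inv` sends 0 to 0, the map s ↦ -1/(4s) extends to an involution of the whole field
  -- that fixes 0. A sum over all frequencies can then be reindexed without disturbing the main term
  -- at s = 0.
  σσ : ∀ s → σ (σ s) ≡ s
  σσ s with s ≟ 0ᶠ
  ... | yes refl = ≡.trans (≡.cong σ σ-0) σ-0
  ... | no s≢0 = *-cancelˡ (s+s≢0 (s+s≢0 (σ≢0 s≢0))) (≡.trans (4s*σ (σ≢0 s≢0)) (≡.trans (≡.sym (4s*σ s≢0))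
    (FS.solve 2 (λ s t → (s FS.:+ s FS.:+ (s FS.:+ s)) FS.:* t FS.:= (t FS.:+ t FS.:+ (t FS.:+ t)) FS.:* s) refl s (σ s))))

  -- The translation m = v + c x with c = -1/(2s) removes the term linear in v and leaves the
  -- constant phase σ s ‖x‖.
  complete-square : ∀ {n} s → s ≢ 0ᶠ → (x : Vec F n) →
    ∑[ m ← vectors n ] χ (dot m x +ᶠ s *ᶠ ‖ m ‖) ≈ Γ n s * χ (σ s *ᶠ ‖ x ‖)
  complete-square {n} s s≢0 x = begin-equality
    ∑[ m ← vectors n ] χ (dot m x +ᶠ s *ᶠ ‖ m ‖)
      ≈⟨ ∑V-translate (c ∙ x) _ ⟨
    ∑[ v ← vectors n ] χ (dot (v ⊕ (c ∙ x)) x +ᶠ s *ᶠ ‖ v ⊕ (c ∙ x) ‖)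
      ≈⟨ ∑-cong (vectors n) (λ v → ≈-trans (χ-cong (expand v)) (χ-+ _ _)) ⟩
    ∑[ v ← vectors n ] (χ (s *ᶠ ‖ v ‖) * χ (σ s *ᶠ ‖ x ‖))
      ≈⟨ ∑-*ʳ (vectors n) _ _ ⟩
    Γ n s * χ (σ s *ᶠ ‖ x ‖) ∎
    where
    c : F
    c = shift s
    expand : ∀ v → dot (v ⊕ (c ∙ x)) x +ᶠ s *ᶠ ‖ v ⊕ (c ∙ x) ‖ ≡ s *ᶠ ‖ v ‖ +ᶠ σ s *ᶠ ‖ x ‖
    expand v = ≡.trans
      (≡.cong₂ (λ a b → a +ᶠ s *ᶠ b)
        (≡.trans (dot-⊕ˡ v (c ∙ x) x) (≡.cong (dot v x +ᶠ_) (≡.trans (dot-∙ˡ c x x) (≡.cong (c *ᶠ_) (dot-self x)))))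
        (≡.trans (‖⊕‖ v (c ∙ x)) (≡.cong₂ (λ a b → ‖ v ‖ +ᶠ a +ᶠ (b +ᶠ b)) (‖∙‖ c x) (dot-∙ʳ c x v))))
      (≡.trans (FS.solve 5 (λ s c t v x → (t FS.:+ c FS.:* x) FS.:+ s FS.:* (v FS.:+ c FS.:* c FS.:* x FS.:+ (c FS.:* t FS.:+ c FS.:* t))
          FS.:= (FS.con (+ 1) FS.:+ (s FS.:+ s) FS.:* c) FS.:* t FS.:+ (s FS.:* v FS.:+ (c FS.:+ s FS.:* (c FS.:* c)) FS.:* x)) refl s c (dot v x) (‖ v ‖) (‖ x ‖))
      (≡.trans (≡.cong (λ z → (1ᶠ +ᶠ z) *ᶠ dot v x +ᶠ (s *ᶠ ‖ v ‖ +ᶠ σ s *ᶠ ‖ x ‖)) (s+s*shift s≢0))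
        (FS.solve 2 (λ t y → (FS.con (+ 1) FS.:- FS.con (+ 1)) FS.:* t FS.:+ y FS.:= y) refl (dot v x) _)))

-- Numerical inequalities for the second moment

module MomentArithmetic where
  open import Data.Nat using (_+_; _*_; _^_; _≤_)
  open +-*-Solver using (solve; _:=_; _:+_; _:*_; con)

  -- Here p stands for q^d. After division by c p q, the main term, the sphere r = 0 and the other
  -- spheres contribute 1, 1 and 2 times n⁶; the assumption p ≤ n² enters for the sphere r = 0. The
  -- factor 3 from squaring a sum of three terms makes this 12.
  second-moment : ∀ c p q n S → 1 ≤ c → 1 ≤ p → 1 ≤ q → p ≤ n * n →
    c * (p * (q * q) * S) ≤ 3 * (c * (q * (p * (n * n * n * (n * n * n))) + q * (p * n * (n * n * (p * n)))) + c * (2 * (q * p * n ^ 6))) →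
    q * S ≤ 12 * n ^ 6
  second-moment c p q n S 1≤c 1≤p 1≤q p≤n² h = ℕP.*-cancelˡ-≤ (c * (p * q)) {{ℕ.>-nonZero (ℕP.*-mono-≤ 1≤c (ℕP.*-mono-≤ 1≤p 1≤q))}} (begin
    c * (p * q) * (q * S)
      ≡⟨ solve 4 (λ c p q s → c :* (p :* q) :* (q :* s) := c :* (p :* (q :* q) :* s)) refl c p q S ⟩
    c * (p * (q * q) * S)
      ≤⟨ h ⟩
    3 * (c * (q * (p * (n * n * n * (n * n * n))) + q * (p * n * (n * n * (p * n)))) + c * (2 * (q * p * n ^ 6)))
      ≤⟨ ℕP.*-monoʳ-≤ 3 (ℕP.+-monoˡ-≤ (c * (2 * (q * p * n ^ 6))) (ℕP.*-monoʳ-≤ c (ℕP.+-monoʳ-≤ (q * (p * (n * n * n * (n * n * n)))) (ℕP.*-monoʳ-≤ q lower)))) ⟩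
    3 * (c * (q * (p * (n * n * n * (n * n * n))) + q * (p * (n * n * n * (n * n * n)))) + c * (2 * (q * p * n ^ 6)))
      ≡⟨ solve 4 (λ c p q n → let X = p :* (n :* n :* n :* (n :* n :* n)); n⁶ = n :* (n :* (n :* (n :* (n :* (n :* con 1))))) in
           con 3 :* (c :* (q :* X :+ q :* X) :+ c :* (con 2 :* (q :* p :* n⁶))) := c :* (p :* q) :* (con 12 :* n⁶)) refl c p q n ⟩
    c * (p * q) * (12 * n ^ 6) ∎)
    where
    open ℕP.≤-Reasoning
    lower : p * n * (n * n * (p * n)) ≤ p * (n * n * n * (n * n * n))
    lower = begin
      p * n * (n * n * (p * n))              ≡⟨ solve 2 (λ p n → p :* n :* (n :* n :* (p :* n)) := p :* (p :* (n :* n :* n :* n))) refl p n ⟩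
      p * (p * (n * n * n * n))              ≤⟨ ℕP.*-monoʳ-≤ p (ℕP.*-monoˡ-≤ (n * n * n * n) p≤n²) ⟩
      p * (n * n * (n * n * n * n))          ≡⟨ ≡.cong (p *_) (solve 1 (λ n → n :* n :* (n :* n :* n :* n) := n :* n :* n :* (n :* n :* n)) refl n) ⟩
      p * (n * n * n * (n * n * n))          ∎

  square-cancel : ∀ {m n} → m * m ≤ n * n → m ≤ n
  square-cancel {m} {n} h with ℕP.≤-<-connex m n
  ... | inj₁ m≤n = m≤n
  ... | inj₂ n<m = ⊥-elim (ℕP.<⇒≱ (ℕP.*-mono-< n<m n<m) h)

  -- With d = 2k the estimate for the error at t = 0 is q^d times a perfect square, so its root can
  -- be taken among natural numbers.
  zero-fibre : ∀ q k n → q * q * (q ^ (k + k) * n * (n * n * (q ^ (k + k) * n))) ≡ q ^ (k + k) * (q ^ suc k * (n * n) * (q ^ suc k * (n * n)))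
  zero-fibre q k n = ≡.trans
    (solve 3 (λ q p n → q :* q :* (p :* n :* (n :* n :* (p :* n))) := p :* (q :* q :* p :* (n :* n :* (n :* n)))) refl q (q ^ (k + k)) n)
    (≡.cong (q ^ (k + k) *_) (≡.trans (≡.cong (λ x → q * q * x * (n * n * (n * n))) (ℕP.^-distribˡ-+-* q k k))
      (solve 3 (λ q x n → q :* q :* (x :* x) :* (n :* n) := q :* x :* n :* (q :* x :* n)) refl q (q ^ k) (n * n))))

-- Fourier analysis of the norms of triple sums

module TripleSums (K : FiniteField) (M : CharacterRing K) (char≢2 : FiniteField.CharNot2 K) (k′ : ℕ)
  (E : List (Vec (FiniteField.F K) (suc k′ ℕ.+ suc k′))) (E-unique : Unique E) where
  open FiniteField K using (F; elements; size; _≟_; _⊕_; ‖_‖) renaming (0# to 0ᶠ; 1# to 1ᶠ)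
  open VectorSpace K
  open 𝔽 using () renaming (_+_ to _+ᶠ_; _*_ to _*ᶠ_)
  open Order K M
  open Characters K M
  open NatCount K M
  open Moments K M char≢2 k′ E E-unique
  open Restriction K M char≢2 k′ E E-unique
  open GaussSums K M char≢2
  open +-*-Solver using () renaming (solve to solveₙ; _:=_ to _≔_; _:*_ to _⊠_; con to conₙ)

  -- Sums are listed with multiplicity, so that the Fourier transform of `triples` is exactly Ê³.
  pairs triples : List (Vec F d)
  pairs = cartesianProductWith _⊕_ E E
  triples = cartesianProductWith _⊕_ pairs E

  N³ : ℕ
  N³ = N² ℕ.* N

  length-triples : length triples ≡ N³
  length-triples = ≡.trans (ℕΣ.length-cartesianProductWith _⊕_ pairs E) (≡.cong (ℕ._* N) (ℕΣ.length-cartesianProductWith _⊕_ E E))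

  ν : F → ℕ
  ν t = ℕΣ.∑ triples (λ x → ℕΣ.[ ‖ x ‖ ≟ t ])

  ∑-split : ∀ (f : F → Carrier) → ∑ elements f ≈ f 0ᶠ + (∑[ s ← elements ] ([ nonzero? s ] * f s))
  ∑-split f = begin-equality
    ∑ elements f
      ≈⟨ ∑-cong elements (λ s → ≈-trans (≈-sym (*-identityˡ _)) (≈-trans (*-congʳ (≈-sym ([]-¬ (s ≟ 0ᶠ)))) (distribʳ _ _ _))) ⟩
    ∑[ s ← elements ] ([ s ≟ 0ᶠ ] * f s + [ nonzero? s ] * f s)
      ≈⟨ ≈-trans (∑-+ elements _ _) (+-congʳ (∑F-pick f 0ᶠ)) ⟩
    f 0ᶠ + (∑[ s ← elements ] ([ nonzero? s ] * f s)) ∎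

  cube : Vec F d → Carrier
  cube m = Ê m * (Ê m * Ê m)

  ∑-triples : ∀ m → ∑[ x ← triples ] χ (dot m x) ≈ cube m
  ∑-triples m = begin-equality
    ∑[ x ← triples ] χ (dot m x)
      ≈⟨ product pairs E ⟩
    (∑[ x ← pairs ] χ (dot m x)) * Ê m
      ≈⟨ *-congʳ (product E E) ⟩
    Ê m * Ê m * Ê m
      ≈⟨ *-assoc _ _ _ ⟩
    cube m ∎
    where
    product : ∀ xs ys → ∑[ x ← cartesianProductWith _⊕_ xs ys ] χ (dot m x) ≈ (∑[ x ← xs ] χ (dot m x)) * (∑[ y ← ys ] χ (dot m y))
    product xs ys = ≈-trans (∑-cartesianProductWith _⊕_ xs ys _)
      (≈-trans (∑-cong xs (λ x → ∑-cong ys (λ y → ≈-trans (χ-cong (dot-⊕ʳ x y m)) (χ-+ _ _)))) (≈-sym (∑-*-∑ xs ys _ _)))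

  -- Fourier transforms on the field: g is that of ν, b is that of `cubes`, and b* is that of
  -- `cubes` with the sphere r = 0 removed.
  g b b* : F → Carrier
  g s = ∑[ x ← triples ] χ (s *ᶠ ‖ x ‖)
  b s = ∑[ r ← elements ] (cubes r * χ (s *ᶠ r))
  b* s = ∑[ r ← elements ] ([ nonzero? r ] * cubes r * χ (s *ᶠ r))

  Γ₁ : Carrier
  Γ₁ = Γ d 1ᶠ

  b-spheres : ∀ s → b s ≈ ∑[ m ← Vs ] (χ (s *ᶠ ‖ m ‖) * cube m)
  b-spheres s = begin-equality
    ∑[ r ← elements ] (cubes r * χ (s *ᶠ r))
      ≈⟨ ∑-cong elements (λ r → ∑-*ʳ Vs _ _) ⟨
    ∑[ r ← elements ] (∑[ m ← Vs ] ([ sphere? r m ] * cube m * χ (s *ᶠ r)))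
      ≈⟨ ∑-cong elements (λ r → ∑-cong Vs (λ m → ≈-trans (*-assoc _ _ _) ([]-*-cong (sphere? r m)
           (λ e → ≈-trans (*-comm _ _) (*-congʳ (χ-cong (≡.cong (s *ᶠ_) (≡.sym e)))))))) ⟩
    ∑[ r ← elements ] (∑[ m ← Vs ] ([ sphere? r m ] * (χ (s *ᶠ ‖ m ‖) * cube m)))
      ≈⟨ ∑-spheres _ ⟩
    ∑[ m ← Vs ] (χ (s *ᶠ ‖ m ‖) * cube m) ∎

  -- The square is completed in the sum over m for each x in `triples`. In even dimension the Gauss
  -- sum at s equals the one at 1, so the same factor Γ₁ serves all frequencies.
  Γ*g : ∀ s → s ≢ 0ᶠ → Γ₁ * g (σ s) ≈ b s
  Γ*g s s≢0 = begin-equality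
    Γ₁ * g (σ s)
      ≈⟨ ≈-trans (*-congʳ (≈-sym (Γ-even k s s≢0))) (≈-sym (∑-*ˡ triples _ _)) ⟩
    ∑[ x ← triples ] (Γ d s * χ (σ s *ᶠ ‖ x ‖))
      ≈⟨ ∑-cong triples (λ x → complete-square s s≢0 x) ⟨
    ∑[ x ← triples ] (∑[ m ← Vs ] χ (dot m x +ᶠ s *ᶠ ‖ m ‖))
      ≈⟨ ∑-swap triples Vs _ ⟩
    ∑[ m ← Vs ] (∑[ x ← triples ] χ (dot m x +ᶠ s *ᶠ ‖ m ‖))
      ≈⟨ ∑-cong Vs (λ m → ≈-trans (∑-cong triples (λ x → ≈-trans (χ-+ _ _) (*-comm _ _)))
           (≈-trans (∑-*ˡ triples _ _) (*-congˡ (∑-triples m)))) ⟩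
    ∑[ m ← Vs ] (χ (s *ᶠ ‖ m ‖) * cube m)
      ≈⟨ b-spheres s ⟨
    b s ∎

  -- An inverse Fourier transform in the frequency σ s. The omitted term s = 0 is the one that
  -- yields the expected value N³.
  dual : (F → Carrier) → F → Carrier
  dual β t = ∑[ s ← elements ] ([ nonzero? s ] * β s * conj (χ (σ s *ᶠ t)))

  χ-0* : ∀ t → χ (0ᶠ *ᶠ t) ≈ 1#
  χ-0* t = ≈-trans (χ-cong (𝔽.zeroˡ t)) χ-0

  χ-*0 : ∀ t → χ (t *ᶠ 0ᶠ) ≈ 1#
  χ-*0 t = ≈-trans (χ-cong (𝔽.zeroʳ t)) χ-0

  conj-χ-σ0 : ∀ t → conj (χ (σ 0ᶠ *ᶠ t)) ≈ 1#
  conj-χ-σ0 t = ≈-trans (conj-cong (≈-trans (χ-cong (≡.cong (_*ᶠ t) σ-0)) (χ-0* t))) conj-1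

  -- Fourier inversion for ν with the frequencies permuted by σ. The equation is multiplied by Γ₁
  -- instead of dividing b by it; the norm of Γ₁, which is q^d, is cancelled later.
  inversion : ∀ t → Γ₁ * nat (size ℕ.* ν t) ≈ Γ₁ * nat N³ + dual b t
  inversion t = begin-equality
    Γ₁ * nat (size ℕ.* ν t)
      ≈⟨ *-congˡ (≈-trans (nat-* size (ν t)) (*-comm _ _)) ⟩
    Γ₁ * (nat (ν t) * nat size)
      ≈⟨ *-congˡ (≈-trans (*-congʳ (nat-count (λ x → ‖ x ‖ ≟ t) triples)) (≈-sym (∑-*ʳ triples _ _))) ⟩
    Γ₁ * (∑[ x ← triples ] ([ ‖ x ‖ ≟ t ] * nat size))
      ≈⟨ *-congˡ (∑-cong triples (λ x → ≈-trans (*-congʳ ([]-cong (‖ x ‖ ≟ t) (t ≟ ‖ x ‖) ≡.sym ≡.sym)) (≈-sym (orthogonalᶠ (‖ x ‖) t)))) ⟩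
    Γ₁ * (∑[ x ← triples ] (∑[ s ← elements ] (χ (s *ᶠ ‖ x ‖) * conj (χ (s *ᶠ t)))))
      ≈⟨ *-congˡ (≈-trans (∑-swap triples elements _) (∑-cong elements (λ s → ∑-*ʳ triples _ _))) ⟩
    Γ₁ * (∑[ s ← elements ] (g s * conj (χ (s *ᶠ t))))
      ≈⟨ *-congˡ (∑F-reindex σ σ σσ σσ (λ s → g s * conj (χ (s *ᶠ t)))) ⟨
    Γ₁ * (∑[ s ← elements ] (g (σ s) * conj (χ (σ s *ᶠ t))))
      ≈⟨ ≈-trans (≈-sym (∑-*ˡ elements _ _)) (∑-split _) ⟩
    Γ₁ * (g (σ 0ᶠ) * conj (χ (σ 0ᶠ *ᶠ t))) + (∑[ s ← elements ] ([ nonzero? s ] * (Γ₁ * (g (σ s) * conj (χ (σ s *ᶠ t))))))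
      ≈⟨ +-cong (*-congˡ (≈-trans (*-cong g-σ0 (conj-χ-σ0 t)) (*-identityʳ _)))
           (∑-cong elements (λ s → ≈-trans ([]-*-cong (nonzero? s) (λ s≢0 → ≈-trans (≈-sym (*-assoc _ _ _)) (*-congʳ (Γ*g s s≢0))))
             (≈-sym (*-assoc _ _ _)))) ⟩
    Γ₁ * nat N³ + dual b t ∎
    where
    g-σ0 : g (σ 0ᶠ) ≈ nat N³
    g-σ0 = ≈-trans (∑-cong triples (λ x → ≈-trans (χ-cong (≡.cong (_*ᶠ ‖ x ‖) σ-0)) (χ-0* (‖ x ‖))))
      (≈-trans (∑-const triples 1#) (≈-trans (*-identityʳ _) (reflexive (≡.cong nat length-triples))))

  b-split : ∀ s → b s ≈ cubes 0ᶠ + b* s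
  b-split s = ≈-trans (∑-split _) (+-cong (≈-trans (*-congˡ (χ-*0 s)) (*-identityʳ _)) (∑-cong elements (λ r → ≈-sym (*-assoc _ _ _))))

  -- Over all s this is a complete character sum, which vanishes as t ≠ 0, and the removed term s =
  -- 0 is 1. The part of b that comes from r = 0 does not depend on s, so it enters with weight -1
  -- only.
  ∑-dual-1 : ∀ t → t ≢ 0ᶠ → ∑[ s ← elements ] ([ nonzero? s ] * conj (χ (σ s *ᶠ t))) ≈ - 1#
  ∑-dual-1 t t≢0 = begin-equality
    S
      ≈⟨ solve 1 (λ s → s := (con (+ 1) :+ s) :- con (+ 1)) ≈-refl S ⟩
    1# + S - 1#
      ≈⟨ +-congʳ (≈-trans (+-congʳ (≈-sym (conj-χ-σ0 t))) (≈-sym (∑-split _))) ⟩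
    (∑[ s ← elements ] conj (χ (σ s *ᶠ t))) - 1#
      ≈⟨ +-congʳ (≈-trans (∑F-reindex σ σ σσ σσ (λ s → conj (χ (s *ᶠ t)))) (≈-sym (conj-∑ elements _))) ⟩
    conj (∑[ s ← elements ] χ (s *ᶠ t)) - 1#
      ≈⟨ +-congʳ (≈-trans (conj-cong (∑-χ-scale t≢0)) conj-0) ⟩
    0# - 1#
      ≈⟨ +-identityˡ _ ⟩
    - 1# ∎
    where
    S : Carrier
    S = ∑[ s ← elements ] ([ nonzero? s ] * conj (χ (σ s *ᶠ t)))

  dual-b : ∀ t → t ≢ 0ᶠ → dual b t ≈ - cubes 0ᶠ + dual b* t
  dual-b t t≢0 = begin-equality
    ∑[ s ← elements ] ([ nonzero? s ] * b s * conj (χ (σ s *ᶠ t)))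
      ≈⟨ ∑-cong elements (λ s → ≈-trans (*-congʳ (*-congˡ (b-split s)))
           (solve 4 (λ n a c e → n :* (a :+ c) :* e := a :* (n :* e) :+ n :* c :* e) ≈-refl [ nonzero? s ] (cubes 0ᶠ) (b* s) (conj (χ (σ s *ᶠ t))))) ⟩
    ∑[ s ← elements ] (cubes 0ᶠ * ([ nonzero? s ] * conj (χ (σ s *ᶠ t))) + [ nonzero? s ] * b* s * conj (χ (σ s *ᶠ t)))
      ≈⟨ ≈-trans (∑-+ elements _ _) (+-congʳ (≈-trans (∑-*ˡ elements _ _) (*-congˡ (∑-dual-1 t t≢0)))) ⟩
    cubes 0ᶠ * - 1# + dual b* t
      ≈⟨ +-congʳ (solve 1 (λ x → x :* (:- con (+ 1)) := :- x) ≈-refl (cubes 0ᶠ)) ⟩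
    - cubes 0ᶠ + dual b* t ∎

  -- Since σ is a bijection, the characters with frequencies σ s are still pairwise orthogonal.
  ∑-norm-dual : ∀ β → ∑[ t ← elements ] norm (dual β t) ≼ nat size * (∑[ s ← elements ] norm (β s))
  ∑-norm-dual β = begin
    ∑[ t ← elements ] norm (dual β t)
      ≈⟨ Dual.plancherel (λ s → [ nonzero? s ] * β s) (FiniteField.distinct K) ⟩
    nat size * (∑[ s ← elements ] norm ([ nonzero? s ] * β s))
      ≲⟨ *-monoˡ (nat-NonNeg size) (∑-mono elements (λ s →
           ≼-trans (≼-reflexive (norm-[]* (nonzero? s) (β s))) ([]*≼ (nonzero? s) (NonNeg-norm (β s))))) ⟩
    nat size * (∑[ s ← elements ] norm (β s)) ∎
    where
    orthogonal : ∀ x y → ∑[ t ← elements ] (conj (χ (σ x *ᶠ t)) * conj (conj (χ (σ y *ᶠ t)))) ≈ [ y ≟ x ] * nat size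
    orthogonal x y = ≈-trans
      (∑-cong elements (λ t → ≈-trans (*-comm _ _) (*-cong
        (≈-trans (conj-conj _) (χ-cong (𝔽.*-comm (σ y) t))) (conj-cong (χ-cong (𝔽.*-comm (σ x) t))))))
      (≈-trans (orthogonalᶠ (σ y) (σ x)) (*-congʳ ([]-cong (σ x ≟ σ y) (y ≟ x)
        (λ e → ≡.trans (≡.sym (σσ y)) (≡.trans (≡.cong σ (≡.sym e)) (σσ x))) (λ e → ≡.cong σ (≡.sym e)))))
    module Dual = Plancherel.Kernel K M _≟_ elements (λ t s → conj (χ (σ s *ᶠ t))) (nat size) orthogonal

  ∑-norm-dual-b* : ∑[ t ← elements ] norm (dual b* t) ≼ nat (size ℕ.* size) * cubes-energy
  ∑-norm-dual-b* = begin
    ∑[ t ← elements ] norm (dual b* t)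
      ≲⟨ ∑-norm-dual b* ⟩
    nat size * (∑[ s ← elements ] norm (b* s))
      ≈⟨ *-congˡ (Planchᶠ.plancherel (λ r → [ nonzero? r ] * cubes r) (FiniteField.distinct K)) ⟩
    nat size * (nat size * (∑[ r ← elements ] norm ([ nonzero? r ] * cubes r)))
      ≈⟨ ≈-trans (≈-sym (*-assoc _ _ _)) (*-cong (≈-sym (nat-* size size)) (∑-cong elements (λ r → norm-[]* (nonzero? r) (cubes r)))) ⟩
    nat (size ℕ.* size) * cubes-energy ∎

  ∑-norm-dual-b : ∑[ t ← elements ] norm (dual b t) ≼ nat (size ℕ.* size ℕ.* (Θ ℕ.* (N² ℕ.* Θ)))
  ∑-norm-dual-b = begin
    ∑[ t ← elements ] norm (dual b t)
      ≲⟨ ∑-norm-dual b ⟩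
    nat size * (∑[ s ← elements ] norm (b s))
      ≈⟨ *-congˡ (Planchᶠ.plancherel cubes (FiniteField.distinct K)) ⟩
    nat size * (nat size * (∑[ r ← elements ] norm (cubes r)))
      ≲⟨ *-monoˡ (nat-NonNeg size) (*-monoˡ (nat-NonNeg size) ∑-cubes) ⟩
    nat size * (nat size * nat (Θ ℕ.* (N² ℕ.* Θ)))
      ≈⟨ ≈-trans (nat-* (size ℕ.* size) (Θ ℕ.* (N² ℕ.* Θ))) (≈-trans (*-congʳ (nat-* size size)) (*-assoc _ _ _)) ⟨
    nat (size ℕ.* size ℕ.* (Θ ℕ.* (N² ℕ.* Θ))) ∎

  norm-Γ*nat : ∀ n → norm (Γ₁ * nat n) ≈ nat (size ℕ.^ d ℕ.* (n ℕ.* n))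
  norm-Γ*nat n = ≈-trans (norm-* Γ₁ (nat n)) (≈-trans
    (*-cong (norm-Γ d 1ᶠ (λ e → FiniteField.0≢1 K (≡.sym e))) (≈-trans (norm-real (conj-nat n)) (≈-sym (nat-* n n))))
    (≈-sym (nat-* (size ℕ.^ d) (n ℕ.* n))))

  norm-neg : ∀ x → norm (- x) ≈ norm x
  norm-neg x = ≈-trans (*-congˡ (conj-neg x)) (solve 2 (λ x y → (:- x) :* (:- y) := x :* y) ≈-refl x (conj x))

  single-bound : ∀ t → t ≢ 0ᶠ → nat (size ℕ.^ d ℕ.* (size ℕ.* ν t ℕ.* (size ℕ.* ν t)))
                 ≼ nat 3 * (nat (size ℕ.^ d ℕ.* (N³ ℕ.* N³)) + norm (cubes 0ᶠ) + norm (dual b* t))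
  single-bound t t≢0 = begin
    nat (size ℕ.^ d ℕ.* (size ℕ.* ν t ℕ.* (size ℕ.* ν t)))
      ≈⟨ norm-Γ*nat (size ℕ.* ν t) ⟨
    norm (Γ₁ * nat (size ℕ.* ν t))
      ≈⟨ norm-cong (≈-trans (inversion t) (≈-trans (+-congˡ (dual-b t t≢0)) (≈-sym (+-assoc _ _ _)))) ⟩
    norm (Γ₁ * nat N³ + - cubes 0ᶠ + dual b* t)
      ≲⟨ norm-+-+ _ _ _ ⟩
    nat 3 * (norm (Γ₁ * nat N³) + norm (- cubes 0ᶠ) + norm (dual b* t))
      ≈⟨ *-congˡ (+-congʳ (+-cong (norm-Γ*nat N³) (norm-neg _))) ⟩
    nat 3 * (nat (size ℕ.^ d ℕ.* (N³ ℕ.* N³)) + norm (cubes 0ᶠ) + norm (dual b* t)) ∎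

  second-moment : ℕ
  second-moment = ℕΣ.∑ elements (λ t → ℕΣ.[ nonzero? t ] ℕ.* (ν t ℕ.* ν t))

  second-moment≼ : nat (size ℕ.^ d ℕ.* (size ℕ.* size) ℕ.* second-moment)
    ≼ nat 3 * (nat (size ℕ.* (size ℕ.^ d ℕ.* (N³ ℕ.* N³)) ℕ.+ size ℕ.* (Θ ℕ.* (N² ℕ.* Θ))) + nat (size ℕ.* size) * cubes-energy)
  second-moment≼ = begin
    nat (size ℕ.^ d ℕ.* (size ℕ.* size) ℕ.* second-moment)
      ≈⟨ reflexive (≡.cong nat (≡.sym (ℕΣ.∑-*ˡ elements (size ℕ.^ d ℕ.* (size ℕ.* size)) (λ t → ℕΣ.[ nonzero? t ] ℕ.* (ν t ℕ.* ν t))))) ⟩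
    nat (ℕΣ.∑ elements (λ t → size ℕ.^ d ℕ.* (size ℕ.* size) ℕ.* (ℕΣ.[ nonzero? t ] ℕ.* (ν t ℕ.* ν t))))
      ≈⟨ nat-∑ elements _ ⟩
    ∑[ t ← elements ] nat (size ℕ.^ d ℕ.* (size ℕ.* size) ℕ.* (ℕΣ.[ nonzero? t ] ℕ.* (ν t ℕ.* ν t)))
      ≲⟨ ∑-mono elements pointwise ⟩
    ∑[ t ← elements ] (nat 3 * (nat X + norm (cubes 0ᶠ) + norm (dual b* t)))
      ≈⟨ ≈-trans (∑-*ˡ elements (nat 3) _) (*-congˡ (≈-trans (∑-+ elements _ _) (+-congʳ (∑-const elements _)))) ⟩
    nat 3 * (nat size * (nat X + norm (cubes 0ᶠ)) + (∑[ t ← elements ] norm (dual b* t)))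
      ≲⟨ *-monoˡ (nat-NonNeg 3) (+-mono (*-monoˡ (nat-NonNeg size) (+-mono ≼-refl cubes0≼)) ∑-norm-dual-b*) ⟩
    nat 3 * (nat size * (nat X + nat (Θ ℕ.* (N² ℕ.* Θ))) + nat (size ℕ.* size) * cubes-energy)
      ≈⟨ *-congˡ (+-congʳ (≈-trans (nat-+ (size ℕ.* X) (size ℕ.* (Θ ℕ.* (N² ℕ.* Θ))))
           (≈-trans (+-cong (nat-* size X) (nat-* size (Θ ℕ.* (N² ℕ.* Θ)))) (≈-sym (distribˡ _ _ _))))) ⟨
    nat 3 * (nat (size ℕ.* X ℕ.+ size ℕ.* (Θ ℕ.* (N² ℕ.* Θ))) + nat (size ℕ.* size) * cubes-energy) ∎
    where
    X : ℕ
    X = size ℕ.^ d ℕ.* (N³ ℕ.* N³)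
    -- One term is bounded by the whole sum, that is by q^(2d) N⁴, which does not exceed q^d N⁶ once
    -- q^d ≤ N².
    cubes0≼ : norm (cubes 0ᶠ) ≼ nat (Θ ℕ.* (N² ℕ.* Θ))
    cubes0≼ = ≼-trans (∈⇒≼∑ (λ r → NonNeg-norm (cubes r)) (FiniteField.complete K 0ᶠ)) ∑-cubes
    pointwise : ∀ t → nat (size ℕ.^ d ℕ.* (size ℕ.* size) ℕ.* (ℕΣ.[ nonzero? t ] ℕ.* (ν t ℕ.* ν t))) ≼ nat 3 * (nat X + norm (cubes 0ᶠ) + norm (dual b* t))
    pointwise t with t ≟ 0ᶠ
    ... | yes _ = ≼-trans (≼-reflexive (reflexive (≡.cong nat (ℕP.*-zeroʳ (size ℕ.^ d ℕ.* (size ℕ.* size))))))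
      (0≼ (NonNeg-* (nat-NonNeg 3) (NonNeg-+ (NonNeg-+ (nat-NonNeg X) (NonNeg-norm _)) (NonNeg-norm _))))
    ... | no t≢0 = ≼-trans (≼-reflexive (reflexive (≡.cong nat
      (solveₙ 3 (λ p q n → p ⊠ (q ⊠ q) ⊠ (conₙ 1 ⊠ (n ⊠ n)) ≔ p ⊠ (q ⊠ n ⊠ (q ⊠ n))) refl (size ℕ.^ d) size (ν t))))) (single-bound t t≢0)

  second-moment-bound : 1 ℕ.≤ N → size ℕ.^ (4 ℕ.* (k ℕ.* k) ℕ.+ k′) ℕ.≤ N ℕ.^ (4 ℕ.* k′ ℕ.+ 3) → size ℕ.^ d ℕ.≤ N² →
    size ℕ.* second-moment ℕ.≤ 12 ℕ.* N ℕ.^ 6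
  second-moment-bound 1≤N H q^d≤N² = MomentArithmetic.second-moment c (size ℕ.^ d) size N second-moment
      1≤c (ℕP.m^n>0 size {{ℕ.>-nonZero 1≤size}} d) 1≤size q^d≤N² (NonNeg-reflect {c ℕ.* L} {3 ℕ.* (c ℕ.* Y₀ ℕ.+ c ℕ.* Z₀)} inR)
    where
    c L Y₀ Z₀ : ℕ
    c = proj₁ (cubes-energy-bound 1≤N H)
    1≤c = proj₁ (proj₂ (cubes-energy-bound 1≤N H))
    energy = proj₂ (proj₂ (cubes-energy-bound 1≤N H))
    L = size ℕ.^ d ℕ.* (size ℕ.* size) ℕ.* second-moment
    Y₀ = size ℕ.* (size ℕ.^ d ℕ.* (N³ ℕ.* N³)) ℕ.+ size ℕ.* (Θ ℕ.* (N² ℕ.* Θ))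
    Z₀ = 2 ℕ.* (size ℕ.^ suc d ℕ.* N ℕ.^ 6)
    1≤size : 1 ℕ.≤ size
    1≤size = ℕP.≤-trans (ℕ.s≤s ℕ.z≤n) (size≥2 K)
    inR : nat (c ℕ.* L) ≼ nat (3 ℕ.* (c ℕ.* Y₀ ℕ.+ c ℕ.* Z₀))
    inR = begin
      nat (c ℕ.* L)
        ≈⟨ nat-* c L ⟩
      nat c * nat L
        ≲⟨ *-monoˡ (nat-NonNeg c) second-moment≼ ⟩
      nat c * (nat 3 * (nat Y₀ + nat (size ℕ.* size) * cubes-energy))
        ≈⟨ solve 4 (λ t c y e → c :* (t :* (y :+ e)) := t :* (c :* y :+ c :* e)) ≈-refl (nat 3) (nat c) (nat Y₀) (nat (size ℕ.* size) * cubes-energy) ⟩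
      nat 3 * (nat c * nat Y₀ + nat c * (nat (size ℕ.* size) * cubes-energy))
        ≲⟨ *-monoˡ (nat-NonNeg 3) (+-mono ≼-refl energy) ⟩
      nat 3 * (nat c * nat Y₀ + nat (c ℕ.* Z₀))
        ≈⟨ ≈-trans (nat-* 3 (c ℕ.* Y₀ ℕ.+ c ℕ.* Z₀)) (*-congˡ (≈-trans (nat-+ (c ℕ.* Y₀) (c ℕ.* Z₀)) (+-congʳ (nat-* c Y₀)))) ⟨
      nat (3 ℕ.* (c ℕ.* Y₀ ℕ.+ c ℕ.* Z₀)) ∎

  -- If q ν(0) exceeds N³, the excess Δ is a natural number and |Γ₁ Δ|² is one term of the
  -- Plancherel sum for `dual b`. All spheres, r = 0 included, are bounded trivially, which gives Δ²
  -- ≤ q^(d+2) N⁴.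
  ν-0-bound : size ℕ.* ν 0ᶠ ℕ.≤ N³ ℕ.+ size ℕ.^ suc k ℕ.* N²
  ν-0-bound = cases (ℕP.≤-total (size ℕ.* ν 0ᶠ) N³)
    where
    b₀ : ℕ
    b₀ = size ℕ.^ suc k ℕ.* N²
    nonZero : ℕ.NonZero (size ℕ.^ d)
    nonZero = ℕP.m^n≢0 size d {{ℕ.>-nonZero (ℕP.≤-trans (ℕ.s≤s ℕ.z≤n) (size≥2 K))}}
    module _ (Δ : ℕ) (N³+Δ≡ : N³ ℕ.+ Δ ≡ size ℕ.* ν 0ᶠ) where
      difference : Γ₁ * nat Δ ≈ dual b 0ᶠ
      difference = begin-equality
        Γ₁ * nat Δ
          ≈⟨ solve 3 (λ g n e → g :* e := g :* (n :+ e) :- g :* n) ≈-refl Γ₁ (nat N³) (nat Δ) ⟩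
        Γ₁ * (nat N³ + nat Δ) - Γ₁ * nat N³
          ≈⟨ +-congʳ (≈-trans (*-congˡ (≈-trans (≈-sym (nat-+ N³ Δ)) (reflexive (≡.cong nat N³+Δ≡)))) (inversion 0ᶠ)) ⟩
        Γ₁ * nat N³ + dual b 0ᶠ - Γ₁ * nat N³
          ≈⟨ solve 2 (λ x y → x :+ y :- x := y) ≈-refl (Γ₁ * nat N³) (dual b 0ᶠ) ⟩
        dual b 0ᶠ ∎
      inR : nat (size ℕ.^ d ℕ.* (Δ ℕ.* Δ)) ≼ nat (size ℕ.^ d ℕ.* (b₀ ℕ.* b₀))
      inR = begin
        nat (size ℕ.^ d ℕ.* (Δ ℕ.* Δ))
          ≈⟨ norm-Γ*nat Δ ⟨
        norm (Γ₁ * nat Δ)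
          ≈⟨ norm-cong difference ⟩
        norm (dual b 0ᶠ)
          ≲⟨ ∈⇒≼∑ (λ t → NonNeg-norm (dual b t)) (FiniteField.complete K 0ᶠ) ⟩
        ∑[ t ← elements ] norm (dual b t)
          ≲⟨ ∑-norm-dual-b ⟩
        nat (size ℕ.* size ℕ.* (Θ ℕ.* (N² ℕ.* Θ)))
          ≈⟨ reflexive (≡.cong nat (MomentArithmetic.zero-fibre size k N)) ⟩
        nat (size ℕ.^ d ℕ.* (b₀ ℕ.* b₀)) ∎
    cases : size ℕ.* ν 0ᶠ ℕ.≤ N³ ⊎ N³ ℕ.≤ size ℕ.* ν 0ᶠ → size ℕ.* ν 0ᶠ ℕ.≤ N³ ℕ.+ b₀
    cases (inj₁ p) = ℕP.≤-trans p (ℕP.m≤m+n N³ b₀)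
    cases (inj₂ p) = ℕP.≤-trans (ℕP.≤-reflexive (≡.sym N³+Δ≡)) (ℕP.+-monoʳ-≤ N³
      (MomentArithmetic.square-cancel (ℕP.*-cancelˡ-≤ (size ℕ.^ d) {{nonZero}}
        (NonNeg-reflect {size ℕ.^ d ℕ.* (Δ ℕ.* Δ)} {size ℕ.^ d ℕ.* (b₀ ℕ.* b₀)} (inR Δ N³+Δ≡)))))
      where
      Δ : ℕ
      Δ = proj₁ (ℕP.m≤n⇒∃[o]m+o≡n p)
      N³+Δ≡ : N³ ℕ.+ Δ ≡ size ℕ.* ν 0ᶠ
      N³+Δ≡ = proj₂ (ℕP.m≤n⇒∃[o]m+o≡n p)

-- Rational exponents and extraction of roots

module Rationals where

  ℕ→ℚ≡ : ∀ n → ℕ→ℚ n ≡ mkℚ (+ n) 0 (Coprimality.sym (Coprimality.1-coprimeTo n))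
  ℕ→ℚ≡ n = ℚP.normalize-coprime (Coprimality.sym (Coprimality.1-coprimeTo n))

  ℕ→ℚ-* : ∀ m n → ℕ→ℚ m ℚ.* ℕ→ℚ n ≡ ℕ→ℚ (m ℕ.* n)
  ℕ→ℚ-* m n = ≡.trans (≡.cong₂ ℚ._*_ (ℕ→ℚ≡ m) (ℕ→ℚ≡ n)) (≡.cong (ℚ._/ 1) (≡.sym (ℤP.pos-* m n)))

  ℕ→ℚ-^ : ∀ m k → ℕ→ℚ m ^ℚ k ≡ ℕ→ℚ (m ℕ.^ k)
  ℕ→ℚ-^ m zero = refl
  ℕ→ℚ-^ m (suc k) = ≡.trans (≡.cong (ℕ→ℚ m ℚ.*_) (ℕ→ℚ-^ m k)) (ℕ→ℚ-* m (m ℕ.^ k))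

  ℕ→ℚ-mono : ∀ {m n} → m ℕ.≤ n → ℕ→ℚ m ℚ.≤ ℕ→ℚ n
  ℕ→ℚ-mono {m} {n} m≤n = ≡.subst₂ ℚ._≤_ (≡.sym (ℕ→ℚ≡ m)) (≡.sym (ℕ→ℚ≡ n))
    (ℚ.*≤* (ℤP.*-monoʳ-≤-nonNeg (+ 1) (ℤ.+≤+ m≤n)))

  ℕ→ℚ-mono⁻¹ : ∀ {m n} → ℕ→ℚ m ℚ.≤ ℕ→ℚ n → m ℕ.≤ n
  ℕ→ℚ-mono⁻¹ {m} {n} h = ℤP.drop‿+≤+ (ℤP.*-cancelʳ-≤-pos (+ m) (+ n) (+ 1)
    (ℚP.drop-*≤* (≡.subst₂ ℚ._≤_ (ℕ→ℚ≡ m) (ℕ→ℚ≡ n) h)))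

  /-toℚᵘ : ∀ i n-1 → toℚᵘ (i ℚ./ suc n-1) ℚᵘ.≃ mkℚᵘ i n-1
  /-toℚᵘ i n-1 = ℚP.toℚᵘ-fromℚᵘ (mkℚᵘ i n-1)

  +-≤-/2 : ∀ a b-1 m-1 x → (a ℕ.* suc m-1 ℕ.+ 1 ℕ.* suc b-1) ℕ.* 2 ℕ.≤ x ℕ.* (suc b-1 ℕ.* suc m-1) →
    (+ a) ℚ./ suc b-1 ℚ.+ (+ 1) ℚ./ suc m-1 ℚ.≤ (+ x) ℚ./ 2
  +-≤-/2 a b-1 m-1 x h = ℚP.toℚᵘ-cancel-≤ (ℚᵘP.≤-trans (ℚᵘP.≤-reflexive sum≃)
    (ℚᵘP.≤-trans (ℚᵘ.*≤* ineq) (ℚᵘP.≤-reflexive (ℚᵘP.≃-sym (/-toℚᵘ (+ x) 1)))))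
    where
    sum≃ : toℚᵘ ((+ a) ℚ./ suc b-1 ℚ.+ (+ 1) ℚ./ suc m-1) ℚᵘ.≃ mkℚᵘ (+ a) b-1 ℚᵘ.+ mkℚᵘ (+ 1) m-1
    sum≃ = ℚᵘP.≃-trans (ℚP.toℚᵘ-homo-+ ((+ a) ℚ./ suc b-1) ((+ 1) ℚ./ suc m-1))
      (ℚᵘP.+-cong (/-toℚᵘ (+ a) b-1) (/-toℚᵘ (+ 1) m-1))
    ineq : ((+ a) ℤ.* (+ suc m-1) ℤ.+ (+ 1) ℤ.* (+ suc b-1)) ℤ.* (+ 2) ℤ.≤ (+ x) ℤ.* (+ (suc b-1 ℕ.* suc m-1))
    ineq = ≡.subst₂ ℤ._≤_
      (≡.trans (ℤP.pos-* (a ℕ.* suc m-1 ℕ.+ 1 ℕ.* suc b-1) 2) (≡.cong (ℤ._* (+ 2)) (≡.cong₂ ℤ._+_ (ℤP.pos-* a (suc m-1)) (ℤP.pos-* 1 (suc b-1)))))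
      (ℤP.pos-* x (suc b-1 ℕ.* suc m-1)) (ℤ.+≤+ h)

  cross-multiply : ∀ a b-1 e → (+ a) ℚ./ suc b-1 ℚ.≤ e → (+ a) ℤ.* ℚ.↧ e ℤ.≤ ℚ.↥ e ℤ.* (+ suc b-1)
  cross-multiply a b-1 e@(mkℚ _ _ _) h =
    ℚᵘP.drop-*≤* (ℚᵘP.≤-trans (ℚᵘP.≤-reflexive (ℚᵘP.≃-sym (/-toℚᵘ (+ a) b-1))) (ℚP.toℚᵘ-mono-≤ h))

  p+r≤q⇒p≤q-r : ∀ {p q r} → p ℚ.+ r ℚ.≤ q → p ℚ.≤ q ℚ.- r
  p+r≤q⇒p≤q-r {p} {q} {r} h = ≡.subst (ℚ._≤ q ℚ.- r)
    (≡.trans (ℚP.+-assoc p r (ℚ.- r)) (≡.trans (≡.cong (p ℚ.+_) (ℚP.+-inverseʳ r)) (ℚP.+-identityʳ p)))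
    (ℚP.+-monoˡ-≤ (ℚ.- r) h)

  -- The numbers n and p are the denominator and the numerator of e. A negative numerator would
  -- contradict e ≥ a/b ≥ 0.
  powers : ∀ {N C q a b} .{{_ : ℕ.NonZero b}} (e : ℚ) → AtLeastCPow (ℕ→ℚ N) (ℕ→ℚ C) q e →
           (+ a) ℤ.* ℚ.↧ e ℤ.≤ ℚ.↥ e ℤ.* (+ b) →
           ∃[ n ] ∃[ p ] (1 ℕ.≤ n × a ℕ.* n ℕ.≤ p ℕ.* b × C ℕ.^ n ℕ.* q ℕ.^ p ℕ.≤ N ℕ.^ n)
  powers {N} {C} {q} {a} {b} (mkℚ (+ p) n-1 _) h a/b≤e = suc n-1 , p , ℕ.s≤s ℕ.z≤n ,
    ℤP.drop‿+≤+ (≡.subst₂ ℤ._≤_ (≡.sym (ℤP.pos-* a (suc n-1))) (≡.sym (ℤP.pos-* p b)) a/b≤e) ,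
    ℕ→ℚ-mono⁻¹ (≡.subst₂ ℚ._≤_
      (≡.trans (≡.cong₂ ℚ._*_ (ℕ→ℚ-^ C (suc n-1)) (ℕ→ℚ-^ q p)) (ℕ→ℚ-* (C ℕ.^ suc n-1) (q ℕ.^ p))) (ℕ→ℚ-^ N (suc n-1)) h)
  powers {a = a} {b = suc b} (mkℚ -[1+ p ] n-1 _) h a/b≤e with ≡.subst (ℤ._≤ -[1+ p ] ℤ.* (+ suc b)) (≡.sym (ℤP.pos-* a (suc n-1))) a/b≤e
  ... | ()

module RootExtraction where
  open import Data.Nat using (_+_; _*_; _^_)
  open ExponentArithmetic using (^-distribʳ-*)
  open +-*-Solver using (solve; _:=_; _:+_; _:*_; con)

  root-mono : ∀ n {x y} → 1 ≤ n → x ^ n ≤ y ^ n → x ≤ y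
  root-mono n {x} {y} 1≤n h with ℕP.≤-<-connex x y
  ... | inj₁ x≤y = x≤y
  ... | inj₂ y<x = ⊥-elim (ℕP.<⇒≱ (ℕP.^-monoˡ-< n {{ℕ.>-nonZero 1≤n}} y<x) h)

  -- The exponent p/n depends on ε and is replaced by the smaller fixed exponent a/b: the hypothesis
  -- is raised to the power b, p b is lowered to a n, and the n-th root is taken.
  extract : ∀ {N C q a b n p} → 1 ≤ q → 1 ≤ n → a * n ≤ p * b → C ^ n * q ^ p ≤ N ^ n → C ^ b * q ^ a ≤ N ^ b
  extract {N} {C} {q} {a} {b} {n} {p} 1≤q 1≤n an≤pb h = root-mono n 1≤n (begin
    (C ^ b * q ^ a) ^ n               ≡⟨ ^-distribʳ-* (C ^ b) (q ^ a) n ⟩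
    (C ^ b) ^ n * (q ^ a) ^ n         ≡⟨ ≡.cong₂ _*_ (swap C b n) (ℕP.^-*-assoc q a n) ⟩
    (C ^ n) ^ b * q ^ (a * n)         ≤⟨ ℕP.*-monoʳ-≤ ((C ^ n) ^ b) (ℕP.^-monoʳ-≤ q {{ℕ.>-nonZero 1≤q}} an≤pb) ⟩
    (C ^ n) ^ b * q ^ (p * b)         ≡⟨ ≡.cong ((C ^ n) ^ b *_) (ℕP.^-*-assoc q p b) ⟨
    (C ^ n) ^ b * (q ^ p) ^ b         ≡⟨ ^-distribʳ-* (C ^ n) (q ^ p) b ⟨
    (C ^ n * q ^ p) ^ b               ≤⟨ ℕP.^-monoˡ-≤ b h ⟩
    (N ^ n) ^ b                       ≡⟨ swap N n b ⟩
    (N ^ b) ^ n                       ∎)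
    where
    open ℕP.≤-Reasoning
    swap : ∀ x m n → (x ^ m) ^ n ≡ (x ^ n) ^ m
    swap x m n = ≡.trans (ℕP.^-*-assoc x m n) (≡.trans (≡.cong (x ^_) (ℕP.*-comm m n)) (≡.sym (ℕP.^-*-assoc x n m)))

  -- The exponent 4k² + k′ of q exceeds k (4k′ + 3) by 2k - 1. So the hypothesis also yields N ≥
  -- 4qᵏ, on which the estimate of ν(0) and the inequality q^d ≤ N² rest.
  linear : ∀ {N q} k′ → let k = suc k′ in 1 ≤ q → 4 ^ (4 * k′ + 3) * q ^ (4 * (k * k) + k′) ≤ N ^ (4 * k′ + 3) → 4 * q ^ k ≤ N
  linear {N} {q} k′ 1≤q h = root-mono (4 * k′ + 3) (ℕP.≤-trans (ℕP.m≤n+m 1 (4 * k′ + 2)) (ℕP.≤-reflexive (ℕP.+-assoc (4 * k′) 2 1))) (begin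
    (4 * q ^ k) ^ (4 * k′ + 3)                       ≡⟨ ^-distribʳ-* 4 (q ^ k) (4 * k′ + 3) ⟩
    4 ^ (4 * k′ + 3) * (q ^ k) ^ (4 * k′ + 3)        ≡⟨ ≡.cong (4 ^ (4 * k′ + 3) *_) (ℕP.^-*-assoc q k (4 * k′ + 3)) ⟩
    4 ^ (4 * k′ + 3) * q ^ (k * (4 * k′ + 3))        ≤⟨ ℕP.*-monoʳ-≤ (4 ^ (4 * k′ + 3)) (ℕP.^-monoʳ-≤ q {{ℕ.>-nonZero 1≤q}} exponents) ⟩
    4 ^ (4 * k′ + 3) * q ^ (4 * (k * k) + k′)        ≤⟨ h ⟩
    N ^ (4 * k′ + 3)                                 ∎)
    where
    open ℕP.≤-Reasoning
    k : ℕ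
    k = suc k′
    exponents : k * (4 * k′ + 3) ≤ 4 * (k * k) + k′
    exponents = ℕP.≤-trans (ℕP.m≤m+n _ (k′ + k′ + 1)) (ℕP.≤-reflexive
      (solve 1 (λ k → (con 1 :+ k) :* (con 4 :* k :+ con 3) :+ (k :+ k :+ con 1) := con 4 :* ((con 1 :+ k) :* (con 1 :+ k)) :+ k) refl k′))

  -- As q ≥ 2 and 4qᵏ ≤ n, at most 1/2 + 1/4 of all triples have norm 0. The remaining quarter costs
  -- a factor 16 after squaring, and with the 12 of the second moment this gives 192.
  conclusion : ∀ {q n S₁ S₂ ν₀ L qᵏ} → 2 ≤ q → 1 ≤ n → 4 * qᵏ ≤ n → S₁ + ν₀ ≡ n * n * n →
    q * ν₀ ≤ n * n * n + q * qᵏ * (n * n) → q * S₂ ≤ 12 * n ^ 6 → S₁ * S₁ ≤ L * S₂ → q ≤ 192 * L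
  conclusion {q} {n} {S₁} {S₂} {ν₀} {L} {qᵏ} 2≤q 1≤n 4qᵏ≤n S₁+ν₀≡ ν₀-bound S₂-bound cs =
    ℕP.*-cancelʳ-≤ q (192 * L) (n³ * n³) {{ℕ.>-nonZero (ℕP.*-mono-≤ 1≤n³ 1≤n³)}} (begin
      q * (n³ * n³)
        ≤⟨ ℕP.*-monoʳ-≤ q (ℕP.*-mono-≤ n³≤4S₁ n³≤4S₁) ⟩
      q * (4 * S₁ * (4 * S₁))
        ≡⟨ solve 2 (λ q s → q :* (con 4 :* s :* (con 4 :* s)) := con 16 :* (q :* (s :* s))) refl q S₁ ⟩
      16 * (q * (S₁ * S₁))
        ≤⟨ ℕP.*-monoʳ-≤ 16 (ℕP.*-monoʳ-≤ q cs) ⟩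
      16 * (q * (L * S₂))
        ≡⟨ solve 3 (λ q l s → con 16 :* (q :* (l :* s)) := con 16 :* (l :* (q :* s))) refl q L S₂ ⟩
      16 * (L * (q * S₂))
        ≤⟨ ℕP.*-monoʳ-≤ 16 (ℕP.*-monoʳ-≤ L S₂-bound) ⟩
      16 * (L * (12 * n ^ 6))
        ≡⟨ solve 2 (λ l n → con 16 :* (l :* (con 12 :* (n :* (n :* (n :* (n :* (n :* (n :* con 1)))))))) := con 192 :* l :* (n :* n :* n :* (n :* n :* n))) refl L n ⟩
      192 * L * (n³ * n³) ∎)
    where
    open ℕP.≤-Reasoning
    n³ : ℕ
    n³ = n * n * n
    1≤n³ : 1 ≤ n³
    1≤n³ = ℕP.*-mono-≤ (ℕP.*-mono-≤ 1≤n 1≤n) 1≤n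
    4ν₀≤3n³ : 4 * ν₀ ≤ 3 * n³
    4ν₀≤3n³ = ℕP.*-cancelˡ-≤ q {{ℕ.>-nonZero (ℕP.≤-trans (ℕ.s≤s ℕ.z≤n) 2≤q)}} (begin
      q * (4 * ν₀)                                  ≡⟨ solve 2 (λ q v → q :* (con 4 :* v) := con 4 :* (q :* v)) refl q ν₀ ⟩
      4 * (q * ν₀)                                  ≤⟨ ℕP.*-monoʳ-≤ 4 ν₀-bound ⟩
      4 * (n³ + q * qᵏ * (n * n))                   ≡⟨ solve 3 (λ q p n → con 4 :* (n :* n :* n :+ q :* p :* (n :* n)) := con 2 :* (con 2 :* (n :* n :* n)) :+ q :* (con 4 :* p :* (n :* n))) refl q qᵏ n ⟩
      2 * (2 * n³) + q * (4 * qᵏ * (n * n))         ≤⟨ ℕP.+-mono-≤ (ℕP.*-monoˡ-≤ (2 * n³) 2≤q) (ℕP.*-monoʳ-≤ q (ℕP.*-monoˡ-≤ (n * n) 4qᵏ≤n)) ⟩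
      q * (2 * n³) + q * (n * (n * n))              ≡⟨ solve 2 (λ q n → q :* (con 2 :* (n :* n :* n)) :+ q :* (n :* (n :* n)) := q :* (con 3 :* (n :* n :* n))) refl q n ⟩
      q * (3 * n³)                                  ∎)
    n³≤4S₁ : n³ ≤ 4 * S₁
    n³≤4S₁ = ℕP.+-cancelʳ-≤ (3 * n³) n³ (4 * S₁) (begin
      n³ + 3 * n³             ≡⟨⟩
      4 * n³                  ≡⟨ ≡.cong (4 *_) S₁+ν₀≡ ⟨
      4 * (S₁ + ν₀)           ≡⟨ ℕP.*-distribˡ-+ 4 S₁ ν₀ ⟩
      4 * S₁ + 4 * ν₀         ≤⟨ ℕP.+-monoʳ-≤ (4 * S₁) 4ν₀≤3n³ ⟩
      4 * S₁ + 3 * n³         ∎)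

-- The method reaches the exponent (4k² + k - 1)/(4k - 1) = (d+1)/2 - 1/(4d-2), where d = 2k.
module Exponent (j : ℕ) where
  k′ k d a b m : ℕ
  k′ = 3 ℕ.+ j
  k = suc k′
  d = k ℕ.+ k
  a = 4 ℕ.* (k ℕ.* k) ℕ.+ k′
  b = 4 ℕ.* k′ ℕ.+ 3
  m = 9 ℕ.* suc (suc (j ℕ.+ k))

  instance
    b-nonZero : ℕ.NonZero b
    b-nonZero = _

  -- This is a/b + 1/(9d-18) ≤ (d+1)/2 with denominators cleared; `m` and 4 + suc (j + k) have the
  -- shape to which `expo d` reduces. The slack 24 + 10j is 5d - 16, the difference of 9d - 18 and
  -- 4d - 2.
  numbers : (a ℕ.* m ℕ.+ 1 ℕ.* b) ℕ.* 2 ℕ.≤ (4 ℕ.+ suc (j ℕ.+ k)) ℕ.* (b ℕ.* m)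
  numbers = ℕP.≤-trans (ℕP.m≤m+n _ (24 ℕ.+ 10 ℕ.* j)) (ℕP.≤-reflexive
    (solve 1 (λ j → let K′ = con 3 :+ j; K = con 1 :+ K′; A = con 4 :* (K :* K) :+ K′; B = con 4 :* K′ :+ con 3; M = con 9 :* (con 1 :+ (con 1 :+ (j :+ K))) in
      (A :* M :+ con 1 :* B) :* con 2 :+ (con 24 :+ con 10 :* j) := (con 4 :+ (con 1 :+ (j :+ K))) :* (B :* M)) refl j))
    where open +-*-Solver using (solve; _:=_; _:+_; _:*_; con)

  a/b≤ : ∀ ε → 0ℚ ℚ.< ε → (+ a) ℚ./ b ℚ.≤ expo d ℚ.+ ε
  a/b≤ ε 0<ε = ℚP.≤-trans (Rationals.p+r≤q⇒p≤q-r {r = (+ 1) ℚ./ m} (Rationals.+-≤-/2 a (ℕ.pred b) (ℕ.pred m) (4 ℕ.+ suc (j ℕ.+ k)) numbers))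
    (≡.subst (ℚ._≤ expo d ℚ.+ ε) (ℚP.+-identityʳ (expo d)) (ℚP.+-monoʳ-≤ (expo d) (ℚP.<⇒≤ 0<ε)))

  module _ (K : FiniteField) (char≢2 : FiniteField.CharNot2 K) (E : List (Vec (FiniteField.F K) d)) (E-unique : Unique E) where
    open FiniteField K

    size≥1 : 1 ℕ.≤ size
    size≥1 = ℕP.≤-trans (ℕ.s≤s ℕ.z≤n) (size≥2 K)

    large : ∀ ε → 0ℚ ℚ.< ε → AtLeastCPow (ℕ→ℚ (length E)) (ℕ→ℚ 4) size (expo d ℚ.+ ε) → 4 ℕ.^ b ℕ.* size ℕ.^ a ℕ.≤ length E ℕ.^ b
    large ε 0<ε h = RootExtraction.extract {length E} {4} {size} {a} {b} {proj₁ root} {proj₁ (proj₂ root)} size≥1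
      (proj₁ (proj₂ (proj₂ root))) (proj₁ (proj₂ (proj₂ (proj₂ root)))) (proj₂ (proj₂ (proj₂ (proj₂ root))))
      where
      root : ∃[ n ] ∃[ p ] (1 ℕ.≤ n × a ℕ.* n ℕ.≤ p ℕ.* b × 4 ℕ.^ n ℕ.* size ℕ.^ p ℕ.≤ length E ℕ.^ n)
      root = Rationals.powers {length E} {4} {size} {a} {b} (expo d ℚ.+ ε) h
        (Rationals.cross-multiply a (ℕ.pred b) (expo d ℚ.+ ε) (a/b≤ ε 0<ε))

    module Conclusion (M : CharacterRing K) (h : 4 ℕ.^ b ℕ.* size ℕ.^ a ℕ.≤ length E ℕ.^ b) where
      open Order K M using (NonNeg-reflect; nat; nat-*; conj-nat; norm; norm-real; cauchy-schwarz-1)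
      open TripleSums K M char≢2 k′ E E-unique hiding (b)
      open Restriction K M char≢2 k′ E E-unique using (nonzero?)
      open Counting
      open Moments K M char≢2 k′ E E-unique using (N; N²)
      private
        module O = Order K M

      4q^k≤N : 4 ℕ.* size ℕ.^ k ℕ.≤ N
      4q^k≤N = RootExtraction.linear k′ size≥1 h

      N≥1 : 1 ℕ.≤ N
      N≥1 = ℕP.≤-trans (ℕP.*-mono-≤ {1} {4} (ℕ.s≤s ℕ.z≤n) (ℕP.m^n>0 size {{ℕ.>-nonZero size≥1}} k)) 4q^k≤N

      H : size ℕ.^ a ℕ.≤ N ℕ.^ b
      H = ℕP.≤-trans (ℕP.m≤n*m (size ℕ.^ a) (4 ℕ.^ b) {{ℕP.m^n≢0 4 b}}) h

      q^d≤N² : size ℕ.^ d ℕ.≤ N²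
      q^d≤N² = ℕP.≤-trans (ℕP.≤-reflexive (ℕP.^-distribˡ-+-* size k k)) (ℕP.*-mono-≤ q^k≤N q^k≤N)
        where
        q^k≤N : size ℕ.^ k ℕ.≤ N
        q^k≤N = ℕP.≤-trans (ℕP.m≤n*m (size ℕ.^ k) 4) 4q^k≤N

      -- The value 0 is left out because the second moment is controlled over t ≠ 0 only; a positive
      -- proportion of the triples has nonzero norm in any case.
      represented? : ∀ t → Dec (t ≢ 0# × 1 ℕ.≤ ν t)
      represented? t = nonzero? t ×-dec (1 ℕP.≤? ν t)

      values : List F
      values = filter represented? elements

      S₁ : ℕ
      S₁ = ∑ values ν

      S₁+ν₀ : S₁ ℕ.+ ν 0# ≡ N³
      S₁+ν₀ = begin
        S₁ ℕ.+ ν 0#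
          ≡⟨ ≡.cong₂ ℕ._+_ (∑-filter represented? elements ν) (≡.sym (EnumSummation.pick ℕP.+-*-commutativeSemiring (fieldEnumeration K) ν 0#)) ⟩
        ∑ elements (λ t → [ represented? t ] ℕ.* ν t) ℕ.+ ∑ elements (λ t → [ t ≟ 0# ] ℕ.* ν t)
          ≡⟨ ∑-+ elements _ _ ⟨
        ∑ elements (λ t → [ represented? t ] ℕ.* ν t ℕ.+ [ t ≟ 0# ] ℕ.* ν t)
          ≡⟨ ∑-cong elements split ⟩
        ∑ elements ν
          ≡⟨ ∑-swap elements triples _ ⟩
        ∑ triples (λ x → ∑ elements (λ t → [ ‖ x ‖ ≟ t ]))
          ≡⟨ ∑-cong triples (λ x → ≡.trans (∑-cong elements (λ t → []-cong (‖ x ‖ ≟ t) (t ≟ ‖ x ‖) ≡.sym ≡.sym))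
               (EnumSummation.count-≡ ℕP.+-*-commutativeSemiring (fieldEnumeration K) (‖ x ‖))) ⟩
        ∑ triples (λ _ → 1)
          ≡⟨ ≡.trans (∑-length triples) length-triples ⟩
        N³ ∎
        where
        open ≡.≡-Reasoning
        split : ∀ t → [ represented? t ] ℕ.* ν t ℕ.+ [ t ≟ 0# ] ℕ.* ν t ≡ ν t
        split t = ≡.trans (≡.sym (ℕP.*-distribʳ-+ (ν t) [ represented? t ] [ t ≟ 0# ])) (go (t ≟ 0#) (1 ℕP.≤? ν t))
          where
          go : (P? : Dec (t ≡ 0#)) (Q? : Dec (1 ℕ.≤ ν t)) → ([ ¬? P? ×-dec Q? ] ℕ.+ [ P? ]) ℕ.* ν t ≡ ν t
          go (yes _) Q? = ℕP.+-identityʳ (ν t)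
          go (no _) (yes _) = ℕP.+-identityʳ (ν t)
          go (no _) (no ν≱1) = ≡.sym (ℕP.n≤0⇒n≡0 (ℕP.≤-pred (ℕP.≰⇒> ν≱1)))

      S₁²≤ : S₁ ℕ.* S₁ ℕ.≤ length values ℕ.* second-moment
      S₁²≤ = ℕP.≤-trans (NonNeg-reflect {S₁ ℕ.* S₁} {length values ℕ.* ∑ values (λ t → ν t ℕ.* ν t)} inR) (ℕP.*-monoʳ-≤ (length values) bound)
        where
        open NatCount K M
        bound : ∑ values (λ t → ν t ℕ.* ν t) ℕ.≤ second-moment
        bound = ℕP.≤-trans (ℕP.≤-reflexive (∑-filter represented? elements _)) (∑-mono elements (λ t →
          ℕP.*-monoˡ-≤ (ν t ℕ.* ν t) (ℕP.≤-trans (ℕP.≤-reflexive ([]-× (nonzero? t) (1 ℕP.≤? ν t)))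
            (ℕP.≤-trans (ℕP.*-monoʳ-≤ [ nonzero? t ] ([]≤1 (1 ℕP.≤? ν t))) (ℕP.≤-reflexive (ℕP.*-identityʳ [ nonzero? t ]))))))
          where
          []≤1 : ∀ {P : Set} (P? : Dec P) → [ P? ] ℕ.≤ 1
          []≤1 (yes _) = ℕP.≤-refl
          []≤1 (no _) = ℕ.z≤n
        inR : nat (S₁ ℕ.* S₁) O.≼ nat (length values ℕ.* ∑ values (λ t → ν t ℕ.* ν t))
        inR = O.begin
          nat (S₁ ℕ.* S₁)
            O.≈⟨ O.≈-trans (nat-* S₁ S₁) (O.≈-sym (norm-real (conj-nat S₁))) ⟩
          norm (nat S₁)
            O.≈⟨ O.norm-cong (nat-∑ values ν) ⟩
          norm (O.∑ values (λ t → nat (ν t)))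
            O.≲⟨ cauchy-schwarz-1 values (λ t → nat (ν t)) ⟩
          nat (length values) O.* O.∑ values (λ t → norm (nat (ν t)))
            O.≈⟨ O.*-congˡ (O.≈-trans (O.∑-cong values (λ t → O.≈-trans (norm-real (conj-nat (ν t))) (O.≈-sym (nat-* (ν t) (ν t)))))
                 (O.≈-sym (nat-∑ values (λ t → ν t ℕ.* ν t)))) ⟩
          nat (length values) O.* nat (∑ values (λ t → ν t ℕ.* ν t))
            O.≈⟨ nat-* (length values) (∑ values (λ t → ν t ℕ.* ν t)) ⟨
          nat (length values ℕ.* ∑ values (λ t → ν t ℕ.* ν t)) O.∎

      many-values : size ℕ.≤ 192 ℕ.* length values
      many-values = RootExtraction.conclusion {size} {N} {S₁} {second-moment} {ν 0#} {length values} {size ℕ.^ k} (size≥2 K) N≥1 4q^k≤N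
        S₁+ν₀ ν-0-bound (second-moment-bound N≥1 H q^d≤N²) S₁²≤

      ν≥1⇒InΔ₃ : ∀ {t} → 1 ℕ.≤ ν t → InΔ₃ E t
      ν≥1⇒InΔ₃ {t} ν≥1 = go (filter (λ x → ‖ x ‖ ≟ t) triples) (λ x∈ → ∈-filter⁻ (λ x → ‖ x ‖ ≟ t) {xs = triples} x∈)
        (≡.subst (1 ℕ.≤_) (count (λ x → ‖ x ‖ ≟ t) triples) ν≥1)
        where
        go : ∀ xs → (∀ {x} → x ∈ xs → x ∈ triples × ‖ x ‖ ≡ t) → 1 ℕ.≤ length xs → InΔ₃ E t
        go (x ∷ _) sound _ with sound (here refl)
        ... | x∈ , ‖x‖≡t with ∈-cartesianProductWith⁻ _⊕_ pairs E x∈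
        ... | y , x₃ , y∈ , x₃∈ , refl with ∈-cartesianProductWith⁻ _⊕_ E E y∈
        ... | x₁ , x₂ , x₁∈ , x₂∈ , refl = x₁ , x₂ , x₃ , x₁∈ , x₂∈ , x₃∈ , ‖x‖≡t

    conclusion : 4 ℕ.^ b ℕ.* size ℕ.^ a ℕ.≤ length E ℕ.^ b → ∃[ L ] (Unique L × All (InΔ₃ E) L × size ℕ.≤ 192 ℕ.* length L)
    conclusion h = values , filter⁺ represented? distinct , All.map (λ { (_ , ν≥1) → ν≥1⇒InΔ₃ ν≥1 }) (all-filter represented? elements) , many-values
      where open Conclusion (characterRing K) h

-- Assembly of the final statement

-- Named as a predicate of the dimension, so that it can be transported from the form (4 + j) + (4 +
-- j) to an arbitrary even d ≥ 8.
ManyNorms : ℕ → Set₁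
ManyNorms d =
  ∃[ c ] (0ℚ ℚ.< c × c ℚ.≤ 1ℚ ×
    ((ε : ℚ) → 0ℚ ℚ.< ε →
      ∃[ C ] (0ℚ ℚ.< C ×
        ((K : FiniteField) → FiniteField.CharNot2 K →
          (E : List (Vec (FiniteField.F K) d)) → Unique E →
          AtLeastCPow (ℕ→ℚ (length E)) C (FiniteField.size K) (expo d ℚ.+ ε) →
          ∃[ L ] (Unique L × All (FiniteField.InΔ₃ K E) L ×
            c ℚ.* ℕ→ℚ (FiniteField.size K) ℚ.≤ ℕ→ℚ (length L))))))

manyNorms : ∀ j → ManyNorms (Exponent.d j)
manyNorms j = c , toWitness {a? = 0ℚ ℚP.<? c} _ , toWitness {a? = c ℚP.≤? 1ℚ} _ , λ ε 0<ε →
  -- The constant 4 is the one in 4qᵏ ≤ N, which keeps ν(0) below three quarters of all triples.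
  ℕ→ℚ 4 , toWitness {a? = 0ℚ ℚP.<? ℕ→ℚ 4} _ , λ K char≢2 E unique h →
    let L , L-unique , L⊆Δ₃ , size≤ = conclusion K char≢2 E unique (large K char≢2 E unique ε 0<ε h)
    in L , L-unique , L⊆Δ₃ , scale (FiniteField.size K) (length L) size≤
  where
  open Exponent j
  c : ℚ
  c = (+ 1) ℚ./ 192
  scale : ∀ q l → q ℕ.≤ 192 ℕ.* l → c ℚ.* ℕ→ℚ q ℚ.≤ ℕ→ℚ l
  scale q l q≤ = ℚP.≤-trans (ℚP.*-monoˡ-≤-nonNeg c (Rationals.ℕ→ℚ-mono q≤)) (ℚP.≤-reflexive (begin
    c ℚ.* ℕ→ℚ (192 ℕ.* l)             ≡⟨ ≡.cong (c ℚ.*_) (Rationals.ℕ→ℚ-* 192 l) ⟨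
    c ℚ.* (ℕ→ℚ 192 ℚ.* ℕ→ℚ l)         ≡⟨ ℚP.*-assoc c (ℕ→ℚ 192) (ℕ→ℚ l) ⟨
    c ℚ.* ℕ→ℚ 192 ℚ.* ℕ→ℚ l           ≡⟨ ℚP.*-identityˡ (ℕ→ℚ l) ⟩
    ℕ→ℚ l                             ∎))
    where open ≡.≡-Reasoning

theorem1p4 : (d : ℕ) → 2 ∣ d → 8 ≤ d →
    ∃[ c ] (0ℚ ℚ.< c × c ℚ.≤ 1ℚ ×
    ((ε : ℚ) → 0ℚ ℚ.< ε →
    ∃[ C ] (0ℚ ℚ.< C ×
    ((K : FiniteField) → FiniteField.CharNot2 K →
    (E : List (Vec (FiniteField.F K) d)) → Unique E →
    AtLeastCPow (ℕ→ℚ (length E)) C (FiniteField.size K) (expo d ℚ.+ ε) →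
    ∃[ L ] (Unique L × All (FiniteField.InΔ₃ K E) L ×
    c ℚ.* ℕ→ℚ (FiniteField.size K) ℚ.≤ ℕ→ℚ (length L))))))
theorem1p4 d (divides k d≡k*2) 8≤d = ≡.subst ManyNorms d≡ (manyNorms j)
  where
  4≤k : 4 ≤ k
  4≤k = ℕP.*-cancelʳ-≤ 4 k 2 (≡.subst (8 ≤_) d≡k*2 8≤d)
  j : ℕ
  j = proj₁ (ℕP.m≤n⇒∃[o]m+o≡n 4≤k)
  d≡ : Exponent.d j ≡ d
  d≡ = ≡.trans (≡.cong₂ ℕ._+_ 4+j≡k 4+j≡k) (≡.sym (≡.trans d≡k*2 (≡.trans (ℕP.*-comm k 2) (≡.cong (k ℕ.+_) (ℕP.+-identityʳ k)))))
    where
    4+j≡k : 4 ℕ.+ j ≡ k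
    4+j≡k = proj₂ (ℕP.m≤n⇒∃[o]m+o≡n 4≤k)
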